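{- Let $T$ be a tree with $\alpha(T)\ge 3$ which has no perfect matching and is not a subdivided star. Then almost every $T$-free graph $G$ has a partition of $V(G)$ into $\alpha(T)-1$ cliques.
   Context: Graphs are finite, simple, labeled on $[n]$. $\alpha(\cdot)$ is the stability number. A graph is $T$-free if it has no induced subgraph isomorphic to $T$. "Almost every $T$-free graph" means the proportion of $T$-free graphs on $[n]$ failing the property tends to $0$ as $n\to\infty$. A star is a tree in which all but one vertex are leaves; a subdivided star is a tree obtained from a star by subdividing each edge exactly once. -}

module Defs where

open import Data.Nat using (ℕ; zero; suc; _+_; _∸_; _≤_)
open import Data.Fin using (Fin; zero; suc; inject₁; fromℕ)
open import Data.Vec using (Vec; lookup)
open import Data.Bool using (Bool; true; false)
open import Data.Unit using (⊤; tt)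
open import Data.Product using (_×_; _,_; Σ; ∃; ∃-syntax)
open import Data.Sum using (_⊎_; inj₁; inj₂)
open import Data.Empty using (⊥)
open import Relation.Nullary using (¬_)
open import Relation.Binary.PropositionalEquality using (_≡_)
open import Function.Definitions using (Injective)
open import Function.Bundles using (_↣_; _↔_)
open import Data.Refinement using (Refinement)

-- Labelled simple graphs on vertex set Fin n (i.e. [n]).
-- A code for a graph on Fin (suc n) is a code for a graph on the
-- vertices 1..n (the `suc i`) together with the adjacency vector of the
-- vertex 0 to them.  This is a bijective encoding of the simple graphs on
-- Fin n, so counting codes = counting labelled graphs.

Code : ℕ → Set
Code zero    = ⊤
Code (suc n) = Code n × Vec Bool n

adjB : ∀ {n} → Code n → Fin n → Fin n → Bool
adjB {suc n} (c , v) zero    zero    = false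
adjB {suc n} (c , v) zero    (suc j) = lookup v j
adjB {suc n} (c , v) (suc i) zero    = lookup v i
adjB {suc n} (c , v) (suc i) (suc j) = adjB c i j

Adj : ∀ {n} → Code n → Fin n → Fin n → Set
Adj G u v = adjB G u v ≡ true

ContainsInduced : ∀ {m n} → Code m → Code n → Set
ContainsInduced {m} {n} T G =
  Σ (Fin m → Fin n) λ f → Injective _≡_ _≡_ f × (∀ u v → adjB G (f u) (f v) ≡ adjB T u v)

Free : ∀ {m n} → Code m → Code n → Set
Free T G = ¬ ContainsInduced T G

StableOfSize : ∀ {n} → Code n → ℕ → Set
StableOfSize {n} G k =
  Σ (Fin k → Fin n) λ f → Injective _≡_ _≡_ f × (∀ i j → ¬ Adj G (f i) (f j))

IsStabilityNumber : ∀ {n} → Code n → ℕ → Set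
IsStabilityNumber G a = StableOfSize G a × ¬ StableOfSize G (suc a)

data Reach {n} (G : Code n) : Fin n → Fin n → Set where
  here  : ∀ {u} → Reach G u u
  there : ∀ {u w v} → Adj G u w → Reach G w v → Reach G u v

Connected : ∀ {n} → Code n → Set
Connected G = ∀ u v → Reach G u v

HasCycle : ∀ {n} → Code n → Set
HasCycle {n} G = ∃[ l ] Σ (Fin (suc (suc (suc l))) → Fin n) λ c →
  Injective _≡_ _≡_ c ×
  (∀ (i : Fin (suc (suc l))) → Adj G (c (inject₁ i)) (c (suc i))) ×
  Adj G (c (fromℕ (suc (suc l)))) (c zero)

IsTree : ∀ {n} → Code n → Set
IsTree {n} G = 1 ≤ n × Connected G × ¬ HasCycle G

HasPerfectMatching : ∀ {n} → Code n → Set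
HasPerfectMatching {n} G = Σ (Fin n → Fin n) λ p →
  (∀ v → Adj G v (p v)) × (∀ v → p (p v) ≡ v)

-- Subdivided stars.  The subdivided star with k legs has vertex set
-- ⊤ ⊎ (Fin k × Bool): centre inj₁ tt, middle vertices inj₂ (i , false),
-- leaves inj₂ (i , true).

SSVertex : ℕ → Set
SSVertex k = ⊤ ⊎ (Fin k × Bool)

SSAdj : ∀ {k} → SSVertex k → SSVertex k → Set
SSAdj (inj₁ _)          (inj₁ _)          = ⊥
SSAdj (inj₁ _)          (inj₂ (j , false)) = ⊤
SSAdj (inj₁ _)          (inj₂ (j , true))  = ⊥
SSAdj (inj₂ (i , false)) (inj₁ _)          = ⊤
SSAdj (inj₂ (i , true))  (inj₁ _)          = ⊥
SSAdj (inj₂ (i , false)) (inj₂ (j , false)) = ⊥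
SSAdj (inj₂ (i , false)) (inj₂ (j , true))  = i ≡ j
SSAdj (inj₂ (i , true))  (inj₂ (j , false)) = i ≡ j
SSAdj (inj₂ (i , true))  (inj₂ (j , true))  = ⊥

IsSubdividedStar : ∀ {n} → Code n → Set
IsSubdividedStar {n} G = ∃[ k ] Σ (Fin n ↔ SSVertex k) λ φ →
  ∀ u v → (Adj G u v → SSAdj (Function.Bundles.Inverse.to φ u) (Function.Bundles.Inverse.to φ v))
        × (SSAdj (Function.Bundles.Inverse.to φ u) (Function.Bundles.Inverse.to φ v) → Adj G u v)

-- Partition of V(G) into r cliques (parts may be empty): an assignment of
-- each vertex to one of r parts, each part being a clique.

CliquePartition : ∀ {n} → Code n → ℕ → Set
CliquePartition {n} G r = Σ (Fin n → Fin r) λ part →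
  ∀ u v → part u ≡ part v → ¬ (u ≡ v) → Adj G u v

-- Sets of graphs (proof components irrelevant, so elements = graphs)

FreeGraphs : ∀ {m} → Code m → ℕ → Set
FreeGraphs T n = Refinement (Code n) (Free T)

BadFreeGraphs : ∀ {m} → Code m → (∀ {n} → Code n → Set) → ℕ → Set
BadFreeGraphs T P n = Refinement (Code n) (λ G → Free T G × ¬ P G)

-- Almost every T-free graph has P: for every k there is N such that for
-- all n ≥ N,  k · #{bad T-free graphs on [n]} ≤ #{T-free graphs on [n]},
-- cardinality comparison being witnessed by an injection.
AlmostEveryFree : ∀ {m} → Code m → (∀ {n} → Code n → Set) → Set
AlmostEveryFree T P = ∀ (k : ℕ) → ∃[ N ] ∀ n → N ≤ n →
  (Fin k × BadFreeGraphs T P n) ↣ FreeGraphs T n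

-- Write R = α(T) - 1.  A new vertex of an R-clique-partitionable graph on n vertices has at least
-- 2^(n - n/R) neighbourhoods, so by induction on n it suffices that every other large T-free graph
-- is compressible: some of its vertices (boundedly many, K) have, given the rest of the graph and
-- cheap additional information, at most 2^(K(n - n/R) - εn) possible neighbourhoods.  In an
-- incompressible graph a set of vertices cannot be almost homogeneous to more than about n/R
-- vertices.  Starting from almost homogeneous sets (Rödl) and enlarging the set to which they are
-- homogeneous as long as possible, one finds R sets that are pairwise generic.  Embedding T
-- vertex by vertex shows that they are almost cliques and that each vertex is almost complete to
-- exactly one of them; this yields R almost cliques which nearly cover the graph and which, by
-- incompressibility, are generic on every linear scale.  A second round of embeddings then forces
-- each vertex into a unique part and makes all the parts cliques.  The partitions of T needed
-- for the embeddings come from a clique cover of size α(T): it contains a single vertex since T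
-- has no perfect matching, and T is not a subdivided star.
module Submission where

open import Defs
open import Data.Bool using (Bool; true; false; not; _∧_; _∨_; if_then_else_) renaming (_≟_ to _≟B_)
open import Data.Bool.Properties using (not-involutive)
open import Data.Empty using (⊥; ⊥-elim)
open import Data.Fin using (Fin; zero; suc; toℕ; fromℕ; inject₁; punchIn; punchOut; fromℕ<; combine; inject≤)
open import Data.Fin.Properties using (punchIn-punchOut; punchOut-punchIn; punchInᵢ≢i; punchIn-injective; punchOut-injective; punchOut-cong; toℕ-injective; toℕ<n; suc-injective; any?; all?; pigeonhole; toℕ-fromℕ<; combine-injective; inject≤-injective) renaming (_≟_ to _≟F_)
open import Data.Irrelevant using ([_])
open import Data.List using (List; []; _∷_; length; map; _++_; filter; allFin; lookup; cartesianProduct)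
open import Data.List.Membership.Propositional using (_∈_; find; lose)
open import Data.List.Membership.Propositional.Properties using (∈-filter⁺; ∈-filter⁻; ∈-allFin; ∈-lookup; ∈-cartesianProduct⁺; ∈-map⁺; ∈-map⁻; ∈-++⁺ˡ; ∈-++⁺ʳ; ∈-++⁻)
open import Data.List.Properties using (length-filter; length-tabulate; length-map; length-++)
open import Data.List.Relation.Unary.All using (All; []; _∷_)
open import Data.List.Relation.Unary.All.Properties using (all-filter)
open import Data.List.Relation.Unary.AllPairs using (AllPairs; []; _∷_)
open import Data.List.Relation.Unary.Any using (here; there)
open import Data.List.Relation.Unary.Unique.Propositional using (Unique)
open import Data.List.Relation.Unary.Unique.Propositional.Properties using () renaming (filter⁺ to Unique-filter⁺; allFin⁺ to Unique-allFin⁺; cartesianProduct⁺ to Unique-cartesianProduct⁺; map⁺ to Unique-map⁺; ++⁺ to Unique-++⁺)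
open import Data.Maybe using (Maybe; just; nothing)
open import Data.Nat using (ℕ; zero; suc; _+_; _*_; _∸_; _^_; _≤_; _<_; z≤n; s≤s; _/_; _%_; s≤s⁻¹; NonZero; nonZero; >-nonZero) renaming (_≟_ to _≟ℕ_)
open import Data.Nat.DivMod using (m≡m%n+[m/n]*n; m/n*n≤m; m%n<n; m≥n⇒m/n>0; m*n/n≡m; /-monoˡ-≤; m/n≤m; /-mono-≤)
open import Data.Nat.Properties hiding (suc-injective; _≟_)
open import Data.Nat.Tactic.RingSolver using (solve-∀)
open import Data.Product using (_×_; _,_; Σ; ∃; proj₁; proj₂)
open import Data.Product.Properties using () renaming (≡-dec to ×-≡-dec)
open import Data.Refinement using (value; _,_)
open import Data.Sum using (_⊎_; inj₁; inj₂; [_,_]′)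
open import Data.Unit using (⊤; tt)
open import Data.Vec using (Vec; []; _∷_) renaming (lookup to vlookup; tabulate to vtabulate; map to vmap)
open import Data.Vec.Properties using (lookup∘tabulate; tabulate-cong; tabulate∘lookup) renaming (≡-dec to Vec-≡-dec)
open import Function using (_∘_; id; const)
open import Function.Bundles using (_↣_; mk↔ₛ′; mk↣)
open import Function.Definitions using (Injective)
open import Relation.Binary.PropositionalEquality using (_≡_; _≢_; refl; sym; trans; cong; cong₂; subst; subst₂)
open import Relation.Nullary using (¬_; Dec; yes; no)
open import Relation.Nullary.Decidable using (⌊_⌋; _×-dec_; _⊎-dec_; ¬?; decidable-stable; _→-dec_; map′; recompute)
import Data.List.Relation.Unary.All
module AllM = Data.List.Relation.Unary.All
import Data.List.Relation.Unary.Any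
module AnyM = Data.List.Relation.Unary.Any

-- A prediction of a neighbourhood that covers `n/R + n/η` vertices with few errors saves about
-- `n/η` bits against the growth of the partitionable graphs. Writing down an arbitrary prediction
-- costs up to `2n` bits, so it pays only when `K` vertices obey the same one, with `K` large in
-- terms of `η`. Hence the first round cannot exclude boundedly many exceptional vertices at any
-- scale. The second round treats a single vertex, and for that the prediction itself has to be
-- cheap: the near-cliques of the first round are replaced by common neighbourhoods of boundedly
-- many vertices, whose description costs only a multiple of log n bits. Both kinds of compressible
-- graphs are put into explicit lists, and a large bad graph outside all lists, for all `η` up to a
-- bound `H`, is refuted. Membership in the lists is decidable, so the structural part only has to
-- derive a contradiction, and many of its existence statements are doubly negated, in the form
-- `(... → ⊥) → ⊥`.

-- A certificate for x ≤ y: the hypotheses combined into one inequality l ≤ r, and a slack s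
-- such that the ring solver can check the remaining identity.
certify : ∀ {x y l r} s → l ≤ r → x + r + s ≡ y + l → x ≤ y
certify {x} {y} {l} {r} s l≤r eq = +-cancelʳ-≤ r x y (begin
  x + r      ≤⟨ m≤m+n (x + r) s ⟩
  x + r + s  ≡⟨ eq ⟩
  y + l      ≤⟨ +-monoʳ-≤ y l≤r ⟩
  y + r      ∎)
  where open ≤-Reasoning

infixl 6 _⊕_
_⊕_ : ∀ {a b c d} → a ≤ b → c ≤ d → a + c ≤ b + d
_⊕_ = +-mono-≤

infixl 7 _⊗_
_⊗_ : ∀ k {a b} → a ≤ b → k * a ≤ k * b
k ⊗ p = *-monoʳ-≤ k p

-- Boolean predicates and their cardinalities

Pred : ℕ → Set
Pred n = Fin n → Bool

infix 4 _⊑_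
_⊑_ : ∀ {n} → Pred n → Pred n → Set
S ⊑ R = ∀ {x} → S x ≡ true → R x ≡ true

infixr 7 _∩_
infixr 6 _∪_
_∩_ _∪_ : ∀ {n} → Pred n → Pred n → Pred n
(S ∩ R) x = S x ∧ R x
(S ∪ R) x = S x ∨ R x

∁ : ∀ {n} → Pred n → Pred n
∁ S x = not (S x)

∧-intro : ∀ {a b} → a ≡ true → b ≡ true → a ∧ b ≡ true
∧-intro refl refl = refl

∧-left : ∀ {a b} → a ∧ b ≡ true → a ≡ true
∧-left {true} _ = refl

∧-right : ∀ {a b} → a ∧ b ≡ true → b ≡ true
∧-right {true} p = p

∨-introˡ : ∀ {a b} → a ≡ true → a ∨ b ≡ true
∨-introˡ refl = refl

∨-introʳ : ∀ {a b} → b ≡ true → a ∨ b ≡ true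
∨-introʳ {true} _ = refl
∨-introʳ {false} p = p

∨-elim : ∀ {a b} → a ∨ b ≡ true → a ≡ true ⊎ b ≡ true
∨-elim {true} _ = inj₁ refl
∨-elim {false} p = inj₂ p

not-intro : ∀ {a} → (a ≡ true → ⊥) → not a ≡ true
not-intro {false} _ = refl
not-intro {true} f = ⊥-elim (f refl)

not-elim : ∀ {a} → not a ≡ true → a ≡ true → ⊥
not-elim {true} () refl

dec-intro : ∀ {P : Set} {d : Dec P} → P → ⌊ d ⌋ ≡ true
dec-intro {d = yes _} _ = refl
dec-intro {d = no ¬p} p = ⊥-elim (¬p p)

dec-elim : ∀ {P : Set} {d : Dec P} → ⌊ d ⌋ ≡ true → P
dec-elim {d = yes p} _ = p

true≢false : true ≡ false → ⊥
true≢false ()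

b2n : Bool → ℕ
b2n true = 1
b2n false = 0

b2n-mono : ∀ {a b} → (a ≡ true → b ≡ true) → b2n a ≤ b2n b
b2n-mono {false} _ = z≤n
b2n-mono {true} f = ≤-reflexive (cong b2n (sym (f refl)))

opaque
  sumF : ∀ {n} → (Fin n → ℕ) → ℕ
  sumF {zero} g = 0
  sumF {suc n} g = g zero + sumF (g ∘ suc)

  sumF-suc : ∀ {n} (g : Fin (suc n) → ℕ) → sumF g ≡ g zero + sumF (g ∘ suc)
  sumF-suc g = refl

  sumF-mono : ∀ {n} {g h : Fin n → ℕ} → (∀ x → g x ≤ h x) → sumF g ≤ sumF h
  sumF-mono {zero} _ = z≤n
  sumF-mono {suc n} p = p zero ⊕ sumF-mono (p ∘ suc)

  sumF-cong : ∀ {n} {g h : Fin n → ℕ} → (∀ x → g x ≡ h x) → sumF g ≡ sumF h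
  sumF-cong {zero} _ = refl
  sumF-cong {suc n} p = cong₂ _+_ (p zero) (sumF-cong (p ∘ suc))

  sumF-+ : ∀ {n} (g h : Fin n → ℕ) → sumF (λ x → g x + h x) ≡ sumF g + sumF h
  sumF-+ {zero} g h = refl
  sumF-+ {suc n} g h rewrite sumF-+ (g ∘ suc) (h ∘ suc) = interchange (g zero) (h zero) _ _
    where
    interchange : ∀ a b c d → a + b + (c + d) ≡ a + c + (b + d)
    interchange = solve-∀

  sumF-* : ∀ {n} k (g : Fin n → ℕ) → sumF (λ x → k * g x) ≡ k * sumF g
  sumF-* {zero} k g = sym (*-zeroʳ k)
  sumF-* {suc n} k g rewrite sumF-* k (g ∘ suc) = sym (*-distribˡ-+ k (g zero) _)

  sumF-0 : ∀ n → sumF {n} (λ _ → 0) ≡ 0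
  sumF-0 zero = refl
  sumF-0 (suc n) = sumF-0 n

  sumF-swap : ∀ {m n} (g : Fin m → Fin n → ℕ) →
    sumF (λ x → sumF (g x)) ≡ sumF (λ y → sumF (λ x → g x y))
  sumF-swap {zero} {n} g = sym (sumF-0 n)
  sumF-swap {suc m} g rewrite sumF-swap (g ∘ suc) = sym (sumF-+ (g zero) _)

  sumF-const : ∀ n k → sumF {n} (λ _ → k) ≡ n * k
  sumF-const zero k = refl
  sumF-const (suc n) k = cong (k +_) (sumF-const n k)

  sumF-member : ∀ {n} (g : Fin n → ℕ) x → g x ≤ sumF g
  sumF-member g zero = m≤m+n _ _
  sumF-member g (suc x) = ≤-trans (sumF-member (g ∘ suc) x) (m≤n+m _ (g zero))

opaque
  # : ∀ {n} → Pred n → ℕ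
  # S = sumF (b2n ∘ S)

  #-mono : ∀ {n} {S R : Pred n} → S ⊑ R → # S ≤ # R
  #-mono p = sumF-mono (λ x → b2n-mono p)

  #-cong : ∀ {n} {S R : Pred n} → (∀ x → S x ≡ R x) → # S ≡ # R
  #-cong p = sumF-cong (λ x → cong b2n (p x))

  #≤n : ∀ {n} (S : Pred n) → # S ≤ n
  #≤n {n} S = ≤-trans (sumF-mono (λ x → ≤1 (S x))) (≤-reflexive (trans (sumF-const n 1) (*-identityʳ n)))
    where
    ≤1 : ∀ b → b2n b ≤ 1
    ≤1 true = ≤-refl
    ≤1 false = z≤n

  #-full : ∀ n → # {n} (λ _ → true) ≡ n
  #-full n = trans (sumF-const n 1) (*-identityʳ n)

  #-split : ∀ {n} (S R : Pred n) → # S ≡ # (S ∩ R) + # (S ∩ ∁ R)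
  #-split S R = trans (sumF-cong (λ x → pt (S x) (R x))) (sumF-+ _ _)
    where
    pt : ∀ a b → b2n a ≡ b2n (a ∧ b) + b2n (a ∧ not b)
    pt false _ = refl
    pt true true = refl
    pt true false = refl

  #-∪ : ∀ {n} (S R : Pred n) → # (S ∪ R) ≤ # S + # R
  #-∪ S R = ≤-trans (sumF-mono (λ x → pt (S x) (R x))) (≤-reflexive (sumF-+ _ _))
    where
    pt : ∀ a b → b2n (a ∨ b) ≤ b2n a + b2n b
    pt false _ = ≤-refl
    pt true b = s≤s z≤n

  #-⊎ : ∀ {n} (S R : Pred n) → (∀ x → S x ≡ true → R x ≡ true → ⊥) → # S + # R ≤ # (S ∪ R)
  #-⊎ S R dis = ≤-trans (≤-reflexive (sym (sumF-+ _ _))) (sumF-mono (λ x → pt (S x) (R x) (dis x)))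
    where
    pt : ∀ a b → (a ≡ true → b ≡ true → ⊥) → b2n a + b2n b ≤ b2n (a ∨ b)
    pt false b _ = ≤-refl
    pt true false _ = ≤-refl
    pt true true d = ⊥-elim (d refl refl)

  #-cover : ∀ {n} {S P R : Pred n} → (∀ x → S x ≡ true → P x ≡ true ⊎ R x ≡ true) → # S ≤ # P + # R
  #-cover {S = S} {P} {R} c = ≤-trans (#-mono {R = P ∪ R} λ {x} s → [ ∨-introˡ , ∨-introʳ ]′ (c x s)) (#-∪ P R)

opaque
  unfolding sumF #

  witness : ∀ {n} (S : Pred n) → 0 < # S → ∃ λ x → S x ≡ true
  witness {suc n} S p with S zero in eq
  ... | true = zero , eq
  ... | false with witness (S ∘ suc) p
  ... | x , q = suc x , q

witness-diff : ∀ {n} (S R : Pred n) → # R < # S → ∃ λ x → S x ≡ true × R x ≡ false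
witness-diff S R p with witness (S ∩ ∁ R) (+-cancelˡ-< (# R) 0 _ (begin-strict
    # R + 0                      ≡⟨ +-identityʳ _ ⟩
    # R                          <⟨ p ⟩
    # S                          ≡⟨ #-split S R ⟩
    # (S ∩ R) + # (S ∩ ∁ R)      ≤⟨ #-mono {R = R} (λ {x} q → ∧-right {S x} q) ⊕ ≤-refl ⟩
    # R + # (S ∩ ∁ R)            ∎))
  where open ≤-Reasoning
... | x , q with R x in eq | ∧-left {S x} q | ∧-right {S x} q
... | false | s | _ = x , s , eq

#-zero : ∀ {n} (S : Pred n) → (∀ x → S x ≡ true → ⊥) → # S ≡ 0
#-zero S e = n≤0⇒n≡0 (≮⇒≥ (λ p → let (x , q) = witness S p in e x q))

opaque
  unfolding sumF #

  trim : ∀ {n} k (S : Pred n) → k ≤ # S → ∃ λ R → R ⊑ S × # R ≡ k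
  trim {zero} zero S p = S , id , refl
  trim {suc n} zero S p = (λ _ → false) , (λ ()) , sumF-0 n
  trim {suc n} (suc k) S p with S zero in eq
  ... | true = let (R , i , e) = trim k (S ∘ suc) (s≤s⁻¹ p) in
               (λ { zero → true ; (suc x) → R x }) , (λ { {zero} _ → eq ; {suc x} q → i q }) , cong suc e
  ... | false = let (R , i , e) = trim (suc k) (S ∘ suc) p in
               (λ { zero → false ; (suc x) → R x }) , (λ { {suc x} q → i q }) , e

  #-single : ∀ {n} (x : Fin n) → # (λ y → ⌊ y ≟F x ⌋) ≡ 1
  #-single {suc n} zero = cong suc (#-zero {n} _ (λ _ ()))
  #-single {suc n} (suc x) = trans (#-cong {n} (λ y → sd y)) (#-single x)
    where
    sd : ∀ y → ⌊ suc y ≟F suc x ⌋ ≡ ⌊ y ≟F x ⌋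
    sd y with y ≟F x
    ... | yes _ = refl
    ... | no _ = refl

#-empty : ∀ {n} → # {n} (λ _ → false) ≡ 0
#-empty = #-zero _ (λ _ ())

-- Together the sets of `bs` have fewer elements than `C`. In `total` the summand `length bs`
-- collects one unit from each strict bound, so the final comparison is strict even when `length bs`
-- equals `k`.
avoid : ∀ {n} k (C : Pred n) (bs : List (Pred n)) → All (λ b → k * # b < # C) bs →
  length bs ≤ k → 0 < # C → ∃ λ x → C x ≡ true × All (λ b → b x ≡ false) bs
avoid k C [] _ _ pos = let (x , c) = witness C pos in x , c , []
avoid {n} k C bs@(b₀ ∷ bs₀) small len pos =
  let (x , c , u) = witness-diff C (union bs) (*-cancelˡ-< k _ _ (bound b₀ bs₀ small len))
  in x , c , unAll bs u
  where
  union : List (Pred n) → Pred n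
  union [] _ = false
  union (b ∷ bs) = b ∪ union bs
  unAll : ∀ bs {x} → union bs x ≡ false → All (λ b → b x ≡ false) bs
  unAll [] _ = []
  unAll (b ∷ bs) {x} u with b x in eq
  ... | false = eq ∷ unAll bs u
  open ≤-Reasoning
  re : ∀ k a b l → k * (a + b) + suc l ≡ suc (k * a) + (k * b + l)
  re = solve-∀
  total : ∀ bs → All (λ b → k * # b < # C) bs → k * # (union bs) + length bs ≤ length bs * # C
  total [] [] = ≤-reflexive (trans (+-identityʳ _) (trans (cong (k *_) #-empty) (*-zeroʳ k)))
  total (b ∷ bs) (p ∷ ps) = begin
    k * # (b ∪ union bs) + suc (length bs)       ≤⟨ (k ⊗ #-∪ b (union bs)) ⊕ ≤-refl ⟩
    k * (# b + # (union bs)) + suc (length bs)   ≡⟨ re k (# b) (# (union bs)) (length bs) ⟩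
    suc (k * # b) + (k * # (union bs) + length bs) ≤⟨ p ⊕ total bs ps ⟩
    # C + length bs * # C ∎
  bound : ∀ b bs → All (λ b → k * # b < # C) (b ∷ bs) → length (b ∷ bs) ≤ k → k * # (union (b ∷ bs)) < k * # C
  bound b bs ps len = <-≤-trans (<-≤-trans (m<m+n _ (s≤s z≤n)) (total (b ∷ bs) ps)) (*-monoˡ-≤ (# C) len)

opaque
  unfolding #

  -- Double counting of the related pairs: their density between `B` and `H` is at most `1/(2ω)`, so
  -- at most half of `B` can exceed twice this density.
  markov : ∀ {n} ω (B H : Pred n) (R : Fin n → Fin n → Bool) → 0 < # H →
    (∀ v → H v ≡ true → 2 * ω * # (λ x → B x ∧ R x v) ≤ # B) →
    # B ≤ 2 * # (λ x → B x ∧ ⌊ ω * # (λ v → H v ∧ R x v) ≤? # H ⌋)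
  markov {n} ω B H R H>0 h = goal
    where
    open ≤-Reasoning
    deg : Fin n → ℕ
    deg x = # (λ v → H v ∧ R x v)
    good : Pred n
    good x = ⌊ ω * deg x ≤? # H ⌋
    bad : ℕ
    bad = # (B ∩ ∁ good)
    dist : ∀ a b c → b2n a * b2n (b ∧ c) ≡ b2n b * b2n (a ∧ c)
    dist true true c = refl
    dist true false c = refl
    dist false true c = refl
    dist false false c = refl
    column : ∀ v → 2 * ω * (b2n (H v) * # (λ x → B x ∧ R x v)) ≤ b2n (H v) * # B
    column v with H v in eq
    ... | true rewrite +-identityʳ (# (λ x → B x ∧ R x v)) | +-identityʳ (# B) = h v eq
    ... | false = ≤-reflexive (*-zeroʳ (2 * ω))
    total : 2 * ω * sumF (λ x → b2n (B x) * deg x) ≤ # H * # B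
    total = begin
      2 * ω * sumF (λ x → b2n (B x) * deg x)
        ≡⟨ cong (2 * ω *_) (trans (sumF-cong (λ x → sym (sumF-* (b2n (B x)) _))) (trans (sumF-swap _)
             (sumF-cong (λ v → trans (sumF-cong (λ x → dist (B x) (H v) (R x v))) (sumF-* (b2n (H v)) _))))) ⟩
      2 * ω * sumF (λ v → b2n (H v) * # (λ x → B x ∧ R x v))  ≡⟨ sym (sumF-* (2 * ω) _) ⟩
      sumF (λ v → 2 * ω * (b2n (H v) * # (λ x → B x ∧ R x v))) ≤⟨ sumF-mono column ⟩
      sumF (λ v → b2n (H v) * # B)  ≡⟨ trans (sumF-cong (λ v → *-comm (b2n (H v)) (# B))) (trans (sumF-* (# B) _) (*-comm (# B) _)) ⟩
      # H * # B ∎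
    row : ∀ x → # H * b2n ((B ∩ ∁ good) x) ≤ ω * (b2n (B x) * deg x)
    row x with B x
    ... | false = ≤-trans (≤-reflexive (*-zeroʳ (# H))) z≤n
    ... | true with ω * deg x ≤? # H
    ... | yes _ = ≤-trans (≤-reflexive (*-zeroʳ (# H))) z≤n
    ... | no ¬p = ≤-trans (≤-reflexive (*-identityʳ (# H))) (≤-trans (≰⇒≥ ¬p) (≤-reflexive (cong (ω *_) (sym (+-identityʳ _)))))
    badBound : 2 * bad ≤ # B
    badBound = *-cancelˡ-≤ (# H) ⦃ >-nonZero H>0 ⦄ (begin
      # H * (2 * bad)   ≡⟨ shuffle (# H) bad ⟩
      2 * (# H * bad)   ≡⟨ cong (2 *_) (sym (sumF-* (# H) _)) ⟩
      2 * sumF (λ x → # H * b2n ((B ∩ ∁ good) x)) ≤⟨ 2 ⊗ sumF-mono row ⟩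
      2 * sumF (λ x → ω * (b2n (B x) * deg x)) ≡⟨ trans (cong (2 *_) (sumF-* ω _)) (sym (*-assoc 2 ω _)) ⟩
      2 * ω * sumF (λ x → b2n (B x) * deg x)   ≤⟨ total ⟩
      # H * # B ∎)
      where
      shuffle : ∀ n b → n * (2 * b) ≡ 2 * (n * b)
      shuffle = solve-∀
    goal : # B ≤ 2 * # (B ∩ good)
    goal = certify 0 badBound (trans (cong (λ z → z + z + 0) (#-split B good)) (re (# (B ∩ good)) bad))
      where
      re : ∀ g b → (g + b) + (g + b) + 0 ≡ 2 * g + 2 * b
      re = solve-∀

-- Graphs and greedy embedding

record Graph (n : ℕ) : Set where
  field
    E : Fin n → Fin n → Bool
    E-sym : ∀ x y → E x y ≡ E y x
    E-irr : ∀ x → E x x ≡ false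
open Graph

-- The vertex `x` lies neither in `nb G true x` nor in `nb G false x`. Passing from one of them to
-- the complement of the other therefore costs one vertex, which is the origin of the recurring
-- summand 1.
nb : ∀ {n} → Graph n → Bool → Fin n → Pred n
nb G b x z = not ⌊ z ≟F x ⌋ ∧ ⌊ E G x z ≟B b ⌋

nb-intro : ∀ {n} (G : Graph n) {b x z} → z ≢ x → E G x z ≡ b → nb G b x z ≡ true
nb-intro G {b} {x} {z} z≢x e = ∧-intro (not-intro (λ p → z≢x (dec-elim {d = z ≟F x} p))) (dec-intro {d = E G x z ≟B b} e)

nb-≢ : ∀ {n} (G : Graph n) {b x z} → nb G b x z ≡ true → z ≢ x
nb-≢ G {b} {x} {z} p eq = not-elim (∧-left {not ⌊ z ≟F x ⌋} p) (dec-intro {d = z ≟F x} eq)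

nb-E : ∀ {n} (G : Graph n) {b x z} → nb G b x z ≡ true → E G x z ≡ b
nb-E G {b} {x} {z} p = dec-elim {d = E G x z ≟B b} (∧-right {not ⌊ z ≟F x ⌋} p)

nb-sym : ∀ {n} (G : Graph n) {b x z} → nb G b x z ≡ true → nb G b z x ≡ true
nb-sym G p = nb-intro G (λ e → nb-≢ G p (sym e)) (trans (E-sym G _ _) (nb-E G p))

-- Injectivity is implicit, because `nb` excludes its centre.
Contains : ∀ {m n} → Graph m → Graph n → Set
Contains {m} {n} T G = Σ (Fin m → Fin n) λ f → ∀ u v → u ≢ v → nb G (E T u v) (f u) (f v) ≡ true

module Embedding {m n : ℕ} (T : Graph m) (G : Graph n) (K : ℕ) (Λ : ℕ → ℕ) (N : Fin m → ℕ) (N>0 : ∀ t → 0 < N t) where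

  loses : ℕ → ℕ → Bool → Pred n → Pred n
  loses k N' b Q x = ⌊ k * # (Q ∩ nb G b x) <? N' ⌋

  -- Few vertices of C t lose the subset Q of C t' when Q is cut down to the prescribed
  -- (non-)neighbourhood; sizes are measured on the scales N t / Λ ℓ.
  Few : (Fin m → Pred n) → Fin m → Fin m → Set
  Few C t t' = ∀ ℓ → ℓ < K → ∀ Q → Q ⊑ C t' → N t' ≤ Λ ℓ * # Q →
    K * (Λ ℓ * # (C t ∩ loses (Λ (suc ℓ)) (N t') (E T t t') Q)) < N t

  -- Greedy embedding: the image of the first vertex `t` has to avoid, for each later `u`, the few
  -- vertices of `C t` that would shrink `C u` below `N u / Λ (suc ℓ)`. Since `Few` speaks about all
  -- subsets `Q` of a candidate set, it survives when candidate sets are cut down. The map `f₀` only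
  -- supplies values outside `L`.
  embed : ∀ L ℓ (C : Fin m → Pred n) → ℓ + length L ≤ K →
    All (λ t → N t ≤ Λ ℓ * # (C t)) L → AllPairs (λ t t' → t ≢ t' × Few C t t') L → (Fin m → Fin n) →
    Σ (Fin m → Fin n) λ f → All (λ t → C t (f t) ≡ true) L ×
      AllPairs (λ t t' → nb G (E T t t') (f t) (f t') ≡ true) L
  embed [] ℓ C _ _ _ f = f , [] , []
  embed (t ∷ L) ℓ C len (sz ∷ szs) (p ∷ ps) f₀ = f , (cond ∷ later L (proj₁ (proj₂ rest)) p) , (link L (proj₁ (proj₂ rest)) p ∷ old L (proj₂ (proj₂ rest)) (proj₁Dist L p))
    where
    ℓ<K : ℓ < K
    ℓ<K = ≤-trans (≤-trans (s≤s (m≤m+n ℓ (length L))) (≤-reflexive (sym (+-suc ℓ (length L))))) len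
    0<C : 0 < # (C t)
    0<C = *-cancelˡ-< (Λ ℓ) 0 _ (≤-trans (subst (_< N t) (sym (*-zeroʳ (Λ ℓ))) (N>0 t)) sz)
    bads : List (Fin m) → List (Pred n)
    bads = map (λ u → C t ∩ loses (Λ (suc ℓ)) (N u) (E T t u) (C u))
    bads-len : ∀ L' → length (bads L') ≡ length L'
    bads-len [] = refl
    bads-len (_ ∷ L') = cong suc (bads-len L')
    swap* : ∀ a b c → a * (b * c) ≡ b * (a * c)
    swap* = solve-∀
    bads-small : ∀ L' → All (λ u → N u ≤ Λ ℓ * # (C u)) L' → All (λ u → t ≢ u × Few C t u) L' → All (λ b → K * # b < # (C t)) (bads L')
    bads-small [] _ _ = []
    bads-small (u ∷ L') (s ∷ ss) ((_ , q) ∷ qs) =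
      *-cancelˡ-< (Λ ℓ) _ _ (<-≤-trans (subst (_< N t) (swap* K (Λ ℓ) _) (q ℓ ℓ<K (C u) id s)) sz) ∷ bads-small L' ss qs
    chosen : ∃ λ x → C t x ≡ true × All (λ b → b x ≡ false) (bads L)
    chosen = avoid K (C t) (bads L) (bads-small L szs p)
      (≤-trans (≤-reflexive (bads-len L)) (≤-trans (≤-trans (n≤1+n _) (m≤n+m _ ℓ)) len)) 0<C
    x : Fin n
    x = proj₁ chosen
    cx : C t x ≡ true
    cx = proj₁ (proj₂ chosen)
    C' : Fin m → Pred n
    C' u = C u ∩ nb G (E T t u) x
    sizes : ∀ L' → All (λ b → b x ≡ false) (bads L') → All (λ u → N u ≤ Λ (suc ℓ) * # (C' u)) L'
    sizes [] _ = []
    sizes (u ∷ L') (b ∷ bs) = ≮⇒≥ (λ q → true≢false (trans (sym (∧-intro cx (dec-intro {d = _ <? _} q))) b)) ∷ sizes L' bs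
    Few-mono : ∀ {u u'} → Few C u u' → Few C' u u'
    Few-mono {u} {u'} q k k<K Q Q⊑ big = ≤-<-trans (K ⊗ (Λ k ⊗ #-mono {S = C' u ∩ loses (Λ (suc k)) (N u') (E T u u') Q} {R = C u ∩ loses (Λ (suc k)) (N u') (E T u u') Q}
      (λ {z} r → ∧-intro {C u z} {loses (Λ (suc k)) (N u') (E T u u') Q z} (∧-left {C u z} (∧-left {C' u z} r)) (∧-right {C' u z} r))))
      (q k k<K Q (λ {z} r → ∧-left {C u' z} (Q⊑ r)) big)
    allFew : ∀ {L'} → AllPairs (λ t t' → t ≢ t' × Few C t t') L' → AllPairs (λ t t' → t ≢ t' × Few C' t t') L'
    allFew [] = []
    allFew (q ∷ qs) = go q ∷ allFew qs
      where
      go : ∀ {u L'} → All (λ u' → u ≢ u' × Few C u u') L' → All (λ u' → u ≢ u' × Few C' u u') L'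
      go [] = []
      go {u} ((d , r) ∷ rs) = (d , Few-mono {u} r) ∷ go rs
    rest : Σ (Fin m → Fin n) λ f → All (λ t → C' t (f t) ≡ true) L ×
      AllPairs (λ t t' → nb G (E T t t') (f t) (f t') ≡ true) L
    rest = embed L (suc ℓ) C' (subst (_≤ K) (+-suc ℓ (length L)) len) (sizes L (proj₂ (proj₂ chosen))) (allFew ps) f₀
    g : Fin m → Fin n
    g = proj₁ rest
    f : Fin m → Fin n
    f u with u ≟F t
    ... | yes _ = x
    ... | no _ = g u
    f-t : f t ≡ x
    f-t with t ≟F t
    ... | yes _ = refl
    ... | no q = ⊥-elim (q refl)
    f-u : ∀ {u} → t ≢ u → f u ≡ g u
    f-u {u} q with u ≟F t
    ... | yes e = ⊥-elim (q (sym e))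
    ... | no _ = refl
    cond : C t (f t) ≡ true
    cond = trans (cong (C t) f-t) cx
    later : ∀ L' → All (λ u → C' u (g u) ≡ true) L' → All (λ u → t ≢ u × Few C t u) L' → All (λ u → C u (f u) ≡ true) L'
    later [] _ _ = []
    later (u ∷ L') (c ∷ cs) ((d , _) ∷ ds) = trans (cong (C u) (f-u d)) (∧-left {C u (g u)} c) ∷ later L' cs ds
    link : ∀ L' → All (λ u → C' u (g u) ≡ true) L' → All (λ u → t ≢ u × Few C t u) L' →
      All (λ u → nb G (E T t u) (f t) (f u) ≡ true) L'
    link [] _ _ = []
    link (u ∷ L') (c ∷ cs) ((d , _) ∷ ds) =
      trans (cong₂ (nb G (E T t u)) f-t (f-u d)) (∧-right {C u (g u)} c) ∷ link L' cs ds
    proj₁Dist : ∀ L' → All (λ u → t ≢ u × Few C t u) L' → All (λ u → t ≢ u) L'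
    proj₁Dist [] _ = []
    proj₁Dist (_ ∷ L') ((d , _) ∷ ds) = d ∷ proj₁Dist L' ds
    old : ∀ L' → AllPairs (λ t t' → nb G (E T t t') (g t) (g t') ≡ true) L' → All (λ u → t ≢ u) L' →
      AllPairs (λ t t' → nb G (E T t t') (f t) (f t') ≡ true) L'
    old [] _ _ = []
    old (u ∷ L') (q ∷ qs) (d ∷ ds) = go L' q ds ∷ old L' qs ds
      where
      go : ∀ L'' → All (λ v → nb G (E T u v) (g u) (g v) ≡ true) L'' → All (λ u → t ≢ u) L'' →
        All (λ v → nb G (E T u v) (f u) (f v) ≡ true) L''
      go [] _ _ = []
      go (v ∷ L'') (r ∷ rs) (d' ∷ ds') = trans (cong₂ (nb G (E T u v)) (f-u d) (f-u d')) r ∷ go L'' rs ds'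

-- Genericity is available only from an earlier part towards a later one, so the vertices of `T`
-- have to be embedded in the order of their parts.
module Sorting {m : ℕ} (key : Fin m → ℕ) where

  Before : Fin m → Fin m → Set
  Before u v = u ≢ v × key u ≤ key v

  insert : Fin m → List (Fin m) → List (Fin m)
  insert t [] = t ∷ []
  insert t (u ∷ L) with key t ≤? key u
  ... | yes _ = t ∷ u ∷ L
  ... | no _ = u ∷ insert t L

  insert-All : ∀ {P : Fin m → Set} t L → P t → All P L → All P (insert t L)
  insert-All t [] p _ = p ∷ []
  insert-All t (u ∷ L) p (q ∷ qs) with key t ≤? key u
  ... | yes _ = p ∷ q ∷ qs
  ... | no _ = q ∷ insert-All t L p qs

  insert-sorted : ∀ t L → All (t ≢_) L → AllPairs Before L → AllPairs Before (insert t L)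
  insert-sorted t [] _ _ = [] ∷ []
  insert-sorted t (u ∷ L) (d ∷ ds) (p ∷ ps) with key t ≤? key u
  ... | yes t≤u = ((d , t≤u) ∷ AllM.zipWith (λ { (d' , (_ , k)) → d' , ≤-trans t≤u k }) (ds , p)) ∷ p ∷ ps
  ... | no t≰u = insert-All t L ((λ e → d (sym e)) , ≰⇒≥ t≰u) p ∷ insert-sorted t L ds ps

  insert-∈ : ∀ {v} t L → v ≡ t ⊎ v ∈ L → v ∈ insert t L
  insert-∈ t [] (inj₁ e) = here e
  insert-∈ t (u ∷ L) q with key t ≤? key u
  insert-∈ t (u ∷ L) (inj₁ e) | yes _ = here e
  insert-∈ t (u ∷ L) (inj₂ q) | yes _ = there q
  insert-∈ t (u ∷ L) (inj₁ e) | no _ = there (insert-∈ t L (inj₁ e))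
  insert-∈ t (u ∷ L) (inj₂ (here e)) | no _ = here e
  insert-∈ t (u ∷ L) (inj₂ (there q)) | no _ = there (insert-∈ t L (inj₂ q))

  sortBy : List (Fin m) → List (Fin m)
  sortBy [] = []
  sortBy (t ∷ L) = insert t (sortBy L)

  sortBy-All : ∀ {P : Fin m → Set} L → All P L → All P (sortBy L)
  sortBy-All [] [] = []
  sortBy-All (t ∷ L) (p ∷ ps) = insert-All t (sortBy L) p (sortBy-All L ps)

  sortBy-sorted : ∀ L → Unique L → AllPairs Before (sortBy L)
  sortBy-sorted [] [] = []
  sortBy-sorted (t ∷ L) (p ∷ ps) = insert-sorted t (sortBy L) (sortBy-All L p) (sortBy-sorted L ps)

  sortBy-∈ : ∀ {v} L → v ∈ L → v ∈ sortBy L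
  sortBy-∈ (t ∷ L) (here e) = insert-∈ t (sortBy L) (inj₁ e)
  sortBy-∈ (t ∷ L) (there q) = insert-∈ t (sortBy L) (inj₂ (sortBy-∈ L q))

  insert-length : ∀ t L → length (insert t L) ≡ suc (length L)
  insert-length t [] = refl
  insert-length t (u ∷ L) with key t ≤? key u
  ... | yes _ = refl
  ... | no _ = cong suc (insert-length t L)

  sortBy-length : ∀ L → length (sortBy L) ≡ length L
  sortBy-length [] = refl
  sortBy-length (t ∷ L) = trans (insert-length t (sortBy L)) (cong suc (sortBy-length L))

allPairs-lookup : ∀ {A : Set} {R : A → A → Set} {L u v} → AllPairs R L → u ∈ L → v ∈ L → u ≢ v → R u v ⊎ R v u
allPairs-lookup (p ∷ ps) (here refl) (here refl) d = ⊥-elim (d refl)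
allPairs-lookup (p ∷ ps) (here refl) (there v) d = inj₁ (AllM.lookup p v)
allPairs-lookup (p ∷ ps) (there u) (here refl) d = inj₂ (AllM.lookup p u)
allPairs-lookup (p ∷ ps) (there u) (there v) d = allPairs-lookup ps u v d

-- T is embedded into G with every vertex t either fixed at a prescribed vertex (ext t) or
-- placed in the candidate set C t inside the part B (pt t).  Distinct parts are generic
-- towards later parts, and inside part i all pairs but few have adjacency σ i.
module PartEmbedding {m n r : ℕ} (T : Graph m) (G : Graph n) (Λ : ℕ → ℕ)
  (Λ-double : ∀ ℓ → 2 * Λ ℓ ≤ Λ (suc ℓ)) (B : Fin r → Pred n) (N : Fin r → ℕ) (N>0 : ∀ i → 0 < N i) (σ : Fin r → Bool)
  (cross : ∀ i k → toℕ i < toℕ k → ∀ b ℓ → ℓ < m → ∀ Q → Q ⊑ B k → N k ≤ Λ ℓ * # Q →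
    m * (Λ ℓ * # (B i ∩ λ x → ⌊ Λ (suc ℓ) * # (Q ∩ nb G b x) <? N k ⌋)) < N i)
  (inner : ∀ i x → B i x ≡ true → 2 * (Λ m * # (B i ∩ ∁ (nb G (σ i) x))) ≤ N i)
  where

  Λ-mono : ∀ {k ℓ} → k ≤ ℓ → Λ k ≤ Λ ℓ
  Λ-mono {k} {zero} z≤n = ≤-refl
  Λ-mono {k} {suc ℓ} p with m≤n⇒m<n∨m≡n p
  ... | inj₁ (s≤s q) = ≤-trans (Λ-mono q) (≤-trans (m≤m+n _ _) (Λ-double ℓ))
  ... | inj₂ refl = ≤-refl

  place : (pt : Fin m → Fin r) (ext : Fin m → Maybe (Fin n)) (C : Fin m → Pred n) →
    (∀ t → ext t ≡ nothing → C t ⊑ B (pt t)) →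
    (∀ t t' y z → ext t ≡ nothing → ext t' ≡ just y → C t z ≡ true → nb G (E T t' t) y z ≡ true) →
    (∀ t → ext t ≡ nothing → N (pt t) ≤ Λ 0 * # (C t)) →
    (∀ t t' → ext t ≡ nothing → ext t' ≡ nothing → t ≢ t' → pt t ≡ pt t' → E T t t' ≡ σ (pt t)) →
    (∀ t t' y y' → ext t ≡ just y → ext t' ≡ just y' → t ≢ t' → nb G (E T t t') y y' ≡ true) →
    (Fin m → Fin n) → Contains T G
  place pt ext C c₁ c₂ c₃ c₄ c₅ f₀ = f , ok
    where
    open Embedding T G m Λ (N ∘ pt) (N>0 ∘ pt)
    open Sorting (toℕ ∘ pt)
    isFree : (t : Fin m) → Dec (ext t ≡ nothing)
    isFree t with ext t
    ... | nothing = yes refl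
    ... | just _ = no (λ ())
    frees : List (Fin m)
    frees = filter isFree (allFin m)
    L : List (Fin m)
    L = sortBy frees
    L-free : All (λ t → ext t ≡ nothing) L
    L-free = sortBy-All frees (all-filter isFree (allFin m))
    L-∈ : ∀ t → ext t ≡ nothing → t ∈ L
    L-∈ t p = sortBy-∈ frees (∈-filter⁺ isFree (∈-allFin t) p)
    L-sorted : AllPairs Before L
    L-sorted = sortBy-sorted frees (Unique-filter⁺ isFree (Unique-allFin⁺ m))
    L-len : length L ≤ m
    L-len = ≤-trans (≤-reflexive (sortBy-length frees)) (≤-trans (length-filter isFree (allFin m)) (≤-reflexive (length-tabulate id)))
    few : ∀ t t' → ext t ≡ nothing → ext t' ≡ nothing → Before t t' → Few C t t'
    few t t' p p' (t≢t' , le) ℓ ℓ<m Q Q⊑ big with m≤n⇒m<n∨m≡n le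
    ... | inj₁ lt = ≤-<-trans (m ⊗ (Λ ℓ ⊗ #-mono {S = C t ∩ R} {R = B (pt t) ∩ R}
            (λ {z} r → ∧-intro {B (pt t) z} {R z} (c₁ t p (∧-left {C t z} r)) (∧-right {C t z} r))))
            (cross (pt t) (pt t') lt (E T t t') ℓ ℓ<m Q (λ q → c₁ t' p' (Q⊑ q)) big)
      where
      R : Pred n
      R = loses (Λ (suc ℓ)) (N (pt t')) (E T t t') Q
    ... | inj₂ eq = subst (_< N (pt t)) (sym (trans (cong (λ k → m * (Λ ℓ * k)) (#-zero _ none)) (trans (cong (m *_) (*-zeroʳ (Λ ℓ))) (*-zeroʳ m)))) (N>0 (pt t))
      where
      open ≤-Reasoning
      i : Fin r
      i = pt t
      i≡ : pt t ≡ pt t'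
      i≡ = toℕ-injective eq
      -- Inside one part no vertex loses anything: by `inner` and `Λ ℓ ≤ Λ m` at most half of `Q` is
      -- cut away, and `Λ-double` makes up for that half.
      none : ∀ x → (C t ∩ loses (Λ (suc ℓ)) (N (pt t')) (E T t t') Q) x ≡ true → ⊥
      none x q = <-irrefl refl (<-≤-trans (dec-elim {d = _ <? _} (∧-right {C t x} q)) (≤-trans (certify 0 (both ⊕ bigQ) (re₃ N' (Λ ℓ * # Q) (Λ ℓ * # Q₁) (Λ ℓ * # Q₂) splitQ)) (≤-trans (≤-reflexive (sym (*-assoc 2 (Λ ℓ) _))) (*-monoˡ-≤ (# Q₁) (Λ-double ℓ)))))
        where
        Q₁ Q₂ : Pred n
        Q₁ = Q ∩ nb G (E T t t') x
        Q₂ = Q ∩ ∁ (nb G (E T t t') x)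
        N' : ℕ
        N' = N (pt t')
        splitQ : Λ ℓ * # Q ≡ Λ ℓ * # Q₁ + Λ ℓ * # Q₂
        splitQ = trans (cong (Λ ℓ *_) (#-split Q (nb G (E T t t') x))) (*-distribˡ-+ (Λ ℓ) _ _)
        bigQ : 2 * N' ≤ 2 * (Λ ℓ * # Q)
        bigQ = 2 ⊗ big
        σ≡ : E T t t' ≡ σ (pt t')
        σ≡ = trans (c₄ t t' p p' t≢t' i≡) (cong σ i≡)
        both : 2 * (Λ ℓ * # Q₂) ≤ N'
        both = ≤-trans (2 ⊗ (*-mono-≤ (Λ-mono (<⇒≤ ℓ<m)) (#-mono {S = Q₂} {R = B (pt t') ∩ ∁ (nb G (σ (pt t')) x)}
          (λ {z} s → ∧-intro (c₁ t' p' (Q⊑ (∧-left {Q z} s))) (subst (λ b → not (nb G b x z) ≡ true) σ≡ (∧-right {Q z} s))))))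
          (inner (pt t') x (subst (λ j → B j x ≡ true) i≡ (c₁ t p (∧-left {C t x} q))))
        re₃ : ∀ N q a b → q ≡ a + b → N + (N + 2 * q) + 0 ≡ 2 * a + (2 * b + 2 * N)
        re₃ N _ a b refl = lem N a b
          where
          lem : ∀ N a b → N + (N + 2 * (a + b)) + 0 ≡ 2 * a + (2 * b + 2 * N)
          lem = solve-∀
    pairs : ∀ L → All (λ t → ext t ≡ nothing) L → AllPairs Before L → AllPairs (λ t t' → t ≢ t' × Few C t t') L
    pairs [] _ _ = []
    pairs (t ∷ L) (e ∷ es) (p ∷ ps) = AllM.zipWith (λ { {t'} (e' , b) → proj₁ b , few t t' e e' b }) (es , p) ∷ pairs L es ps
    emb : Σ (Fin m → Fin n) λ f → All (λ t → C t (f t) ≡ true) L ×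
      AllPairs (λ t t' → nb G (E T t t') (f t) (f t') ≡ true) L
    emb = embed L 0 C L-len (AllM.map (λ {t} → c₃ t) L-free) (pairs L L-free L-sorted) f₀
    g : Fin m → Fin n
    g = proj₁ emb
    f : Fin m → Fin n
    f t with ext t
    ... | just y = y
    ... | nothing = g t
    ok : ∀ u v → u ≢ v → nb G (E T u v) (f u) (f v) ≡ true
    ok u v u≢v with ext u in eu | ext v in ev
    ... | just y | just y' = c₅ u v y y' eu ev u≢v
    ... | just y | nothing = c₂ v u y (g v) ev eu (AllM.lookup (proj₁ (proj₂ emb)) (L-∈ v ev))
    ... | nothing | just y = subst (λ b → nb G b (g u) y ≡ true) (E-sym T v u) (nb-sym G (c₂ u v y (g u) eu ev (AllM.lookup (proj₁ (proj₂ emb)) (L-∈ u eu))))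
    ... | nothing | nothing with allPairs-lookup (proj₂ (proj₂ emb)) (L-∈ u eu) (L-∈ v ev) u≢v
    ... | inj₁ q = q
    ... | inj₂ q = subst (λ b → nb G b (g u) (g v) ≡ true) (E-sym T v u) (nb-sym G q)

lastOf : ∀ {A : Set} → A → List A → A
lastOf x [] = x
lastOf x (y ∷ L) = lastOf y L

lookup-last : ∀ {A : Set} (x : A) L → lookup (x ∷ L) (fromℕ (length L)) ≡ lastOf x L
lookup-last x [] = refl
lookup-last x (y ∷ L) = lookup-last y L

Unique-lookup : ∀ {A : Set} {L : List A} → Unique L → ∀ i j → lookup L i ≡ lookup L j → i ≡ j
Unique-lookup (p ∷ ps) zero zero e = refl
Unique-lookup {L = _ ∷ L} (p ∷ ps) zero (suc j) e = ⊥-elim (AllM.lookup p (∈-lookup j) e)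
Unique-lookup (p ∷ ps) (suc i) zero e = ⊥-elim (AllM.lookup p (∈-lookup i) (sym e))
Unique-lookup (p ∷ ps) (suc i) (suc j) e = cong suc (Unique-lookup ps i j e)

Unique-length : ∀ {n} (L : List (Fin n)) → Unique L → length L ≤ n
Unique-length {n} L u with length L ≤? n
... | yes p = p
... | no p = let (i , j , i<j , e) = pigeonhole (≰⇒> p) (lookup L)
             in ⊥-elim (<⇒≢ i<j (cong toℕ (Unique-lookup u i j e)))

update : ∀ {n} {A : Set} → (Fin n → A) → Fin n → A → Fin n → A
update f v a t = if ⌊ t ≟F v ⌋ then a else f t

update-at : ∀ {n} {A : Set} (f : Fin n → A) v a → update f v a v ≡ a
update-at f v a with v ≟F v
... | yes _ = refl
... | no p = ⊥-elim (p refl)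

update-off : ∀ {n} {A : Set} (f : Fin n → A) {v} a {t} → t ≢ v → update f v a t ≡ f t
update-off f {v} a {t} p with t ≟F v
... | yes e = ⊥-elim (p e)
... | no _ = refl

ofCode : ∀ {n} → Code n → Graph n
ofCode {n} G = record { E = adjB G ; E-sym = symm G ; E-irr = irr G }
  where
  symm : ∀ {n} (G : Code n) x y → adjB G x y ≡ adjB G y x
  symm {suc n} G zero zero = refl
  symm {suc n} G zero (suc y) = refl
  symm {suc n} G (suc x) zero = refl
  symm {suc n} (G , _) (suc x) (suc y) = symm G x y
  irr : ∀ {n} (G : Code n) x → adjB G x x ≡ false
  irr {suc n} G zero = refl
  irr {suc n} (G , _) (suc x) = irr G x

-- Acyclic graphs: leaves, colourings and clique covers

module Acyclic {m : ℕ} (C : Code m) (acyclic : ¬ HasCycle C) where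

  T : Graph m
  T = ofCode C

  infix 4 _~_
  _~_ : Fin m → Fin m → Set
  x ~ y = E T x y ≡ true

  ~-sym : ∀ {x y} → x ~ y → y ~ x
  ~-sym {x} {y} p = trans (E-sym T y x) p

  ~-≢ : ∀ {x y} → x ~ y → x ≢ y
  ~-≢ {x} p refl = true≢false (trans (sym p) (E-irr T x))

  _~?_ : ∀ x y → Dec (x ~ y)
  x ~? y = E T x y ≟B true

  data Walk : Fin m → List (Fin m) → Set where
    stop : ∀ {x} → Walk x []
    step : ∀ {x y L} → x ~ y → Walk y L → Walk x (y ∷ L)

  Walk-lookup : ∀ {x L} → Walk x L → ∀ i → lookup (x ∷ L) (inject₁ i) ~ lookup L i
  Walk-lookup (step p w) zero = p
  Walk-lookup (step p w) (suc i) = Walk-lookup w i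

  no-cycle : ∀ {a b c L} → Unique (a ∷ b ∷ c ∷ L) → Walk a (b ∷ c ∷ L) → lastOf c L ~ a → ⊥
  no-cycle {a} {b} {c} {L} u w close = acyclic (length L , lookup (a ∷ b ∷ c ∷ L) ,
    (λ {i} {j} → Unique-lookup u i j) , Walk-lookup w , subst (_~ a) (sym (lookup-last c L)) close)

  no-triangle : ∀ {a b c} → a ~ b → b ~ c → c ~ a → ⊥
  no-triangle p q s = no-cycle ((~-≢ p ∷ (λ e → ~-≢ s (sym e)) ∷ []) ∷ (~-≢ q ∷ []) ∷ [] ∷ []) (step p (step q stop)) s

  no-square : ∀ {a b c d} → a ~ b → b ~ c → c ~ d → d ~ a → a ≢ c → b ≢ d → ⊥
  no-square p q s t a≢c b≢d = no-cycle
    ((~-≢ p ∷ a≢c ∷ (λ e → ~-≢ t (sym e)) ∷ []) ∷ (~-≢ q ∷ b≢d ∷ []) ∷ (~-≢ s ∷ []) ∷ [] ∷ [])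
    (step p (step q (step s stop))) t

  -- The prefix of a path that ends at `u`. It is passed to a continuation into an arbitrary `P`, so
  -- that a caller who only wants a contradiction may take `P` to be constantly `⊥`.
  cut : ∀ {v L u} → Unique L → Walk v L → u ∈ L → (P : List (Fin m) → Set) → (∀ {L'} → Unique L' → (∀ {z} → z ∈ L' → z ∈ L) → Walk v L' → lastOf v L' ≡ u → L' ≢ [] → P L') → ∃ P
  cut (d ∷ ds) (step p w) (here refl) P k = _ , k ([] ∷ []) (λ { (here e) → here e }) (step p stop) refl (λ ())
  cut {v} {y ∷ L} {u} (d ∷ ds) (step p w) (there q) P k =
    let (L' , ds' , inc , w' , l , _) = cut ds w q (λ L' → Unique L' × (∀ {z} → z ∈ L' → z ∈ L) × Walk y L' × lastOf y L' ≡ u × L' ≢ []) (λ a b c d e → a , b , c , d , e)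
    in y ∷ L' , k (AllM.tabulate (λ z e → AllM.lookup d (inc z) e) ∷ ds') (λ { (here e) → here e ; (there z) → there (inc z) }) (step p w') l (λ ())

  Degree≤1 : Pred m → Fin m → Set
  Degree≤1 S v = (∀ u → S u ≡ true → v ~ u → ⊥) ⊎ (∃ λ x → S x ≡ true × v ~ x × (∀ u → S u ≡ true → v ~ u → u ≡ x))

  Leaf : Pred m → Fin m → Set
  Leaf S v = S v ≡ true × Degree≤1 S v

  -- A path inside `S` is prolonged at its head. A neighbour of the head other than its predecessor
  -- is either new or closes a cycle with a prefix of the path. As a path has at most `m` vertices,
  -- the process stops at a vertex of degree at most one.
  leaf : ∀ S v → S v ≡ true → ∃ (Leaf S)
  leaf S v₀ s₀ = isolated
    where
    grow : ∀ k v p L → m < k + length (v ∷ p ∷ L) → All (λ z → S z ≡ true) (v ∷ p ∷ L) → Unique (v ∷ p ∷ L) → Walk v (p ∷ L) → ∃ (Leaf S)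
    grow zero v p L lt _ u _ = ⊥-elim (<-irrefl refl (<-≤-trans lt (Unique-length _ u)))
    grow (suc k) v p L lt (sv ∷ sp ∷ ss) u@(dv ∷ dp ∷ ds) w@(step e w')
      with any? (λ z → (S z ≟B true) ×-dec (v ~? z) ×-dec ¬? (z ≟F p))
    ... | no none = v , sv , inj₂ (p , sp , e , λ z sz vz → decidable-stable (z ≟F p) (λ ne → none (z , sz , vz , ne)))
    ... | yes (z , sz , vz , z≢p) with AnyM.any? (z ≟F_) L
    ... | no z∉L = grow k z v (p ∷ L) (subst (m <_) (sym (+-suc k _)) lt) (sz ∷ sv ∷ sp ∷ ss)
              (((λ eq → ~-≢ vz (sym eq)) ∷ z≢p ∷ AllM.tabulate (λ q eq → z∉L (subst (_∈ L) (sym eq) q))) ∷ u) (step (~-sym vz) w)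
    ... | yes z∈L = ⊥-elim (proj₂ (cut ds w' z∈L (λ _ → ⊥) absurd))
      where
      absurd : ∀ {L'} → Unique L' → (∀ {z} → z ∈ L' → z ∈ L) → Walk p L' → lastOf p L' ≡ z → L' ≢ [] → ⊥
      absurd {[]} _ _ _ _ ne = ne refl
      absurd {c ∷ L'} uL inc wL l _ = no-cycle
        (((AllM.head dv) ∷ AllM.tabulate (λ q → AllM.lookup (AllM.tail dv) (inc q))) ∷ AllM.tabulate (λ q → AllM.lookup dp (inc q)) ∷ uL)
        (step e wL) (subst (_~ v) (sym l) (~-sym vz))
    isolated : ∃ (Leaf S)
    isolated with any? (λ z → (S z ≟B true) ×-dec (v₀ ~? z))
    ... | no none = v₀ , s₀ , inj₁ (λ u su vu → none (u , su , vu))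
    ... | yes (z , sz , vz) = grow m z v₀ [] (m<m+n m (s≤s z≤n)) (sz ∷ s₀ ∷ []) (((λ e → ~-≢ vz (sym e)) ∷ []) ∷ [] ∷ []) (step (~-sym vz) stop)

  minus : Pred m → Fin m → Pred m
  minus S v = S ∩ (λ z → not ⌊ z ≟F v ⌋)

  minus-≢ : ∀ {S v z} → minus S v z ≡ true → z ≢ v
  minus-≢ {S} {v} {z} p e = not-elim (∧-right {S z} p) (dec-intro {d = z ≟F v} e)

  minus-intro : ∀ {S v z} → S z ≡ true → z ≢ v → minus S v z ≡ true
  minus-intro {S} {v} {z} s d = ∧-intro s (not-intro (λ e → d (dec-elim {d = z ≟F v} e)))

  minus-# : ∀ {S v} → S v ≡ true → # (minus S v) < # S
  minus-# {S} {v} s = ≤-trans (≤-trans (≤-reflexive (cong (_+ # (minus S v)) (sym (#-single v))))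
    (#-⊎ (λ z → ⌊ z ≟F v ⌋) (minus S v) (λ z p q → minus-≢ {S} q (dec-elim {d = z ≟F v} p))))
    (#-mono λ {z} p → [ (λ q → subst (λ z → S z ≡ true) (sym (dec-elim {d = z ≟F v} q)) s) , ∧-left {S z} ]′ (∨-elim {⌊ z ≟F v ⌋} p))

  empty? : (S : Pred m) → (∃ λ v → S v ≡ true) ⊎ (∀ v → S v ≡ true → ⊥)
  empty? S with any? (λ z → S z ≟B true)
  ... | yes p = inj₁ p
  ... | no p = inj₂ (λ v s → p (v , s))

  colour : ∀ k S → # S ≤ k → Σ (Fin m → Bool) λ col → ∀ u v → S u ≡ true → S v ≡ true → u ~ v → col u ≢ col v
  colour k S le with empty? S
  ... | inj₂ e = (λ _ → true) , λ u v su _ _ → ⊥-elim (e u su)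
  colour zero S le | inj₁ (v , s) = ⊥-elim (<⇒≱ (≤-trans (s≤s z≤n) (minus-# s)) le)
  colour (suc k) S le | inj₁ (v₀ , s₀) with leaf S v₀ s₀
  ... | v , s , alt = update col v b , proper
    where
    ih : Σ (Fin m → Bool) λ col → ∀ x y → minus S v x ≡ true → minus S v y ≡ true → x ~ y → col x ≢ col y
    ih = colour k (minus S v) (s≤s⁻¹ (≤-trans (minus-# s) le))
    col : Fin m → Bool
    col = proj₁ ih
    colourBy : Degree≤1 S v → Bool
    colourBy (inj₁ _) = true
    colourBy (inj₂ (x , _)) = not (col x)
    b : Bool
    b = colourBy alt
    not≢ : ∀ c → not c ≢ c
    not≢ true ()
    not≢ false ()
    away : ∀ a u → S u ≡ true → v ~ u → colourBy a ≢ col u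
    away (inj₁ none) u su vu = ⊥-elim (none u su vu)
    away (inj₂ (x , _ , _ , only)) u su vu rewrite only u su vu = not≢ (col x)
    proper : ∀ x y → S x ≡ true → S y ≡ true → x ~ y → update col v b x ≢ update col v b y
    proper x y sx sy xy e = [ caseX , (λ x≢v → [ caseY x≢v , both x≢v ]′ (dec⊎ y)) ]′ (dec⊎ x)
      where
      dec⊎ : ∀ z → z ≡ v ⊎ z ≢ v
      dec⊎ z with z ≟F v
      ... | yes p = inj₁ p
      ... | no p = inj₂ p
      caseX : x ≡ v → ⊥
      caseX refl = away alt y sy xy (trans (sym (update-at col v b)) (trans e (update-off col b (λ q → ~-≢ xy (sym q)))))
      caseY : x ≢ v → y ≡ v → ⊥
      caseY d refl = away alt x sx (~-sym xy) (trans (sym (update-at col v b)) (trans (sym e) (update-off col b d)))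
      both : x ≢ v → y ≢ v → ⊥
      both d d' = proj₂ ih x y (minus-intro {S} sx d) (minus-intro {S} sy d') xy (trans (sym (update-off col b d)) (trans e (update-off col b d')))

  -- A cover of S by b cliques together with a stable transversal I.
  record KCover (S : Pred m) : Set where
    field
      b : ℕ
      cl : Fin m → ℕ
      I : ℕ → Fin m
      cl<b : ∀ u → S u ≡ true → cl u < b
      clique : ∀ u v → S u ≡ true → S v ≡ true → cl u ≡ cl v → u ≢ v → u ~ v
      I∈S : ∀ k → k < b → S (I k) ≡ true
      cl-I : ∀ k → k < b → cl (I k) ≡ k
      stable : ∀ j k → j < b → k < b → ¬ I j ~ I k

  -- The greedy argument for forests: a vertex `v` of degree at most one forms a clique with its
  -- mate, and once both are removed no remaining vertex is adjacent to `v`, so `v` can join the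
  -- stable transversal. An isolated `v` counts as its own mate.
  cover : ∀ k S → # S ≤ k → Fin m → KCover S
  cover k S le d₀ with empty? S
  ... | inj₂ e = record { b = 0 ; cl = λ _ → 0 ; I = λ _ → d₀ ; cl<b = λ u s → ⊥-elim (e u s)
          ; clique = λ u _ s → ⊥-elim (e u s) ; I∈S = λ _ () ; cl-I = λ _ () ; stable = λ _ _ () }
  cover zero S le d₀ | inj₁ (v , s) = ⊥-elim (<⇒≱ (≤-trans (s≤s z≤n) (minus-# s)) le)
  cover (suc k) S le d₀ | inj₁ (v₀ , s₀) with leaf S v₀ s₀
  ... | v , s , alt = record { b = suc b' ; cl = cl ; I = I ; cl<b = bound ; clique = clq ; I∈S = inS ; cl-I = clI ; stable = stb }
    where
    mate : Degree≤1 S v → Fin m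
    mate (inj₁ _) = v
    mate (inj₂ (x , _)) = x
    x : Fin m
    x = mate alt
    S' : Pred m
    S' = minus (minus S v) x
    ih : KCover S'
    ih = cover k S' (≤-trans (#-mono {R = minus S v} (λ {z} p → ∧-left {minus S v z} p)) (s≤s⁻¹ (≤-trans (minus-# s) le))) d₀
    open KCover ih renaming (b to b'; cl to cl'; I to I')
    S'-intro : ∀ {z} → S z ≡ true → z ≢ v → z ≢ x → S' z ≡ true
    S'-intro {z} sz p q = minus-intro {minus S v} (minus-intro {S} sz p) q
    mate-~ : ∀ a → v ≢ mate a → v ~ mate a
    mate-~ (inj₁ _) d = ⊥-elim (d refl)
    mate-~ (inj₂ (_ , _ , vx , _)) _ = vx
    vx : v ≢ x → v ~ x
    vx = mate-~ alt
    mate-only : ∀ a u → S u ≡ true → v ~ u → u ≡ mate a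
    mate-only (inj₁ none) u su vu = ⊥-elim (none u su vu)
    mate-only (inj₂ (_ , _ , _ , only)) u su vu = only u su vu
    far : ∀ u → S' u ≡ true → v ~ u → ⊥
    far u s'u vu = minus-≢ {minus S v} s'u (mate-only alt u (∧-left {S u} (∧-left {minus S v u} s'u)) vu)
    cl : Fin m → ℕ
    cl = update (update cl' v b') x b'
    I : ℕ → Fin m
    I j with j ≟ℕ b'
    ... | yes _ = v
    ... | no _ = I' j
    data Where (z : Fin m) : Set where
      new : (z ≡ v ⊎ z ≡ x) → cl z ≡ b' → Where z
      old : S' z ≡ true → cl z ≡ cl' z → cl' z < b' → Where z
    where? : ∀ z → S z ≡ true → Where z
    where? z sz with z ≟F x
    ... | yes refl = new (inj₂ refl) (update-at (update cl' v b') x b')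
    ... | no q with z ≟F v
    ... | yes refl = new (inj₁ refl) (trans (update-off (update cl' v b') b' q) (update-at cl' v b'))
    ... | no p = old (S'-intro sz p q) (trans (update-off (update cl' v b') b' q) (update-off cl' b' p)) (cl<b z (S'-intro sz p q))
    bound : ∀ u → S u ≡ true → cl u < suc b'
    bound u su with where? u su
    ... | new _ e = s≤s (≤-reflexive e)
    ... | old _ e lt = m≤n⇒m≤1+n (subst (_< b') (sym e) lt)
    newPair : ∀ {u w} → (u ≡ v ⊎ u ≡ x) → (w ≡ v ⊎ w ≡ x) → u ≢ w → u ~ w
    newPair (inj₁ refl) (inj₁ refl) d = ⊥-elim (d refl)
    newPair (inj₁ refl) (inj₂ refl) d = vx d
    newPair (inj₂ refl) (inj₁ refl) d = ~-sym (vx (λ e → d (sym e)))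
    newPair (inj₂ refl) (inj₂ refl) d = ⊥-elim (d refl)
    clq : ∀ u w → S u ≡ true → S w ≡ true → cl u ≡ cl w → u ≢ w → u ~ w
    clq u w su sw e d with where? u su | where? w sw
    ... | new p _ | new q _ = newPair p q d
    ... | new _ eu | old _ ew lt = ⊥-elim (<⇒≢ lt (trans (sym ew) (trans (sym e) eu)))
    ... | old _ eu lt | new _ ew = ⊥-elim (<⇒≢ lt (trans (sym eu) (trans e ew)))
    ... | old s'u eu _ | old s'w ew _ = clique u w s'u s'w (trans (sym eu) (trans e ew)) d
    less : ∀ {j} → j < suc b' → j ≢ b' → j < b'
    less lt ne = ≤∧≢⇒< (s≤s⁻¹ lt) ne
    inS : ∀ j → j < suc b' → S (I j) ≡ true
    inS j lt with j ≟ℕ b'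
    ... | yes _ = s
    ... | no ne = let z = I' j in ∧-left {S z} (∧-left {minus S v z} (I∈S j (less lt ne)))
    clI : ∀ j → j < suc b' → cl (I j) ≡ j
    clI j lt with j ≟ℕ b'
    ... | no ne = let s'z = I∈S j (less lt ne) in
      trans (update-off (update cl' v b') b' (minus-≢ {minus S v} s'z)) (trans (update-off cl' b' (minus-≢ {S} (∧-left {minus S v (I' j)} s'z))) (cl-I j (less lt ne)))
    ... | yes refl with where? v s
    ... | new _ e = e
    ... | old s'v _ _ = ⊥-elim (minus-≢ {S} (∧-left {minus S v v} s'v) refl)
    stb : ∀ i j → i < suc b' → j < suc b' → ¬ I i ~ I j
    stb i j li lj e with i ≟ℕ b' | j ≟ℕ b'
    ... | yes _ | yes _ = ~-≢ e refl
    ... | yes _ | no q = far (I' j) (I∈S j (less lj q)) e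
    ... | no p | yes _ = far (I' i) (I∈S i (less li p)) (~-sym e)
    ... | no p | no q = stable i j (less li p) (less lj q) e

-- The value at the unused label cu is junk.
relabel : ∀ {r} (s cu : Fin (suc (suc r))) → s ≢ cu → Fin (suc (suc r)) → Maybe (Fin r)
relabel s cu d x with s ≟F x
... | yes _ = nothing
... | no p with punchOut d ≟F punchOut p
... | yes _ = nothing
... | no q = just (punchOut q)

relabel-s : ∀ {r} (s cu : Fin (suc (suc r))) d → relabel s cu d s ≡ nothing
relabel-s s cu d with s ≟F s
... | yes _ = refl
... | no p = ⊥-elim (p refl)

just-injective : ∀ {A : Set} {x y : A} → just x ≡ just y → x ≡ y
just-injective refl = refl

relabel-injective : ∀ {r} (s cu : Fin (suc (suc r))) d x y → x ≢ cu → y ≢ cu → relabel s cu d x ≡ relabel s cu d y → x ≡ y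
relabel-injective s cu d x y x≢ y≢ e with s ≟F x | s ≟F y
... | yes p | yes q = trans (sym p) q
... | yes p | no q with punchOut d ≟F punchOut q
...   | yes h = ⊥-elim (y≢ (sym (punchOut-injective d q h)))
relabel-injective s cu d x y x≢ y≢ () | yes p | no q | no h
relabel-injective s cu d x y x≢ y≢ e | no p | yes q with punchOut d ≟F punchOut p
...   | yes h = ⊥-elim (x≢ (sym (punchOut-injective d p h)))
relabel-injective s cu d x y x≢ y≢ () | no p | yes q | no h
relabel-injective s cu d x y x≢ y≢ e | no p | no q with punchOut d ≟F punchOut p | punchOut d ≟F punchOut q
... | yes h | _ = ⊥-elim (x≢ (sym (punchOut-injective d p h)))
... | no _ | yes h = ⊥-elim (y≢ (sym (punchOut-injective d q h)))
... | no h | no h' = punchOut-injective p q (punchOut-injective h h' (just-injective e))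

-- Partitions of the tree T that drive the embeddings

record Bipartition {m : ℕ} (T : Graph m) : Set where
  field
    col : Fin m → Bool
    proper : ∀ t t' → col t ≡ col t' → E T t t' ≡ false

-- Partitions of a graph T into r cliques (labels just k) and one exceptional part (label nothing).
module _ {m : ℕ} (T : Graph m) (r : ℕ) where

  -- Directed against two non-adjacent vertices in the same part: they take the places of `w` and
  -- `w'`, the rest of the exceptional part is a clique in their common neighbourhood, and the other
  -- cliques of `T` go into the other parts.
  record Shape₁ : Set where
    field
      pt : Fin m → Maybe (Fin r)
      w w' : Fin m
      w≢w' : w ≢ w'
      ww' : E T w w' ≡ false
      pt-w : pt w ≡ nothing
      pt-w' : pt w' ≡ nothing
      clique : ∀ t t' → t ≢ t' → pt t ≡ pt t' → t ≢ w → t ≢ w' → t' ≢ w → t' ≢ w' → E T t t' ≡ true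
      joined : ∀ t → pt t ≡ nothing → t ≢ w → t ≢ w' → E T w t ≡ true × E T w' t ≡ true

  -- Directed against a vertex that is rich in non-neighbours in one part and rich in both
  -- adjacencies in all others: it takes the place of `w`.
  record Shape₂ : Set where
    field
      pt : Fin m → Maybe (Fin r)
      w : Fin m
      pt-w : pt w ≡ nothing
      clique : ∀ t t' → t ≢ t' → pt t ≡ pt t' → t ≢ w → t' ≢ w → E T t t' ≡ true
      apart : ∀ t → pt t ≡ nothing → t ≢ w → E T w t ≡ false

  -- Directed against a single nearly stable part among nearly complete ones.
  record ShapeS : Set where
    field
      pt : Fin m → Maybe (Fin r)
      clique : ∀ t t' k → t ≢ t' → pt t ≡ just k → pt t' ≡ just k → E T t t' ≡ true
      stable : ∀ t t' → pt t ≡ nothing → pt t' ≡ nothing → E T t t' ≡ false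

¬true⇒false : ∀ {b} → ¬ b ≡ true → b ≡ false
¬true⇒false {true} p = ⊥-elim (p refl)
¬true⇒false {false} _ = refl

module TreeShapes {m r : ℕ} (C : Code m) (isTree : IsTree C) (stab : IsStabilityNumber C (suc (suc (suc r))))
  (noPM : ¬ HasPerfectMatching C) (noSS : ¬ IsSubdividedStar C) where

  open Acyclic C (proj₂ (proj₂ isTree))

  a : ℕ
  a = suc (suc (suc r))

  some : Fin m
  some = fromℕ< (proj₁ isTree)

  full : Pred m
  full _ = true

  bipartition : Bipartition T
  bipartition = let (col , p) = colour m full (#≤n full) in
    record { col = col ; proper = λ t t' e → ¬true⇒false (λ q → p t t' refl refl q e) }

  col : Fin m → Bool
  col = Bipartition.col bipartition

  same-colour : ∀ {t t'} → col t ≡ col t' → t ~ t' → ⊥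
  same-colour e q = true≢false (trans (sym q) (Bipartition.proper bipartition _ _ e))

  two-steps : ∀ {x y z} → x ~ y → y ~ z → col x ≡ col z
  two-steps {x} {y} {z} p q with col x in ex | col y in ey | col z in ez
  ... | true | true | _ = ⊥-elim (same-colour (trans ex (sym ey)) p)
  ... | false | false | _ = ⊥-elim (same-colour (trans ex (sym ey)) p)
  ... | _ | true | true = ⊥-elim (same-colour (trans ey (sym ez)) q)
  ... | _ | false | false = ⊥-elim (same-colour (trans ey (sym ez)) q)
  ... | true | false | true = refl
  ... | false | true | false = refl

  Cliques : (Fin m → Fin a) → Set
  Cliques c = ∀ u v → c u ≡ c v → u ≢ v → u ~ v

  Single : (Fin m → Fin a) → Fin m → Set
  Single c w = ∀ t → c t ≡ c w → t ≡ w

  Edge : (Fin m → Fin a) → Fin m → Fin m → Set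
  Edge c t t' = t ~ t' × c t ≡ c t'

  -- The stable transversal of the cover has `b` elements, whence `b ≤ a` and `a` labels suffice.
  cliqueCover : ∃ Cliques
  cliqueCover = (λ u → fromℕ< (below u)) , λ u v e → clique u v refl refl (trans (sym (toℕ-fromℕ< (below u))) (trans (cong toℕ e) (toℕ-fromℕ< (below v))))
    where
    K : KCover full
    K = cover m full (#≤n full) some
    open KCover K
    b≤a : b ≤ a
    b≤a = ≮⇒≥ (λ lt → proj₂ stab ((λ i → I (toℕ i)) ,
      (λ {i} {j} e → toℕ-injective (trans (sym (cl-I _ (<-≤-trans (toℕ<n i) lt))) (trans (cong cl e) (cl-I _ (<-≤-trans (toℕ<n j) lt))))) ,
      (λ i j → stable _ _ (<-≤-trans (toℕ<n i) lt) (<-≤-trans (toℕ<n j) lt))))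
    below : ∀ u → cl u < a
    below u = <-≤-trans (cl<b u refl) b≤a

  -- Otherwise two of the `a` vertices of a stable set would share one of the remaining `a - 1`
  -- cliques.
  surjective : ∀ c → Cliques c → ∀ k → ∃ λ t → c t ≡ k
  surjective c cl k with any? (λ t → c t ≟F k)
  ... | yes p = p
  ... | no none =
    let (f , inj , ind) = proj₁ stab
        g = λ i → punchOut {i = k} {j = c (f i)} (λ e → none (f i , sym e))
        (i , j , i<j , e) = pigeonhole ≤-refl g
    in ⊥-elim (ind i j (cl (f i) (f j) (punchOut-injective (λ e → none (f i , sym e)) (λ e → none (f j , sym e)) e) (λ e → <⇒≢ i<j (cong toℕ (inj e)))))

  pair-only : ∀ {c} → Cliques c → ∀ {t t'} → Edge c t t' → ∀ u → c u ≡ c t → u ≡ t ⊎ u ≡ t'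
  pair-only {c} cl {t} {t'} (tt' , e) u eu with u ≟F t | u ≟F t'
  ... | yes p | _ = inj₁ p
  ... | no _ | yes q = inj₂ q
  ... | no p | no q = ⊥-elim (no-triangle (cl u t eu p) tt' (cl t' u (trans (sym e) (sym eu)) (λ z → q (sym z))))

  edge-swap : ∀ {c t t'} → Edge c t t' → Edge c t' t
  edge-swap (p , e) = ~-sym p , sym e

  partner? : ∀ c → Cliques c → ∀ t → (∃ λ t' → Edge c t t') ⊎ Single c t
  partner? c cl t with any? (λ t' → (c t ≟F c t') ×-dec ¬? (t ≟F t'))
  ... | yes (t' , e , d) = inj₁ (t' , cl t t' e d , e)
  ... | no none = inj₂ (λ u e → decidable-stable (u ≟F t) (λ d → none (u , sym e , λ q → d (sym q))))

  module Assemble (lab : Fin m → Fin a) (s cu : Fin a) (s≢cu : s ≢ cu) (miss : ∀ t → lab t ≢ cu) where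
    pt : Fin m → Maybe (Fin (suc r))
    pt t = relabel s cu s≢cu (lab t)
    pt-eq : ∀ t t' → pt t ≡ pt t' → lab t ≡ lab t'
    pt-eq t t' = relabel-injective s cu s≢cu _ _ (miss t) (miss t')
    pt-s : ∀ t → lab t ≡ s → pt t ≡ nothing
    pt-s t e = trans (cong (relabel s cu s≢cu) e) (relabel-s s cu s≢cu)
    lab-s : ∀ t → pt t ≡ nothing → lab t ≡ s
    lab-s t e = relabel-injective s cu s≢cu _ _ (miss t) s≢cu (trans e (sym (relabel-s s cu s≢cu)))

  Shapes : Set
  Shapes = Shape₁ T (suc r) × Shape₂ T (suc r) × ShapeS T (suc r)

  -- Merging the two singletons frees a label. They are not adjacent: otherwise the merged classes
  -- would be a clique cover that misses a label, contrary to `surjective`.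
  two-singles : ∀ c → Cliques c → ∀ w w' → Single c w → Single c w' → w ≢ w' → Shapes
  two-singles c cl w w' sw sw' d = S₁ , S₂ , S₃
    where
    lab : Fin m → Fin a
    lab = update c w' (c w)
    cw≢ : c w ≢ c w'
    cw≢ e = d (sw' w e)
    miss : ∀ t → lab t ≢ c w'
    miss t e with t ≟F w'
    ... | yes _ = cw≢ e
    ... | no p = p (sw' t e)
    open Assemble lab (c w) (c w') cw≢ miss
    lab-w' : lab w' ≡ c w
    lab-w' = update-at c w' (c w)
    lab-w : lab w ≡ c w
    lab-w = update-off c (c w) d
    inside : ∀ t → lab t ≡ c w → t ≡ w ⊎ t ≡ w'
    inside t e with t ≟F w'
    ... | yes p = inj₂ p
    ... | no _ = inj₁ (sw t e)
    outside : ∀ t t' → t ≢ t' → lab t ≡ lab t' → t ≢ w' → t' ≢ w' → t ~ t'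
    outside t t' d e p q = cl t t' (trans (sym (update-off c (c w) p)) (trans e (update-off c (c w) q))) d
    apart : ¬ w ~ w'
    apart q = let (t , e) = surjective lab cl' (c w') in miss t e
      where
      cl' : Cliques lab
      cl' u v e d with u ≟F w' | v ≟F w'
      ... | yes refl | yes refl = ⊥-elim (d refl)
      ... | yes refl | no _ rewrite sw v (sym e) = ~-sym q
      ... | no _ | yes refl rewrite sw u e = q
      ... | no _ | no _ = cl u v e d
    none : ∀ t → pt t ≡ nothing → t ≡ w ⊎ t ≡ w'
    none t e = inside t (lab-s t e)
    S₁ : Shape₁ T (suc r)
    S₁ = record { pt = pt ; w = w ; w' = w' ; w≢w' = d ; ww' = ¬true⇒false apart ; pt-w = pt-s w lab-w ; pt-w' = pt-s w' lab-w'
      ; clique = λ t t' dd e _ p _ q → outside t t' dd (pt-eq t t' e) p q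
      ; joined = λ t e p q → ⊥-elim ([ p , q ]′ (none t e)) }
    S₂ : Shape₂ T (suc r)
    S₂ = record { pt = pt ; w = w ; pt-w = pt-s w lab-w
      ; clique = clq
      ; apart = λ t e p → [ (λ q → ⊥-elim (p q)) , (λ { refl → ¬true⇒false apart }) ]′ (none t e) }
      where
      clq : ∀ t t' → t ≢ t' → pt t ≡ pt t' → t ≢ w → t' ≢ w → t ~ t'
      clq t t' dd e p q = outside t t' dd le (λ { refl → bad t' (trans (sym le) lab-w') (λ z → dd (sym z)) q }) (λ { refl → bad t (trans le lab-w') dd p })
        where
        le : lab t ≡ lab t'
        le = pt-eq t t' e
        bad : ∀ u → lab u ≡ c w → u ≢ w' → u ≢ w → ⊥
        bad u e p q = [ q , p ]′ (inside u e)
    S₃ : ShapeS T (suc r)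
    S₃ = record { pt = pt
      ; clique = λ t t' k dd e e' → outside t t' dd (pt-eq t t' (trans e (sym e'))) (λ { refl → absurd (trans (sym e) (pt-s w' lab-w')) }) (λ { refl → absurd (trans (sym e') (pt-s w' lab-w')) })
      ; stable = λ t t' e e' → ¬true⇒false (λ q → st q (none t e) (none t' e')) }
      where
      absurd : ∀ {k : Fin (suc r)} → just k ≡ nothing → ⊥
      absurd ()
      st : ∀ {t t'} → t ~ t' → t ≡ w ⊎ t ≡ w' → t' ≡ w ⊎ t' ≡ w' → ⊥
      st q (inj₁ refl) (inj₁ refl) = ~-≢ q refl
      st q (inj₁ refl) (inj₂ refl) = apart q
      st q (inj₂ refl) (inj₁ refl) = apart (~-sym q)
      st q (inj₂ refl) (inj₂ refl) = ~-≢ q refl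

  search⊎ : ∀ {n} {A B : Fin n → Set} → (∀ t → A t ⊎ B t) → (∀ t → A t) ⊎ ∃ B
  search⊎ {zero} _ = inj₁ (λ ())
  search⊎ {suc n} f with f zero | search⊎ (f ∘ suc)
  ... | inj₂ b | _ = inj₂ (zero , b)
  ... | inj₁ _ | inj₂ (t , b) = inj₂ (suc t , b)
  ... | inj₁ x | inj₁ g = inj₁ (λ { zero → x ; (suc t) → g t })

  module OneSingle (c : Fin m → Fin a) (cl : Cliques c) (w : Fin m) (sw : Single c w) where

    module Absorb {x x' : Fin m} (ed : Edge c x x') (cx≢ : c x ≢ c w) where
      lab : Fin m → Fin a
      lab = update (update c x (c w)) x' (c w)
      lab-off : ∀ {t} → t ≢ x → t ≢ x' → lab t ≡ c t
      lab-off p q = trans (update-off (update c x (c w)) (c w) q) (update-off c (c w) p)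
      lab-x' : lab x' ≡ c w
      lab-x' = update-at (update c x (c w)) x' (c w)
      lab-x : lab x ≡ c w
      lab-x = trans (update-off (update c x (c w)) (c w) (~-≢ (proj₁ ed))) (update-at c x (c w))
      lab-w : lab w ≡ c w
      lab-w = lab-off (λ { refl → cx≢ refl }) (λ { refl → cx≢ (proj₂ ed) })
      inside : ∀ t → lab t ≡ c w → t ≡ w ⊎ t ≡ x ⊎ t ≡ x'
      inside t e with t ≟F x | t ≟F x'
      ... | yes p | _ = inj₂ (inj₁ p)
      ... | no _ | yes q = inj₂ (inj₂ q)
      ... | no p | no q = inj₁ (sw t e)
      miss : ∀ t → lab t ≢ c x
      miss t e with t ≟F x | t ≟F x'
      ... | yes refl | yes _ = cx≢ (sym e)
      ... | yes refl | no _ = cx≢ (sym e)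
      ... | no _ | yes refl = cx≢ (sym e)
      ... | no p | no q = [ p , q ]′ (pair-only cl ed t e)
      open Assemble lab (c w) (c x) (λ e → cx≢ (sym e)) miss public
      clq : ∀ t t' → t ≢ t' → pt t ≡ pt t' → t ≢ w → t' ≢ w → t ~ t'
      clq t t' d e p q = go (lab t ≟F c w)
        where
        le : lab t ≡ lab t'
        le = pt-eq t t' e
        join : t ≡ x ⊎ t ≡ x' → t' ≡ x ⊎ t' ≡ x' → t ~ t'
        join (inj₁ refl) (inj₁ refl) = ⊥-elim (d refl)
        join (inj₁ refl) (inj₂ refl) = proj₁ ed
        join (inj₂ refl) (inj₁ refl) = ~-sym (proj₁ ed)
        join (inj₂ refl) (inj₂ refl) = ⊥-elim (d refl)
        strip : ∀ {u} → u ≢ w → u ≡ w ⊎ u ≡ x ⊎ u ≡ x' → u ≡ x ⊎ u ≡ x'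
        strip p (inj₁ q) = ⊥-elim (p q)
        strip p (inj₂ q) = q
        go : Dec (lab t ≡ c w) → t ~ t'
        go (yes h) = join (strip p (inside t h)) (strip q (inside t' (trans (sym le) h)))
        go (no h) = cl t t' (trans (sym (off t h)) (trans le (off t' (λ h' → h (trans le h'))))) d
          where
          off : ∀ u → lab u ≢ c w → lab u ≡ c u
          off u h = lab-off (λ { refl → h lab-x }) (λ { refl → h lab-x' })

    class≢ : ∀ {x x'} → Edge c x x' → c x ≢ c w
    class≢ (p , e) q = ~-≢ p (trans (sw _ q) (sym (sw _ (trans (sym e) q))))

    -- On the path `w`, `x`, `x'` the ends are not adjacent and the middle is joined to both, so
    -- `x'` can serve as the second special vertex.
    shape₁ : ∀ {x x'} → Edge c x x' → w ~ x → Shape₁ T (suc r)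
    shape₁ {x} {x'} ed wx = record { pt = pt ; w = w ; w' = x'
      ; w≢w' = λ { refl → class≢ ed (proj₂ ed) }
      ; ww' = ¬true⇒false (λ q → no-triangle wx (proj₁ ed) (~-sym q))
      ; pt-w = pt-s w lab-w ; pt-w' = pt-s x' lab-x'
      ; clique = λ t t' d e p _ q _ → clq t t' d e p q
      ; joined = λ t e p q → [ (λ h → ⊥-elim (p h)) , [ (λ { refl → wx , ~-sym (proj₁ ed) }) , (λ h → ⊥-elim (q h)) ]′ ]′ (inside t (lab-s t e)) }
      where open Absorb ed (class≢ ed)

    shape₂ : ∀ {y z} → Edge c y z → ¬ w ~ y → ¬ w ~ z → Shape₂ T (suc r)
    shape₂ {y} {z} ed wy wz = record { pt = pt ; w = w ; pt-w = pt-s w lab-w ; clique = clq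
      ; apart = λ t e p → [ (λ h → ⊥-elim (p h)) , [ (λ { refl → ¬true⇒false wy }) , (λ { refl → ¬true⇒false wz }) ]′ ]′ (inside t (lab-s t e)) }
      where open Absorb ed (class≢ ed)

    -- The stable set is {w, x', z}; the vertices x and y form a new clique.
    shapeS : ∀ {x x' y z} → Edge c x x' → Edge c y z → c x ≢ c y → x ~ y → ¬ w ~ x' → ¬ w ~ z → ¬ x' ~ z → ShapeS T (suc r)
    shapeS {x} {x'} {y} {z} ex ey cx≢cy xy wx' wz x'z = record { pt = pt ; clique = clq ; stable = stb }
      where
      lab : Fin m → Fin a
      lab = update (update (update c x' (c w)) z (c w)) y (c x)
      data Pos (t : Fin m) : Set where
        inS : t ≡ w ⊎ t ≡ x' ⊎ t ≡ z → lab t ≡ c w → Pos t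
        inX : t ≡ x ⊎ t ≡ y → lab t ≡ c x → Pos t
        out : lab t ≡ c t → c t ≢ c w → c t ≢ c x → c t ≢ c y → Pos t
      pos : ∀ t → Pos t
      pos t with t ≟F y in eqy
      ... | yes refl = inX (inj₂ refl) (update-at (update (update c x' (c w)) z (c w)) y (c x))
      ... | no ny with t ≟F z
      ... | yes refl = inS (inj₂ (inj₂ refl)) (trans (update-off (update (update c x' (c w)) z (c w)) (c x) ny) (update-at (update c x' (c w)) z (c w)))
      ... | no nz with t ≟F x'
      ... | yes refl = inS (inj₂ (inj₁ refl)) (trans (update-off (update (update c x' (c w)) z (c w)) (c x) ny) (trans (update-off (update c x' (c w)) (c w) nz) (update-at c x' (c w))))
      ... | no nx' = go (t ≟F w) (t ≟F x)
        where
        unmoved : lab t ≡ c t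
        unmoved = trans (update-off (update (update c x' (c w)) z (c w)) (c x) ny) (trans (update-off (update c x' (c w)) (c w) nz) (update-off c (c w) nx'))
        go : Dec (t ≡ w) → Dec (t ≡ x) → Pos t
        go (yes p) _ = inS (inj₁ p) (trans unmoved (cong c p))
        go (no _) (yes p) = inX (inj₁ p) (trans unmoved (cong c p))
        go (no nw) (no nx) = out unmoved (λ e → nw (sw t e)) (λ e → [ nx , nx' ]′ (pair-only cl ex t e)) (λ e → [ ny , nz ]′ (pair-only cl ey t e))
      miss : ∀ t → lab t ≢ c y
      miss t e with pos t
      ... | inS _ h = class≢ ey (trans (sym e) h)
      ... | inX _ h = cx≢cy (trans (sym h) e)
      ... | out h _ _ q = q (trans (sym h) e)
      open Assemble lab (c w) (c y) (λ e → class≢ ey (sym e)) miss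
      nonadjacent : ∀ {t t'} → t ≡ w ⊎ t ≡ x' ⊎ t ≡ z → t' ≡ w ⊎ t' ≡ x' ⊎ t' ≡ z → ¬ t ~ t'
      nonadjacent (inj₁ refl) (inj₁ refl) q = ~-≢ q refl
      nonadjacent (inj₁ refl) (inj₂ (inj₁ refl)) q = wx' q
      nonadjacent (inj₁ refl) (inj₂ (inj₂ refl)) q = wz q
      nonadjacent (inj₂ (inj₁ refl)) (inj₁ refl) q = wx' (~-sym q)
      nonadjacent (inj₂ (inj₁ refl)) (inj₂ (inj₁ refl)) q = ~-≢ q refl
      nonadjacent (inj₂ (inj₁ refl)) (inj₂ (inj₂ refl)) q = x'z q
      nonadjacent (inj₂ (inj₂ refl)) (inj₁ refl) q = wz (~-sym q)
      nonadjacent (inj₂ (inj₂ refl)) (inj₂ (inj₁ refl)) q = x'z (~-sym q)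
      nonadjacent (inj₂ (inj₂ refl)) (inj₂ (inj₂ refl)) q = ~-≢ q refl
      stb : ∀ t t' → pt t ≡ nothing → pt t' ≡ nothing → E T t t' ≡ false
      stb t t' e e' with pos t | pos t'
      ... | inS p _ | inS q _ = ¬true⇒false (nonadjacent p q)
      ... | inX _ h | _ = ⊥-elim (class≢ ex (trans (sym h) (lab-s t e)))
      ... | out h q _ _ | _ = ⊥-elim (q (trans (sym h) (lab-s t e)))
      ... | inS _ _ | inX _ h = ⊥-elim (class≢ ex (trans (sym h) (lab-s t' e')))
      ... | inS _ _ | out h q _ _ = ⊥-elim (q (trans (sym h) (lab-s t' e')))
      pair : ∀ {t t'} → t ≢ t' → t ≡ x ⊎ t ≡ y → t' ≡ x ⊎ t' ≡ y → t ~ t'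
      pair d (inj₁ refl) (inj₁ refl) = ⊥-elim (d refl)
      pair d (inj₁ refl) (inj₂ refl) = xy
      pair d (inj₂ refl) (inj₁ refl) = ~-sym xy
      pair d (inj₂ refl) (inj₂ refl) = ⊥-elim (d refl)
      clq : ∀ t t' k → t ≢ t' → pt t ≡ just k → pt t' ≡ just k → t ~ t'
      clq t t' k d e e' with pos t | pos t' | pt-eq t t' (trans e (sym e'))
      ... | inS _ h | _ | _ = ⊥-elim (just≢nothing (trans (sym e) (pt-s t h)))
        where
        just≢nothing : ∀ {k : Fin (suc r)} → just k ≡ nothing → ⊥
        just≢nothing ()
      ... | inX p _ | inX q _ | _ = pair d p q
      ... | inX _ h | inS _ h' | le = ⊥-elim (class≢ ex (trans (sym h) (trans le h')))
      ... | inX _ h | out h' _ q _ | le = ⊥-elim (q (trans (sym h') (trans (sym le) h)))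
      ... | out h q _ _ | inS _ h' | le = ⊥-elim (q (trans (sym h) (trans le h')))
      ... | out h _ q _ | inX _ h' | le = ⊥-elim (q (trans (sym h) (trans le h')))
      ... | out h _ _ _ | out h' _ _ _ | le = cl t t' (trans (sym h) (trans le h')) d

    -- Exchange along the path `w`, `x`, `x'`: the edge `w x` becomes a class and `x'` becomes the
    -- singleton, while the other classes are unchanged.
    module Switch {x x' : Fin m} (ed : Edge c x x') (wx : w ~ x) where
      c₁ : Fin m → Fin a
      c₁ = update (update c w (c x)) x' (c w)
      w≢x' : w ≢ x'
      w≢x' refl = class≢ ed (proj₂ ed)
      c₁-x' : c₁ x' ≡ c w
      c₁-x' = update-at (update c w (c x)) x' (c w)
      c₁-w : c₁ w ≡ c x
      c₁-w = trans (update-off (update c w (c x)) (c w) w≢x') (update-at c w (c x))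
      c₁-off : ∀ {t} → t ≢ w → t ≢ x' → c₁ t ≡ c t
      c₁-off p q = trans (update-off (update c w (c x)) (c w) q) (update-off c (c x) p)
      single₁ : Single c₁ x'
      single₁ t e with t ≟F x'
      ... | yes p = p
      ... | no q with t ≟F w
      ... | yes refl = ⊥-elim (class≢ ed (trans (trans (sym (update-at c w (c x))) (sym (update-off (update c w (c x)) (c w) q))) (trans (update-off (update c w (c x)) (c w) q) (trans (update-at c w (c x)) (trans e c₁-x')))))
      ... | no p = ⊥-elim (p (sw t (trans e c₁-x')))
      cliques₁ : Cliques c₁
      cliques₁ u v e d = go (u ≟F x') (v ≟F x')
        where
        fromW : ∀ u → u ≢ x' → u ≢ w → c₁ w ≡ c₁ u → w ~ u
        fromW u p q e = subst (w ~_) (sym ([ id , (λ h → ⊥-elim (p h)) ]′ (pair-only cl ed u (trans (sym (c₁-off q p)) (trans (sym e) c₁-w))))) wx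
        go : Dec (u ≡ x') → Dec (v ≡ x') → u ~ v
        go (yes refl) _ = ⊥-elim (d (sym (single₁ v (sym e))))
        go (no _) (yes refl) = ⊥-elim (d (single₁ u e))
        go (no p) (no q) = go₂ (u ≟F w) (v ≟F w)
          where
          go₂ : Dec (u ≡ w) → Dec (v ≡ w) → u ~ v
          go₂ (yes refl) (yes refl) = ⊥-elim (d refl)
          go₂ (yes refl) (no nv) = fromW v q nv e
          go₂ (no nu) (yes refl) = ~-sym (fromW u p nu (sym e))
          go₂ (no nu) (no nv) = cl u v (trans (sym (c₁-off nu p)) (trans e (c₁-off nv q))) d
      keep : ∀ {t t'} → Edge c t t' → c t ≢ c x → Edge c₁ t t' × c₁ t ≡ c t
      keep {t} {t'} e ne = (proj₁ e , trans e₁ (trans (proj₂ e) (sym (c₁-off (λ { refl → class≢ e (proj₂ e) }) (λ { refl → ne (trans (proj₂ e) (sym (proj₂ ed))) }))))) , e₁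
        where
        e₁ : c₁ t ≡ c t
        e₁ = c₁-off (λ { refl → class≢ e refl }) (λ { refl → ne (sym (proj₂ ed)) })

    Near : Fin m → Set
    Near t = t ≡ w ⊎ w ~ t ⊎ ∃ λ t' → Edge c t t' × w ~ t'

    Far : Fin m → Set
    Far t = ∃ λ t' → Edge c t t' × ¬ w ~ t × ¬ w ~ t'

    near-far : ∀ {t} → Near t → Far t → ⊥
    near-far (inj₁ refl) (_ , e , _) = class≢ e refl
    near-far (inj₂ (inj₁ p)) (_ , _ , q , _) = q p
    near-far (inj₂ (inj₂ (t₁ , e₁ , p))) (t₂ , e₂ , _ , q) with pair-only cl e₁ t₂ (sym (proj₂ e₂))
    ... | inj₁ refl = ~-≢ (proj₁ e₂) refl
    ... | inj₂ refl = q p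

    module _ (mate : ∀ t → t ≢ w → ∃ λ t' → Edge c t t') where

      near⊎far : ∀ t → Near t ⊎ Far t
      near⊎far t with t ≟F w
      ... | yes p = inj₁ (inj₁ p)
      ... | no p with mate t p
      ... | t' , e with w ~? t | w ~? t'
      ... | yes q | _ = inj₁ (inj₂ (inj₁ q))
      ... | no _ | yes q = inj₁ (inj₂ (inj₂ (t' , e , q)))
      ... | no q | no q' = inj₂ (t' , e , q , q')

      frontier : ∀ {u v} → Reach C u v → Near u → Far v → ∃ λ p → ∃ λ q → p ~ q × Near p × Far q
      frontier here n f = ⊥-elim (near-far n f)
      frontier (there {w = z} e rest) n f with near⊎far z
      ... | inj₁ nz = frontier rest nz f
      ... | inj₂ fz = _ , _ , e , n , fz

      -- If `w` has a neighbour in every other class, the classes are the legs of a subdivided star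
      -- with centre `w`. Exactly one end of each class is adjacent to `w`, as there are no
      -- triangles. Edges between two classes are excluded by a triangle through `w`, by a square
      -- through `w`, or by the 2-colouring.
      star : (∀ t → Near t) → IsSubdividedStar C
      star near = suc (suc r) , mk↔ₛ′ to from to-from from-to , λ u v → fwd u v , bwd u v
        where
        flag : Fin m → Bool
        flag t = not (E T w t)
        flag-~ : ∀ {t} → flag t ≡ false → w ~ t
        flag-~ {t} e with E T w t
        ... | true = refl
        flags : ∀ {t t'} → Edge c t t' → flag t' ≡ not (flag t)
        flags {t} {t'} e with E T w t in p | E T w t' in q
        ... | true | true = ⊥-elim (no-triangle p (proj₁ e) (~-sym q))
        ... | true | false = refl
        ... | false | true = refl
        ... | false | false = ⊥-elim (near-far (near t) (t' , e , (λ h → true≢false (trans (sym h) p)) , (λ h → true≢false (trans (sym h) q))))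
        off : ∀ {t} → t ≢ w → c w ≢ c t
        off p e = p (sw _ (sym e))
        to : Fin m → SSVertex (suc (suc r))
        to t with t ≟F w
        ... | yes _ = inj₁ tt
        ... | no p = inj₂ (punchOut (off p) , flag t)
        to-w : to w ≡ inj₁ tt
        to-w with w ≟F w
        ... | yes _ = refl
        ... | no p = ⊥-elim (p refl)
        to-off : ∀ {t} (p : t ≢ w) → to t ≡ inj₂ (punchOut (off p) , flag t)
        to-off {t} p with t ≟F w
        ... | yes q = ⊥-elim (p q)
        ... | no q = cong (λ i → inj₂ (i , flag t)) (punchOut-irr (off q) (off p))
          where
          punchOut-irr : ∀ {n} {i j : Fin (suc n)} (p q : i ≢ j) → punchOut p ≡ punchOut q
          punchOut-irr {i = i} p q = punchOut-cong i refl
        pick : ∀ i b → ∃ λ t → t ≢ w × c t ≡ punchIn (c w) i × flag t ≡ b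
        pick i b with surjective c cl (punchIn (c w) i)
        ... | t , e with mate t (λ { refl → punchInᵢ≢i (c w) i (sym e) })
        ... | t' , ed with flag t ≟B b
        ... | yes q = t , (λ { refl → punchInᵢ≢i (c w) i (sym e) }) , e , q
        ... | no q = t' , (λ { refl → class≢ ed (proj₂ ed) }) , trans (sym (proj₂ ed)) e , trans (flags ed) (neg (flag t) b q)
          where
          neg : ∀ x y → x ≢ y → not x ≡ y
          neg true true d = ⊥-elim (d refl)
          neg true false d = refl
          neg false true d = refl
          neg false false d = ⊥-elim (d refl)
        from : SSVertex (suc (suc r)) → Fin m
        from (inj₁ _) = w
        from (inj₂ (i , b)) = proj₁ (pick i b)
        to-from : ∀ s → to (from s) ≡ s
        to-from (inj₁ _) = to-w
        to-from (inj₂ (i , b)) with pick i b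
        ... | t , p , e , q = trans (to-off p) (cong₂ (λ i b → inj₂ (i , b)) (trans (punchOut-cong (c w) {i≢k = λ z → punchInᵢ≢i (c w) i (sym z)} e) (punchOut-punchIn (c w))) q)
        inj₂-injective : ∀ {k} {i j : Fin k × Bool} → _≡_ {A = ⊤ ⊎ (Fin k × Bool)} (inj₂ i) (inj₂ j) → i ≡ j
        inj₂-injective refl = refl
        to-injective : ∀ u v → to u ≡ to v → u ≡ v
        to-injective u v e with u ≟F w | v ≟F w
        ... | yes p | yes q = trans p (sym q)
        to-injective u v () | yes p | no q
        to-injective u v () | no p | yes q
        ... | no p | no q with u ≟F v
        ... | yes h = h
        ... | no h = ⊥-elim (x≢notx (flag u) (trans (cong proj₂ (inj₂-injective e)) (flags (cl u v ce h , ce))))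
          where
          ce : c u ≡ c v
          ce = punchOut-injective (off p) (off q) (cong proj₁ (inj₂-injective e))
          x≢notx : ∀ x → x ≡ not x → ⊥
          x≢notx true ()
          x≢notx false ()
        from-to : ∀ t → from (to t) ≡ t
        from-to t = to-injective _ _ (to-from (to t))
        same : ∀ {u v} → flag u ≡ false → flag v ≡ true → v ≢ w → u ~ v → c u ≡ c v
        same {u} {v} fu fv v≢w uv with mate v v≢w
        ... | v' , ed with u ≟F v'
        ... | yes refl = sym (proj₂ ed)
        ... | no d = ⊥-elim (no-square (flag-~ fu) uv (proj₁ ed) (~-sym (flag-~ (trans (flags ed) (cong not fv)))) (λ e → v≢w (sym e)) d)
        cw : ∀ {u} → flag u ≡ true → u ≢ w → col u ≡ col w
        cw {u} fu u≢w with mate u u≢w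
        ... | u' , ed = two-steps (proj₁ ed) (~-sym (flag-~ (trans (flags ed) (cong not fu))))
        fwd : ∀ u v → u ~ v → SSAdj (to u) (to v)
        fwd u v uv with u ≟F w | v ≟F w
        ... | yes refl | yes refl = ~-≢ uv refl
        ... | yes refl | no q rewrite uv = tt
        ... | no p | yes refl rewrite ~-sym uv = tt
        ... | no p | no q with flag u in fu | flag v in fv
        ... | true | true = same-colour (trans (cw fu p) (sym (cw fv q))) uv
        ... | false | false = no-triangle (flag-~ fu) uv (~-sym (flag-~ fv))
        ... | false | true = punchOut-cong (c w) (same fu fv q uv)
        ... | true | false = punchOut-cong (c w) (sym (same fv fu p (~-sym uv)))
        edge : ∀ {u v} (p : u ≢ w) (q : v ≢ w) → flag u ≢ flag v → punchOut (off p) ≡ punchOut (off q) → u ~ v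
        edge {u} {v} p q d e = cl u v (punchOut-injective (off p) (off q) e) (λ { refl → d refl })
        bwd : ∀ u v → SSAdj (to u) (to v) → u ~ v
        bwd u v s with u ≟F w | v ≟F w
        bwd u v () | yes _ | yes _
        bwd u v s | yes refl | no q with flag v in fv
        ... | false = flag-~ fv
        bwd u v s | no p | yes refl with flag u in fu
        ... | false = ~-sym (flag-~ fu)
        bwd u v s | no p | no q with flag u in fu | flag v in fv
        ... | false | true = edge p q (λ e → true≢false (trans (sym fv) (trans (sym e) fu))) s
        ... | true | false = edge p q (λ e → true≢false (trans (sym fu) (trans e fv))) s

      far-class : ∃ Far
      far-class with search⊎ near⊎far
      ... | inj₁ near = ⊥-elim (noSS (star near))
      ... | inj₂ f = f

      Frontier : Set
      Frontier = ∃ λ x → ∃ λ x' → ∃ λ y → ∃ λ z → Edge c x x' × w ~ x × Edge c y z × ¬ w ~ y × ¬ w ~ z × (x ~ y ⊎ x' ~ y)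

      -- Since `T` is connected and not a subdivided star, some edge leads from a near vertex to a
      -- far one. It does not start at `w`, whose neighbours are near.
      find-frontier : Frontier
      find-frontier with frontier (proj₁ (proj₂ isTree) w (proj₁ far-class)) (inj₁ refl) (proj₂ far-class)
      ... | p , q , pq , inj₁ refl , (z , ed , wq , wz) = ⊥-elim (wq pq)
      ... | p , q , pq , inj₂ (inj₁ wp) , (z , ed , wq , wz) = let (p' , ep) = mate p (λ e → ~-≢ wp (sym e)) in
              p , p' , q , z , ep , wp , ed , wq , wz , inj₁ pq
      ... | p , q , pq , inj₂ (inj₂ (p' , ep , wp)) , (z , ed , wq , wz) =
              p' , p , q , z , edge-swap ep , wp , ed , wq , wz , inj₂ pq

      module _ {x x' y z : Fin m} (ex : Edge c x x') (wx : w ~ x) (ey : Edge c y z) (wy : ¬ w ~ y) (wz : ¬ w ~ z) where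
        classes : c x ≢ c y
        classes e with pair-only cl ex y (sym e)
        ... | inj₁ refl = wy wx
        ... | inj₂ refl with pair-only cl (edge-swap ex) z (sym (proj₂ ey))
        ... | inj₁ refl = ~-≢ (proj₁ ey) refl
        ... | inj₂ refl = wz wx
        x≢z : x ≢ z
        x≢z refl = wz wx
        x'≢y : x' ≢ y
        x'≢y refl = classes (proj₂ ex)
        wx' : ¬ w ~ x'
        wx' q = no-triangle wx (proj₁ ex) (~-sym q)

        config₁ : x ~ y → ShapeS T (suc r)
        config₁ xy = shapeS ex ey classes xy wx' wz
          (λ q → no-square (~-sym (proj₁ ex)) xy (proj₁ ey) (~-sym q) x'≢y x≢z)

  -- A second neighbour `x₁` of `w` allows a switch along `w`, `x₁`, `d₀` that leaves the classes of
  -- `x` and `y` alone. Then `x'` and `y` form the new clique and `d₀`, `x`, `z` the stable set: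
  -- `d₀` and `z` have the same colour, the other two pairs are excluded by squares.
  config₂ : ∀ c (cl : Cliques c) w (sw : Single c w) (mate : ∀ t → t ≢ w → ∃ λ t' → Edge c t t') {x x' y z} →
    Edge c x x' → w ~ x → Edge c y z → ¬ w ~ y → ¬ w ~ z → x' ~ y → ∀ {x₁} → w ~ x₁ → x₁ ≢ x → ShapeS T (suc r)
  config₂ c cl w sw mate {x} {x'} {y} {z} ex wx ey wy wz x'y {x₁} wx₁ x₁≢x = OneSingle.shapeS c₁ cliques₁ d₀ single₁ (edge-swap {c₁} (proj₁ kx)) (proj₁ ky)
      (λ q → cx≢cy (trans (sym (proj₂ kx)) (trans (proj₂ (proj₁ kx)) (trans q (proj₂ ky))))) x'y
      (λ q → no-square (~-sym (proj₁ e₁)) (~-sym wx₁) wx (~-sym q) d₀≢w x₁≢x)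
      (same-colour (trans (two-steps (~-sym (proj₁ e₁)) (~-sym wx₁)) (trans (two-steps wx (proj₁ ex)) (two-steps x'y (proj₁ ey)))))
      (λ q → no-square (proj₁ ex) x'y (proj₁ ey) (~-sym q) (λ { refl → wy wx }) (λ { refl → cx≢cy (trans (proj₂ ex) (sym (proj₂ ey))) }))
    where
    open OneSingle c cl w sw
    d₀ : Fin m
    d₀ = proj₁ (mate x₁ (λ e → ~-≢ wx₁ (sym e)))
    e₁ : Edge c x₁ d₀
    e₁ = proj₂ (mate x₁ (λ e → ~-≢ wx₁ (sym e)))
    open Switch e₁ wx₁
    cx≢cy : c x ≢ c y
    cx≢cy = classes mate ex wx ey wy wz
    cx≢cx₁ : c x ≢ c x₁
    cx≢cx₁ e = [ x₁≢x , (λ { refl → no-triangle wx (proj₁ ex) (~-sym wx₁) }) ]′ (pair-only cl ex x₁ (sym e))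
    cy≢cx₁ : c y ≢ c x₁
    cy≢cx₁ e = [ (λ { refl → wy wx₁ }) , (λ { refl → wz wx₁ }) ]′ (pair-only cl ey x₁ (sym e))
    kx : Edge c₁ x x' × c₁ x ≡ c x
    kx = keep ex cx≢cx₁
    ky : Edge c₁ y z × c₁ y ≡ c y
    ky = keep ey cy≢cx₁
    d₀≢w : d₀ ≢ w
    d₀≢w e = class≢ e₁ (trans (proj₂ e₁) (cong c e))

  mates : ∀ c → Cliques c → ∀ w → Single c w → (∀ t → t ≢ w → ∃ λ t' → Edge c t t') ⊎ (∃ λ w' → Single c w' × w ≢ w')
  mates c cl w sw with search⊎ (λ t → alternatives t (t ≟F w))
    where
    alternatives : ∀ t → Dec (t ≡ w) → (t ≢ w → ∃ λ t' → Edge c t t') ⊎ (Single c t × w ≢ t)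
    alternatives t (yes p) = inj₁ (λ q → ⊥-elim (q p))
    alternatives t (no p) = [ (λ e → inj₁ (λ _ → e)) , (λ s → inj₂ (s , λ e → p (sym e))) ]′ (partner? c cl t)
  ... | inj₁ f = inj₁ f
  ... | inj₂ q = inj₂ q

  someSingle : ∀ c → Cliques c → ∃ (Single c)
  someSingle c cl with search⊎ (partner? c cl)
  ... | inj₂ s = s
  ... | inj₁ f = ⊥-elim (noPM ((λ t → proj₁ (f t)) , (λ t → proj₁ (proj₂ (f t))) , involutive))
    where
    involutive : ∀ t → proj₁ (f (proj₁ (f t))) ≡ t
    involutive t with f t
    ... | t' , e with f t'
    ... | t'' , e' with pair-only cl (edge-swap e) t'' (sym (proj₂ e'))
    ... | inj₁ refl = ⊥-elim (~-≢ (proj₁ e') refl)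
    ... | inj₂ p = p

  shapes : Shapes
  shapes with cliqueCover
  ... | c , cl with someSingle c cl
  ... | w , sw with mates c cl w sw
  ... | inj₂ (w' , sw' , d) = two-singles c cl w w' sw sw' d
  ... | inj₁ mate with OneSingle.find-frontier c cl w sw mate
  ... | x , x' , y , z , ex , wx , ey , wy , wz , alt = shape₁ ex wx , shape₂ ey wy wz , stableShape alt
    where
    open OneSingle c cl w sw
    stableShape : x ~ y ⊎ x' ~ y → ShapeS T (suc r)
    stableShape (inj₁ xy) = config₁ mate ex wx ey wy wz xy
    stableShape (inj₂ x'y) with any? (λ x₁ → (w ~? x₁) ×-dec ¬? (x₁ ≟F x))
    ... | yes (x₁ , p , q) = config₂ c cl w sw mate ex wx ey wy wz x'y p q
    -- After the switch along `w`, `x`, `x'` the singleton is `x'`, which has the two neighbours `x`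
    -- and `y`. Whatever neighbour `u` of `x'` the new frontier produces, one of these two differs
    -- from it, so `config₂` applies whenever `config₁` does not.
    ... | no none with mates c₁ cliques₁ x' single₁
      where open Switch ex wx
    ... | inj₂ (w' , sw' , d) = proj₂ (proj₂ (two-singles c₁ cliques₁ x' w' single₁ sw' d))
      where open Switch ex wx
    ... | inj₁ mate₁ with OneSingle.find-frontier (Switch.c₁ ex wx) (Switch.cliques₁ ex wx) x' (Switch.single₁ ex wx) mate₁
    ... | u , u' , v , v' , eu , x'u , ev , x'v , x'v' , inj₁ uv = OneSingle.config₁ (Switch.c₁ ex wx) (Switch.cliques₁ ex wx) x' (Switch.single₁ ex wx) mate₁ eu x'u ev x'v x'v' uv
    ... | u , u' , v , v' , eu , x'u , ev , x'v , x'v' , inj₂ u'v with x ≟F u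
    ... | yes refl = config₂ (Switch.c₁ ex wx) (Switch.cliques₁ ex wx) x' (Switch.single₁ ex wx) mate₁ eu x'u ev x'v x'v' u'v x'y (λ { refl → wy wx })
    ... | no d = config₂ (Switch.c₁ ex wx) (Switch.cliques₁ ex wx) x' (Switch.single₁ ex wx) mate₁ eu x'u ev x'v x'v' u'v (~-sym (proj₁ ex)) d

-- Configurations of generic parts excluded by T-freeness

record Parts {n : ℕ} (G : Graph n) (m r : ℕ) (σ : Fin r → Bool) : Set where
  field
    Λ : ℕ → ℕ
    Λ-double : ∀ ℓ → 2 * Λ ℓ ≤ Λ (suc ℓ)
    B : Fin r → Pred n
    N : Fin r → ℕ
    N>0 : ∀ i → 0 < N i
    cross : ∀ i k → toℕ i < toℕ k → ∀ b ℓ → ℓ < m → ∀ Q → Q ⊑ B k → N k ≤ Λ ℓ * # Q →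
      m * (Λ ℓ * # (B i ∩ λ x → ⌊ Λ (suc ℓ) * # (Q ∩ nb G b x) <? N k ⌋)) < N i
    inner : ∀ i x → B i x ≡ true → 2 * (Λ m * # (B i ∩ ∁ (nb G (σ i) x))) ≤ N i

module Forbidden {m n r : ℕ} (T : Graph m) (G : Graph n) (free : ¬ Contains T G) where

  -- The exceptional label goes to the part `i`, the `r` clique labels to the `r` other parts.
  pos : Fin (suc r) → Maybe (Fin r) → Fin (suc r)
  pos i nothing = i
  pos i (just k) = punchIn i k

  pos-injective : ∀ i x y → pos i x ≡ pos i y → x ≡ y
  pos-injective i nothing nothing _ = refl
  pos-injective i nothing (just y) e = ⊥-elim (punchInᵢ≢i i y (sym e))
  pos-injective i (just x) nothing e = ⊥-elim (punchInᵢ≢i i x e)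
  pos-injective i (just x) (just y) e = cong just (punchIn-injective i x y e)

  -- With `w` placed at `v`, the rest of the exceptional part has to consist of non-neighbours of
  -- `v`, while the cliques of `T` may need either adjacency to `v`; this is why both values of `b`
  -- are required in the other parts.
  no-shape₂ : Shape₂ T r → ∀ v i → (P : Parts G m (suc r) (const true)) → let open Parts P in
    N i ≤ Λ 0 * # (B i ∩ nb G false v) → (∀ k → k ≢ i → ∀ b → N k ≤ Λ 0 * # (B k ∩ nb G b v)) → ⊥
  no-shape₂ S v i P hi hk = free (place (pos i ∘ pt) ext C c₁ c₂ c₃ c₄ c₅ (const v))
    where
    open Parts P
    open Shape₂ S
    open PartEmbedding T G Λ Λ-double B N N>0 (const true) cross inner
    ext : Fin m → Maybe (Fin n)
    ext t = if ⌊ t ≟F w ⌋ then just v else nothing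
    C : Fin m → Pred n
    C t = B (pos i (pt t)) ∩ nb G (E T w t) v
    ext-nothing : ∀ {t} → ext t ≡ nothing → t ≢ w
    ext-nothing {t} e with t ≟F w
    ... | no p = p
    ext-just : ∀ {t y} → ext t ≡ just y → t ≡ w × v ≡ y
    ext-just {t} e with t ≟F w
    ext-just refl | yes p = p , refl
    c₁ : ∀ t → ext t ≡ nothing → C t ⊑ B (pos i (pt t))
    c₁ t _ {z} p = ∧-left {B (pos i (pt t)) z} p
    c₂ : ∀ t t' y z → ext t ≡ nothing → ext t' ≡ just y → C t z ≡ true → nb G (E T t' t) y z ≡ true
    c₂ t t' y z _ e p with ext-just {t'} e
    ... | refl , refl = ∧-right {B (pos i (pt t)) z} p
    c₃ : ∀ t → ext t ≡ nothing → N (pos i (pt t)) ≤ Λ 0 * # (C t)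
    c₃ t e with pt t in ept
    ... | nothing = subst (λ b → N i ≤ Λ 0 * # (B i ∩ nb G b v)) (sym (apart t ept (ext-nothing {t} e))) hi
    ... | just k = hk (punchIn i k) (λ q → punchInᵢ≢i i k q) (E T w t)
    c₄ : ∀ t t' → ext t ≡ nothing → ext t' ≡ nothing → t ≢ t' → pos i (pt t) ≡ pos i (pt t') → E T t t' ≡ true
    c₄ t t' e e' d q = clique t t' d (pos-injective i _ _ q) (ext-nothing {t} e) (ext-nothing {t'} e')
    c₅ : ∀ t t' y y' → ext t ≡ just y → ext t' ≡ just y' → t ≢ t' → nb G (E T t t') y y' ≡ true
    c₅ t t' y y' e e' d = ⊥-elim (d (trans (proj₁ (ext-just {t} e)) (sym (proj₁ (ext-just {t'} e')))))

  no-shape₁ : Shape₁ T r → ∀ u v i → u ≢ v → E G u v ≡ false → (P : Parts G m (suc r) (const true)) → let open Parts P in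
    N i ≤ Λ 0 * # (B i ∩ nb G true u ∩ nb G true v) →
    (∀ k → k ≢ i → ∀ b b' → N k ≤ Λ 0 * # (B k ∩ nb G b u ∩ nb G b' v)) → ⊥
  no-shape₁ S u v i u≢v uv P hi hk = free (place (pos i ∘ pt) ext C c₁ c₂ c₃ c₄ c₅ (const v))
    where
    open Parts P
    open Shape₁ S
    open PartEmbedding T G Λ Λ-double B N N>0 (const true) cross inner
    ext : Fin m → Maybe (Fin n)
    ext t = if ⌊ t ≟F w ⌋ then just u else (if ⌊ t ≟F w' ⌋ then just v else nothing)
    C : Fin m → Pred n
    C t = B (pos i (pt t)) ∩ nb G (E T w t) u ∩ nb G (E T w' t) v
    ext-nothing : ∀ {t} → ext t ≡ nothing → t ≢ w × t ≢ w'
    ext-nothing {t} e with t ≟F w | t ≟F w'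
    ... | no p | no q = p , q
    ext-just : ∀ {t y} → ext t ≡ just y → (t ≡ w × u ≡ y) ⊎ (t ≡ w' × v ≡ y)
    ext-just {t} e with t ≟F w | t ≟F w'
    ext-just refl | yes p | _ = inj₁ (p , refl)
    ext-just refl | no _ | yes p = inj₂ (p , refl)
    c₁ : ∀ t → ext t ≡ nothing → C t ⊑ B (pos i (pt t))
    c₁ t _ {z} p = ∧-left {B (pos i (pt t)) z} p
    c₂ : ∀ t t' y z → ext t ≡ nothing → ext t' ≡ just y → C t z ≡ true → nb G (E T t' t) y z ≡ true
    c₂ t t' y z _ e p with ext-just {t'} e
    ... | inj₁ (refl , refl) = ∧-left {nb G (E T w t) u z} (∧-right {B (pos i (pt t)) z} p)
    ... | inj₂ (refl , refl) = ∧-right {nb G (E T w t) u z} (∧-right {B (pos i (pt t)) z} p)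
    c₃ : ∀ t → ext t ≡ nothing → N (pos i (pt t)) ≤ Λ 0 * # (C t)
    c₃ t e with pt t in ept
    ... | nothing = let (p , q) = ext-nothing {t} e ; (j , j') = joined t ept p q in
      subst₂ (λ b b' → N i ≤ Λ 0 * # (B i ∩ nb G b u ∩ nb G b' v)) (sym j) (sym j') hi
    ... | just k = hk (punchIn i k) (λ q → punchInᵢ≢i i k q) (E T w t) (E T w' t)
    c₄ : ∀ t t' → ext t ≡ nothing → ext t' ≡ nothing → t ≢ t' → pos i (pt t) ≡ pos i (pt t') → E T t t' ≡ true
    c₄ t t' e e' d q = let (p₁ , p₂) = ext-nothing {t} e ; (q₁ , q₂) = ext-nothing {t'} e' in
      clique t t' d (pos-injective i _ _ q) p₁ p₂ q₁ q₂
    c₅ : ∀ t t' y y' → ext t ≡ just y → ext t' ≡ just y' → t ≢ t' → nb G (E T t t') y y' ≡ true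
    c₅ t t' y y' e e' d with ext-just {t} e | ext-just {t'} e'
    ... | inj₁ (refl , refl) | inj₁ (refl , _) = ⊥-elim (d refl)
    ... | inj₁ (refl , refl) | inj₂ (refl , refl) = nb-intro G (λ q → u≢v (sym q)) (trans uv (sym ww'))
    ... | inj₂ (refl , refl) | inj₁ (refl , refl) = nb-intro G u≢v (trans (E-sym G v u) (trans uv (trans (sym ww') (E-sym T w w'))))
    ... | inj₂ (refl , refl) | inj₂ (refl , _) = ⊥-elim (d refl)

  default : ∀ {σ} (P : Parts G m (suc r) σ) → let open Parts P in (∀ i → N i ≤ Λ 0 * # (B i)) → Fin n
  default P big = proj₁ (witness (B zero) (*-cancelˡ-< (Λ 0) 0 _ (subst (_< Λ 0 * # (B zero)) (sym (*-zeroʳ (Λ 0))) (≤-trans (N>0 zero) (big zero)))))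
    where open Parts P

  no-shapeS : ShapeS T r → ∀ {σ} i → σ i ≡ false → (∀ k → k ≢ i → σ k ≡ true) → (P : Parts G m (suc r) σ) → let open Parts P in
    (∀ k → N k ≤ Λ 0 * # (B k)) → ⊥
  no-shapeS S {σ} i σi σk P big = free (place (pos i ∘ pt) (const nothing) (λ t → B (pos i (pt t))) (λ _ _ p → p)
    (λ _ _ _ _ _ ()) (λ t _ → big (pos i (pt t))) (λ t t' _ _ d e → c₄ t t' d (pos-injective i (pt t) (pt t') e)) (λ _ _ _ _ ()) (const (default P big)))
    where
    open Parts P
    open ShapeS S
    open PartEmbedding T G Λ Λ-double B N N>0 σ cross inner
    c₄ : ∀ t t' → t ≢ t' → pt t ≡ pt t' → E T t t' ≡ σ (pos i (pt t))
    c₄ t t' d e with pt t in eq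
    ... | nothing = trans (stable t t' eq (sym e)) (sym σi)
    ... | just k = trans (clique t t' k d eq (sym e)) (sym (σk _ (punchInᵢ≢i i k)))

  no-bipartition : Bipartition T → ∀ {σ} i j → i ≢ j → σ i ≡ false → σ j ≡ false → (P : Parts G m (suc r) σ) → let open Parts P in
    (∀ k → N k ≤ Λ 0 * # (B k)) → ⊥
  no-bipartition S {σ} i j i≢j σi σj P big = free (place side (const nothing) (λ t → B (side t)) (λ _ _ p → p)
    (λ _ _ _ _ _ ()) (λ t _ → big (side t)) (λ t t' _ _ d e → c₄ t t' e) (λ _ _ _ _ ()) (const (default P big)))
    where
    open Parts P
    open Bipartition S
    open PartEmbedding T G Λ Λ-double B N N>0 σ cross inner
    side : Fin m → Fin (suc r)
    side t = if col t then i else j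
    c₄ : ∀ t t' → side t ≡ side t' → E T t t' ≡ σ (side t)
    c₄ t t' e with col t in c | col t' in c'
    ... | true | true = trans (proper t t' (trans c (sym c'))) (sym σi)
    ... | false | false = trans (proper t t' (trans c (sym c'))) (sym σj)
    ... | true | false = ⊥-elim (i≢j e)
    ... | false | true = ⊥-elim (i≢j (sym e))

  -- A single nearly stable part would admit `T` through `ShapeS`, two of them through the
  -- bipartition.
  all-cliques : ShapeS T r → Bipartition T → ∀ {σ} (P : Parts G m (suc r) σ) → let open Parts P in
    (∀ k → N k ≤ Λ 0 * # (B k)) → ∀ k → σ k ≡ true
  all-cliques S bip {σ} P big k with σ k in eq
  ... | true = refl
  ... | false with any? (λ j → (σ j ≟B false) ×-dec ¬? (k ≟F j))
  ... | yes (j , σj , d) = ⊥-elim (no-bipartition bip k j d eq σj P big)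
  ... | no none = ⊥-elim (no-shapeS S k eq others P big)
    where
    others : ∀ j → j ≢ k → σ j ≡ true
    others j d with σ j in e
    ... | true = refl
    ... | false = ⊥-elim (none (j , e , λ q → d (sym q)))

-- Almost homogeneous sets: constants and Rödl's theorem

module Constants (m : ℕ) where

  flat-constant : ℕ → ℕ
  flat-constant w = suc m * w ^ m

  -- A recursion of Erdős-Szekeres type. `K` and `ω'` are the constants of `join` for `e = i + j`,
  -- with `c` large enough for both predecessors. The argument `2 * (2 * ω')` allows for two uses of
  -- `markov`.
  finds-constant : ℕ → ℕ → ℕ
  finds-constant zero j = 1
  finds-constant (suc i) zero = 1
  finds-constant (suc i) (suc j) = flat-constant (2 * (2 * ω')) * (2 * K)
    where
    c K ω' : ℕ
    c = finds-constant i (suc j) + finds-constant (suc i) j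
    K = 2 * (c + 2 ^ (i + j))
    ω' = 2 * (K * 4 ^ suc (i + j))

  rödl-constant : ℕ → ℕ
  rödl-constant ε = 2 * finds-constant (3 * ε) (3 * ε)

  finds-constant>0 : ∀ i j → 0 < finds-constant i j
  finds-constant>0 zero j = s≤s z≤n
  finds-constant>0 (suc i) zero = s≤s z≤n
  finds-constant>0 (suc i) (suc j) = *-mono-≤ {1} {_} {1} (*-mono-≤ {1} {suc m} {1} (s≤s z≤n)
      (m^n>0 _ ⦃ >-nonZero (p₂ (p₂ (p₂ (*-mono-≤ {1} {_} {1} (p₂ K>0) (m^n>0 4 (suc (i + j))))))) ⦄ m)) (p₂ (p₂ K>0))
    where
    p₂ : ∀ {a} → 0 < a → 0 < 2 * a
    p₂ q = ≤-trans q (m≤m+n _ _)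
    K>0 : 0 < finds-constant i (suc j) + finds-constant (suc i) j + 2 ^ (i + j)
    K>0 = ≤-trans (m^n>0 2 (i + j)) (m≤n+m _ _)

open Constants public

*-^ : ∀ a b k → (a * b) ^ k ≡ a ^ k * b ^ k
*-^ a b zero = refl
*-^ a b (suc k) = trans (cong (a * b *_) (*-^ a b k)) (re a b (a ^ k) (b ^ k))
  where
  re : ∀ a b x y → a * b * (x * y) ≡ a * x * (b * y)
  re = solve-∀

k<2^k : ∀ k → k < 2 ^ k
k<2^k zero = s≤s z≤n
k<2^k (suc k) = ≤-trans (s≤s (k<2^k k)) (≤-trans (+-monoˡ-≤ (2 ^ k) (m^n>0 2 k)) (≤-reflexive (cong (2 ^ k +_) (sym (+-identityʳ _)))))

-- That is, `(3/4)^(3k)` is at most `2^(-k)`, hence at most `1/k`, because `2 * 27 ≤ 64`.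
ratio : ∀ k → k * 3 ^ (3 * k) ≤ 4 ^ (3 * k)
ratio k = begin
  k * 3 ^ (3 * k)   ≤⟨ *-monoˡ-≤ _ (<⇒≤ (k<2^k k)) ⟩
  2 ^ k * 3 ^ (3 * k)  ≡⟨ cong (2 ^ k *_) (sym (^-*-assoc 3 3 k)) ⟩
  2 ^ k * 27 ^ k  ≡⟨ sym (*-^ 2 27 k) ⟩
  54 ^ k  ≤⟨ ^-monoˡ-≤ k (m≤m+n 54 10) ⟩
  64 ^ k ≡⟨ ^-*-assoc 4 3 k ⟩
  4 ^ (3 * k) ∎
  where
  open ≤-Reasoning

-- Rödl's theorem: a T-free graph has linear-sized almost homogeneous sets inside every set U.
module Homogeneous {m n : ℕ} (T : Graph m) (G : Graph n) (free : ¬ Contains T G) where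

  -- If no large pair of this kind existed, `Few` would hold for all pairs of vertices of `T`, and
  -- `embed` would find `T` inside `U`.
  flat-pair : ∀ w → 0 < w → ∀ U → 0 < # U →
    (∀ b P Q → P ⊑ U → Q ⊑ U → # U ≤ flat-constant m w * # P → # U ≤ flat-constant m w * # Q →
      (∀ x → P x ≡ true → w * # (Q ∩ nb G b x) < # Q) → ⊥) → ⊥
  flat-pair w w>0 U U>0 none = free (f , λ u v d → [ id , (λ q → subst (λ b → nb G b (f u) (f v) ≡ true) (E-sym T v u) (nb-sym G q)) ]′
      (allPairs-lookup (proj₂ (proj₂ emb)) (∈-allFin u) (∈-allFin v) d))
    where
    instance
      w≢0 : NonZero w
      w≢0 = >-nonZero w>0
    open Embedding T G m (w ^_) (const (# U)) (const U>0)
    pow : ∀ {ℓ} → ℓ < m → w ^ ℓ ≤ w ^ m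
    pow lt = ^-monoʳ-≤ w (<⇒≤ lt)
    few : ∀ t t' → Few (const U) t t'
    few t t' ℓ ℓ<m Q Q⊑ big with m * (w ^ ℓ * # (U ∩ loses (w ^ suc ℓ) (# U) (E T t t') Q)) <? # U
    ... | yes p = p
    ... | no q = ⊥-elim (none (E T t t') (U ∩ loses (w ^ suc ℓ) (# U) (E T t t') Q) Q (λ {x} p → ∧-left {U x} p) Q⊑
        (≤-trans (≮⇒≥ q) (≤-trans (m ⊗ *-monoˡ-≤ _ (pow ℓ<m)) (≤-trans (≤-reflexive (sym (*-assoc m (w ^ m) _))) (*-monoˡ-≤ _ (*-monoˡ-≤ (w ^ m) (n≤1+n m))))))
        (≤-trans big (*-monoˡ-≤ (# Q) (≤-trans (pow ℓ<m) (m≤m+n _ _))))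
        (λ x p → *-cancelˡ-< (w ^ ℓ) _ _ (<-≤-trans (subst (_< # U) (re w (w ^ ℓ) _) (dec-elim {d = _ <? _} (∧-right {U x} p))) big)))
      where
      re : ∀ w p k → w * p * k ≡ p * (w * k)
      re = solve-∀
    pairs : ∀ L → Unique L → AllPairs (λ t t' → t ≢ t' × Few (const U) t t') L
    pairs [] [] = []
    pairs (t ∷ L) (d ∷ ds) = AllM.map (λ {t'} q → q , few t t') d ∷ pairs L ds
    emb : Σ (Fin m → Fin n) λ f → All (λ t → U (f t) ≡ true) (allFin m) ×
      AllPairs (λ t t' → nb G (E T t t') (f t) (f t') ≡ true) (allFin m)
    emb = embed (allFin m) 0 (const U) (≤-reflexive (length-tabulate id)) (AllM.tabulate (λ _ → ≤-reflexive (sym (+-identityʳ (# U)))))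
      (pairs (allFin m) (Unique-allFin⁺ m)) (const (proj₁ (witness U U>0)))
    f : Fin m → Fin n
    f = proj₁ emb

  -- Level `i` stands for an error rate of `(3/4)^i` at every vertex.
  Near : Bool → ℕ → Pred n → Set
  Near σ i B = ∀ x → B x ≡ true → 4 ^ i * # (B ∩ ∁ (nb G σ x)) ≤ 3 ^ i * # B

  -- Sets of size exactly 2^i s at level i, so that two of them of the same type can be joined.
  Finds : (Bool → ℕ) → ℕ → Set
  Finds lev c = ∀ s U → 0 < s → c * s ≤ # U →
    (∀ σ B → B ⊑ U → # B ≡ 2 ^ lev σ * s → Near σ (lev σ) B → ⊥) → ⊥

  other : ∀ {σ x} b → b ≡ not σ → x ≢ σ → x ≡ b
  other {true} {true} _ _ d = ⊥-elim (d refl)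
  other {true} {false} _ e _ = sym e
  other {false} {true} _ e _ = sym e
  other {false} {false} _ _ d = ⊥-elim (d refl)

  -- Two sets of colour `σ`, level `i` and equal size, with almost only `σ`-pairs between them, have
  -- a union of level `i + 1`: the inner error rate is halved, and `(3/4)^i / 2` plus a small cross
  -- term is at most `(3/4)^(i+1)`. If either search yields the opposite colour instead, that set
  -- already has the required level.
  join : ∀ σ i e → i ≤ e → ∀ (lev lev⁻ : Bool → ℕ) c → lev σ ≡ suc i → lev⁻ σ ≡ i → lev⁻ (not σ) ≡ lev (not σ) → Finds lev⁻ c →
    ∀ s U P Q → 0 < s → let K = 2 * (c + 2 ^ e) ; ω' = 2 * (K * 4 ^ suc e) in
    P ⊑ U → Q ⊑ U → 2 * (K * s) ≤ # P → 2 * (K * s) ≤ # Q → (∀ x → P x ≡ true → 2 * (2 * ω') * # (Q ∩ nb G (not σ) x) ≤ # Q) →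
    (∀ σ B → B ⊑ U → # B ≡ 2 ^ lev σ * s → Near σ (lev σ) B → ⊥) → ⊥
  join σ i e i≤e lev lev⁻ c eσ eσ⁻ e¬σ finds s U P Q s>0 P⊑ Q⊑ P≥ Q≥ flat fail =
    finds s P₁ s>0 cs≤P₁ (λ { τ B B⊑ sz near → branch τ B (λ p → P⊑ (P₁⊑ (B⊑ p))) sz near (second B B⊑) })
    where
    open ≤-Reasoning
    b : Bool
    b = not σ
    K δ ω' p : ℕ
    K = 2 * (c + 2 ^ e)
    δ = 4 ^ suc e
    ω' = 2 * (K * δ)
    p = 2 ^ i * s
    2^>0 : 0 < 2 ^ i
    2^>0 = m^n>0 2 i
    K>0 : 0 < K
    K>0 = ≤-trans (m^n>0 2 e) (≤-trans (m≤n+m _ c) (m≤m+n _ _))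
    Ks>0 : 0 < K * s
    Ks>0 = *-mono-≤ K>0 s>0
    Q₀ : Pred n
    Q₀ z = Q z ∧ ⌊ 2 * ω' * # (λ x → P x ∧ nb G b x z) ≤? # P ⌋
    P>0 : 0 < # P
    P>0 = ≤-trans Ks>0 (≤-trans (m≤m+n _ _) P≥)
    Q₀-half : # Q ≤ 2 * # Q₀
    Q₀-half = markov (2 * ω') Q P (λ z x → nb G b x z) P>0 flat
    Q₀≥ : K * s ≤ # Q₀
    Q₀≥ = *-cancelˡ-≤ 2 (≤-trans Q≥ Q₀-half)
    -- The exact size `K * s` turns the relative error bound towards this set into the absolute
    -- bound `K * s / ω'`. It stays small against the subset of size `2 ^ i * s` that is chosen
    -- later.
    trimmed : ∃ λ R → R ⊑ Q₀ × # R ≡ K * s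
    trimmed = trim (K * s) Q₀ Q₀≥
    Q₁ : Pred n
    Q₁ = proj₁ trimmed
    #Q₁ : # Q₁ ≡ K * s
    #Q₁ = proj₂ (proj₂ trimmed)
    P₁ : Pred n
    P₁ x = P x ∧ ⌊ ω' * # (λ z → Q₁ z ∧ nb G b x z) ≤? # Q₁ ⌋
    P₁-half : # P ≤ 2 * # P₁
    P₁-half = markov ω' P Q₁ (nb G b) (subst (0 <_) (sym #Q₁) Ks>0)
      (λ z q → dec-elim {d = _ ≤? _} (∧-right {Q z} (proj₁ (proj₂ trimmed) q)))
    P₁⊑ : P₁ ⊑ P
    P₁⊑ {x} q = ∧-left {P x} q
    c≤K : c ≤ K
    c≤K = ≤-trans (m≤m+n c _) (m≤m+n _ _)
    cs≤P₁ : c * s ≤ # P₁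
    cs≤P₁ = ≤-trans (*-monoˡ-≤ s c≤K) (*-cancelˡ-≤ 2 (≤-trans P≥ P₁-half))
    branch : ∀ τ B → B ⊑ U → # B ≡ 2 ^ lev⁻ τ * s → Near τ (lev⁻ τ) B → (# B ≡ p → Near σ i B → ⊥) → ⊥
    branch τ B B⊑ sz near k with τ ≟B σ
    ... | yes refl = k (trans sz (cong (λ j → 2 ^ j * s) eσ⁻)) (subst (λ j → Near σ j B) eσ⁻ near)
    ... | no d rewrite other {σ} (not σ) refl d = fail (not σ) B B⊑ (trans sz (cong (λ j → 2 ^ j * s) e¬σ)) (subst (λ j → Near (not σ) j B) e¬σ near)
    module _ (P' : Pred n) (P'⊑ : P' ⊑ P₁) (#P' : # P' ≡ p) (nearP : Near σ i P') where
      sparse : ∀ x → P' x ≡ true → ω' * # (Q₁ ∩ nb G b x) ≤ K * s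
      sparse x q = subst (ω' * # (Q₁ ∩ nb G b x) ≤_) #Q₁ (dec-elim {d = _ ≤? _} (∧-right {P x} (P'⊑ q)))
      p>0 : 0 < p
      p>0 = *-mono-≤ 2^>0 s>0
      Q₂ : Pred n
      Q₂ z = Q₁ z ∧ ⌊ δ * # (λ x → P' x ∧ nb G b x z) ≤? # P' ⌋
      Q₂-half : # Q₁ ≤ 2 * # Q₂
      Q₂-half = markov δ Q₁ P' (λ z x → nb G b x z) (subst (0 <_) (sym #P') p>0) (λ x q → begin
        2 * δ * # (Q₁ ∩ nb G b x)  ≤⟨ *-monoˡ-≤ _ (2 ⊗ m≤n*m δ K ⦃ >-nonZero K>0 ⦄) ⟩
        2 * (K * δ) * # (Q₁ ∩ nb G b x) ≡⟨⟩
        ω' * # (Q₁ ∩ nb G b x) ≤⟨ sparse x q ⟩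
        K * s ≡⟨ sym #Q₁ ⟩
        # Q₁ ∎)
      Q₃ : Pred n
      Q₃ = Q₂ ∩ ∁ P'
      cs≤Q₃ : c * s ≤ # Q₃
      cs≤Q₃ = +-cancelˡ-≤ p _ _ (begin
        p + c * s  ≡⟨ re c (2 ^ i) s ⟩
        (c + 2 ^ i) * s  ≤⟨ *-monoˡ-≤ s (+-monoʳ-≤ c (^-monoʳ-≤ 2 i≤e)) ⟩
        (c + 2 ^ e) * s  ≤⟨ *-cancelˡ-≤ 2 (≤-trans (≤-reflexive (sym (*-assoc 2 (c + 2 ^ e) s))) (≤-trans (≤-reflexive (sym #Q₁)) Q₂-half)) ⟩
        # Q₂  ≡⟨ #-split Q₂ P' ⟩
        # (Q₂ ∩ P') + # Q₃  ≤⟨ #-mono {S = Q₂ ∩ P'} {R = P'} (λ {x} q → ∧-right {Q₂ x} q) ⊕ ≤-refl ⟩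
        # P' + # Q₃  ≡⟨ cong (_+ # Q₃) #P' ⟩
        p + # Q₃ ∎)
        where
        re : ∀ c t s → t * s + c * s ≡ (c + t) * s
        re = solve-∀
      Q₃⊑Q₁ : Q₃ ⊑ Q₁
      Q₃⊑Q₁ {z} q = ∧-left {Q₁ z} (∧-left {Q₂ z} q)
      Q₃⊑U : Q₃ ⊑ U
      Q₃⊑U {z} q = Q⊑ (∧-left {Q z} (proj₁ (proj₂ trimmed) (Q₃⊑Q₁ q)))
      union : ∀ Q' → Q' ⊑ Q₃ → # Q' ≡ p → Near σ i Q' → ⊥
      union Q' Q'⊑ #Q' nearQ = fail σ B B⊑ (trans #B (trans (re (2 ^ i) s) (cong (λ j → 2 ^ j * s) (sym eσ)))) (subst (λ j → Near σ j B) (sym eσ) near)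
        where
        B : Pred n
        B = P' ∪ Q'
        B⊑ : B ⊑ U
        B⊑ {z} q = [ (λ h → P⊑ (P₁⊑ (P'⊑ h))) , (λ h → Q₃⊑U (Q'⊑ h)) ]′ (∨-elim {P' z} q)
        disjoint : ∀ z → P' z ≡ true → Q' z ≡ true → ⊥
        disjoint z h h' = not-elim (∧-right {Q₂ z} (Q'⊑ h')) h
        #B : # B ≡ p + p
        #B = ≤-antisym (≤-trans (#-∪ P' Q') (≤-reflexive (cong₂ _+_ #P' #Q'))) (≤-trans (≤-reflexive (sym (cong₂ _+_ #P' #Q'))) (#-⊎ P' Q' disjoint))
        re : ∀ t s → t * s + t * s ≡ 2 * t * s
        re = solve-∀
        err : ∀ x (X Y : Pred n) → (∀ z → X z ≡ true → Y z ≡ true → ⊥) → X x ≡ true → # X ≡ p → Near σ i X → B ⊑ X ∪ Y →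
          δ * # (Y ∩ nb G b x) ≤ p → 4 ^ suc i * # (B ∩ ∁ (nb G σ x)) ≤ 3 ^ suc i * # B
        err x X Y dis xX #X nearX B⊑ cross = begin
          4 ^ suc i * # (B ∩ ∁ (nb G σ x))  ≤⟨ 4 ^ suc i ⊗ #-cover {P = X ∩ ∁ (nb G σ x)} {R = Y ∩ nb G b x} (λ z q → sort z (∨-elim {X z} (B⊑ (∧-left {B z} q))) (∧-right {B z} q)) ⟩
          4 ^ suc i * (# (X ∩ ∁ (nb G σ x)) + # (Y ∩ nb G b x)) ≡⟨ re₁ (4 ^ i) (# (X ∩ ∁ (nb G σ x))) (# (Y ∩ nb G b x)) ⟩
          4 * (4 ^ i * # (X ∩ ∁ (nb G σ x))) + 4 ^ suc i * # (Y ∩ nb G b x) ≤⟨ (4 ⊗ nearX x xX) ⊕ ≤-trans (*-monoˡ-≤ _ (^-monoʳ-≤ 4 (s≤s i≤e))) cross ⟩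
          4 * (3 ^ i * # X) + p  ≡⟨ cong (λ k → 4 * (3 ^ i * k) + p) #X ⟩
          4 * (3 ^ i * p) + p ≤⟨ ≤-refl {4 * (3 ^ i * p)} ⊕ ≤-trans (m≤n*m p (3 ^ i) ⦃ >-nonZero (m^n>0 3 i) ⦄) (m≤m+n (3 ^ i * p) _) ⟩
          4 * (3 ^ i * p) + 2 * (3 ^ i * p)  ≡⟨ re₂ (3 ^ i) p ⟩
          3 ^ suc i * (p + p) ≡⟨ cong (3 ^ suc i *_) (sym #B) ⟩
          3 ^ suc i * # B ∎
          where
          re₁ : ∀ f a b → 4 * f * (a + b) ≡ 4 * (f * a) + 4 * f * b
          re₁ = solve-∀
          re₂ : ∀ t p → 4 * (t * p) + 2 * (t * p) ≡ 3 * t * (p + p)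
          re₂ = solve-∀
          sort : ∀ z → X z ≡ true ⊎ Y z ≡ true → ∁ (nb G σ x) z ≡ true → (X ∩ ∁ (nb G σ x)) z ≡ true ⊎ (Y ∩ nb G b x) z ≡ true
          sort z (inj₁ h) q = inj₁ (∧-intro h q)
          sort z (inj₂ h) q = inj₂ (∧-intro h (nb-intro G z≢x (other b refl (λ e → not-elim q (nb-intro G z≢x e)))))
            where
            z≢x : z ≢ x
            z≢x refl = dis z xX h
        near : Near σ (suc i) B
        near x q with ∨-elim {P' x} q
        ... | inj₁ h = err x P' Q' disjoint h #P' nearP id (begin
            δ * # (Q' ∩ nb G b x)  ≤⟨ δ ⊗ #-mono {S = Q' ∩ nb G b x} {R = Q₁ ∩ nb G b x} (λ {z} r → ∧-intro (Q₃⊑Q₁ (Q'⊑ (∧-left {Q' z} r))) (∧-right {Q' z} r)) ⟩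
            δ * # (Q₁ ∩ nb G b x)  ≤⟨ *-cancelˡ-≤ K ⦃ >-nonZero K>0 ⦄ (≤-trans (m≤m+n _ _) (≤-trans (≤-reflexive (re₁ K δ _)) (sparse x h))) ⟩
            s  ≤⟨ ≤-trans (≤-reflexive (sym (+-identityʳ s))) (*-monoˡ-≤ s 2^>0) ⟩
            p ∎)
            where
            re₁ : ∀ K δ k → K * (δ * k) + K * (δ * k) ≡ 2 * (K * δ) * k
            re₁ = solve-∀
        ... | inj₂ h = err x Q' P' (λ z a b → disjoint z b a) h #Q' nearQ (λ {z} r → [ ∨-introʳ {Q' z} , ∨-introˡ ]′ (∨-elim {P' z} r)) (begin
            δ * # (P' ∩ nb G b x)  ≤⟨ δ ⊗ #-mono {S = P' ∩ nb G b x} {R = λ z → P' z ∧ nb G b z x} (λ {z} r → ∧-intro (∧-left {P' z} r) (nb-sym G (∧-right {P' z} r))) ⟩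
            δ * # (λ z → P' z ∧ nb G b z x) ≤⟨ dec-elim {d = _ ≤? _} (∧-right {Q₁ x} (∧-left {Q₂ x} (Q'⊑ h))) ⟩
            # P' ≡⟨ #P' ⟩
            p ∎)
    second : ∀ B → B ⊑ P₁ → # B ≡ p → Near σ i B → ⊥
    second P' P'⊑ #P' nearP = finds s Q₃' s>0 (cs≤Q₃ P' P'⊑ #P' nearP)
        (λ { τ B B⊑ sz near → branch τ B (λ q → Q₃⊑U P' P'⊑ #P' nearP (B⊑ q)) sz near (union P' P'⊑ #P' nearP B B⊑) })
      where
      Q₃' : Pred n
      Q₃' = Q₃ P' P'⊑ #P' nearP

  levels : ℕ → ℕ → Bool → ℕ
  levels i j false = i
  levels i j true = j

  finds-mono : ∀ {lev c c'} → c ≤ c' → Finds lev c → Finds lev c'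
  finds-mono le f s U s>0 big = f s U s>0 (≤-trans (*-monoˡ-≤ s le) big)

  near₀ : ∀ σ B → Near σ 0 B
  near₀ σ B x _ = *-monoʳ-≤ 1 (#-mono {S = B ∩ ∁ (nb G σ x)} {R = B} (λ {z} q → ∧-left {B z} q))

  trivial : ∀ lev σ → lev σ ≡ 0 → Finds lev 1
  trivial lev σ e s U s>0 big fail with trim s U (≤-trans (≤-reflexive (sym (+-identityʳ s))) big)
  ... | B , B⊑ , #B = fail σ B B⊑ (trans #B (trans (sym (+-identityʳ s)) (cong (λ j → 2 ^ j * s) (sym e)))) (subst (λ j → Near σ j B) (sym e) (near₀ σ B))

  -- Induction on both levels as for Ramsey numbers: the pair given by `flat-pair` is poor in one
  -- adjacency, and `join` then raises the level of the opposite one.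
  finds : ∀ i j → Finds (levels i j) (finds-constant m i j)
  finds zero j = trivial (levels zero j) false refl
  finds (suc i) zero = trivial (levels (suc i) zero) true refl
  finds (suc i) (suc j) s U s>0 big fail = flat-pair w w>0 U U>0 found
    where
    open ≤-Reasoning
    c₁ c₂ c K ω' w : ℕ
    c₁ = finds-constant m i (suc j)
    c₂ = finds-constant m (suc i) j
    c = c₁ + c₂
    K = 2 * (c + 2 ^ (i + j))
    ω' = 2 * (K * 4 ^ suc (i + j))
    w = 2 * (2 * ω')
    pos : ∀ {a b} → 0 < a → 0 < b → 0 < a * b
    pos p q = *-mono-≤ p q
    K>0 : 0 < K
    K>0 = pos {2} (s≤s z≤n) (≤-trans (m^n>0 2 (i + j)) (m≤n+m _ c))
    w>0 : 0 < w
    w>0 = pos {2} (s≤s z≤n) (pos {2} (s≤s z≤n) (pos {2} (s≤s z≤n) (pos K>0 (m^n>0 4 (suc (i + j))))))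
    D>0 : 0 < flat-constant m w
    D>0 = pos {suc m} (s≤s z≤n) (m^n>0 w ⦃ >-nonZero w>0 ⦄ m)
    U>0 : 0 < # U
    U>0 = ≤-trans (pos (pos D>0 (pos {2} (s≤s z≤n) K>0)) s>0) big
    large : ∀ X → # U ≤ flat-constant m w * # X → 2 * (K * s) ≤ # X
    large X q = *-cancelˡ-≤ (flat-constant m w) ⦃ >-nonZero D>0 ⦄ (≤-trans (≤-reflexive (re (flat-constant m w) K s)) (≤-trans big q))
      where
      re : ∀ D K s → D * (2 * (K * s)) ≡ D * (2 * K) * s
      re = solve-∀
    found : ∀ b P Q → P ⊑ U → Q ⊑ U → # U ≤ flat-constant m w * # P → # U ≤ flat-constant m w * # Q →
      (∀ x → P x ≡ true → w * # (Q ∩ nb G b x) < # Q) → ⊥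
    found true P Q P⊑ Q⊑ P≥ Q≥ flat = join false i (i + j) (m≤m+n i j) (levels (suc i) (suc j)) (levels i (suc j)) c refl refl refl
      (finds-mono {levels i (suc j)} (m≤m+n c₁ c₂) (finds i (suc j))) s U P Q s>0 P⊑ Q⊑ (large P P≥) (large Q Q≥) (λ x p → <⇒≤ (flat x p)) fail
    found false P Q P⊑ Q⊑ P≥ Q≥ flat = join true j (i + j) (m≤n+m j i) (levels (suc i) (suc j)) (levels (suc i) j) c refl refl refl
      (finds-mono {levels (suc i) j} (m≤n+m c₂ c₁) (finds (suc i) j)) s U P Q s>0 P⊑ Q⊑ (large P P≥) (large Q Q≥) (λ x p → <⇒≤ (flat x p)) fail

  -- Level `3 * ε` in both colours is enough by `ratio`. The scale `s` is as large as `U` permits,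
  -- so the set found is a constant fraction of `U`.
  rödl : ∀ ε U → finds-constant m (3 * ε) (3 * ε) ≤ # U →
    (∀ σ B → B ⊑ U → # U ≤ rödl-constant m ε * # B → (∀ x → B x ≡ true → ε * # (B ∩ ∁ (nb G σ x)) ≤ # B) → ⊥) → ⊥
  rödl ε U big fail = finds L L s U s>0 cs≤U λ σ B B⊑ sz near → fail σ B B⊑ (large σ B sz) (homog σ B (level σ) near)
    where
    open ≤-Reasoning
    L c s : ℕ
    L = 3 * ε
    c = finds-constant m L L
    instance
      c≢0 : NonZero c
      c≢0 = >-nonZero (finds-constant>0 m L L)
    s = # U / c
    s>0 : 0 < s
    s>0 = m≥n⇒m/n>0 big
    cs≤U : c * s ≤ # U
    cs≤U = ≤-trans (≤-reflexive (*-comm c s)) (m/n*n≤m (# U) c)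
    level : ∀ σ → levels L L σ ≡ L
    level false = refl
    level true = refl
    large : ∀ σ B → # B ≡ 2 ^ levels L L σ * s → # U ≤ rödl-constant m ε * # B
    large σ B sz = begin
      # U  ≡⟨ m≡m%n+[m/n]*n (# U) c ⟩
      # U % c + s * c ≤⟨ ≤-trans (<⇒≤ (m%n<n (# U) c)) (≤-trans (≤-reflexive (sym (*-identityˡ c))) (*-monoˡ-≤ c s>0)) ⊕ ≤-refl ⟩
      s * c + s * c ≡⟨ re s c ⟩
      2 * c * s ≤⟨ 2 * c ⊗ ≤-trans (≤-reflexive (sym (*-identityˡ s))) (*-monoˡ-≤ s (m^n>0 2 (levels L L σ))) ⟩
      2 * c * (2 ^ levels L L σ * s) ≡⟨ cong (2 * c *_) (sym sz) ⟩
      2 * c * # B ∎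
      where
      re : ∀ s c → s * c + s * c ≡ 2 * c * s
      re = solve-∀
    homog : ∀ σ B {l} → l ≡ L → Near σ l B → ∀ x → B x ≡ true → ε * # (B ∩ ∁ (nb G σ x)) ≤ # B
    homog σ B refl near x q = *-cancelˡ-≤ (3 ^ L) ⦃ >-nonZero (m^n>0 3 L) ⦄ (begin
      3 ^ L * (ε * k)  ≡⟨ re (3 ^ L) ε k ⟩
      ε * 3 ^ L * k  ≤⟨ *-monoˡ-≤ k (ratio ε) ⟩
      4 ^ L * k  ≤⟨ near x q ⟩
      3 ^ L * # B ∎)
      where
      k : ℕ
      k = # (B ∩ ∁ (nb G σ x))
      re : ∀ t e k → t * (e * k) ≡ e * t * k
      re = solve-∀

-- Predictions and incompressible graphs

wrong : Maybe Bool → Bool → Bool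
wrong nothing _ = false
wrong (just true) c = not c
wrong (just false) c = c

isJust : Maybe Bool → Bool
isJust nothing = false
isJust (just _) = true

errors : ∀ {n} → Graph n → (Fin n → Maybe Bool) → Fin n → Pred n
errors G φ y z = wrong (φ z) (E G y z)

-- The prediction φ covers at least n/R + n/η vertices and the error rate is 1/ω.
Incompressible : ∀ {n} → Graph n → (R η ω K : ℕ) → Set
Incompressible {n} G R η ω K = ∀ (φ : Fin n → Maybe Bool) (Y : Pred n) →
  (η + R) * n ≤ R * η * # (isJust ∘ φ) → (∀ y → Y y ≡ true → ω * # (errors G φ y) ≤ n) → # Y < K

two-valued : ∀ {n} → Pred n → Bool → Pred n → Bool → Fin n → Maybe Bool
two-valued S₁ β₁ S₂ β₂ z = if S₁ z then just β₁ else (if S₂ z then just β₂ else nothing)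

wrong-value : ∀ β c → wrong (just β) c ≡ true → c ≡ not β
wrong-value true false _ = refl
wrong-value false true _ = refl

two-valued-dom : ∀ {n} (S₁ : Pred n) β₁ S₂ β₂ → (∀ x → S₁ x ≡ true → S₂ x ≡ true → ⊥) →
  # S₁ + # S₂ ≤ # (isJust ∘ two-valued S₁ β₁ S₂ β₂)
two-valued-dom S₁ β₁ S₂ β₂ dis = ≤-trans (#-⊎ S₁ S₂ dis) (#-mono λ {z} → dom (S₁ z) (S₂ z))
  where
  dom : ∀ a b → a ∨ b ≡ true → isJust (if a then just β₁ else (if b then just β₂ else nothing)) ≡ true
  dom true _ _ = refl
  dom false true _ = refl

two-valued-errors : ∀ {n} (G : Graph n) (S₁ : Pred n) β₁ S₂ β₂ y →
  # (errors G (two-valued S₁ β₁ S₂ β₂) y) ≤ # (S₁ ∩ nb G (not β₁) y) + # (S₂ ∩ nb G (not β₂) y) + 1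
two-valued-errors G S₁ β₁ S₂ β₂ y = ≤-trans (#-cover {P = (S₁ ∩ nb G (not β₁) y) ∪ (S₂ ∩ nb G (not β₂) y)} {R = λ z → ⌊ z ≟F y ⌋} sort)
  (#-∪ (S₁ ∩ nb G (not β₁) y) (S₂ ∩ nb G (not β₂) y) ⊕ ≤-reflexive (#-single y))
  where
  sort : ∀ z → errors G (two-valued S₁ β₁ S₂ β₂) y z ≡ true →
    ((S₁ ∩ nb G (not β₁) y) ∪ (S₂ ∩ nb G (not β₂) y)) z ≡ true ⊎ ⌊ z ≟F y ⌋ ≡ true
  sort z e = go (z ≟F y)
    where
    body : z ≢ y → ((S₁ ∩ nb G (not β₁) y) ∪ (S₂ ∩ nb G (not β₂) y)) z ≡ true
    body d with S₁ z | S₂ z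
    ... | true | _ = ∨-introˡ (nb-intro G d (wrong-value β₁ _ e))
    ... | false | true = nb-intro G d (wrong-value β₂ _ e)
    go : Dec (z ≡ y) → ((S₁ ∩ nb G (not β₁) y) ∪ (S₂ ∩ nb G (not β₂) y)) z ≡ true ⊎ ⌊ z ≟F y ⌋ ≡ true
    go (yes p) = inj₂ (dec-intro {d = z ≟F y} p)
    go (no p) = inj₁ (body p)

module UseIncompressible {n : ℕ} (G : Graph n) (R η ω K : ℕ) (inc : Incompressible G R η ω K) where

  direct : ∀ S₁ β₁ S₂ β₂ (Y : Pred n) → (∀ x → S₁ x ≡ true → S₂ x ≡ true → ⊥) → (η + R) * n ≤ R * η * (# S₁ + # S₂) →
    (∀ y → Y y ≡ true → ω * (# (S₁ ∩ nb G (not β₁) y) + # (S₂ ∩ nb G (not β₂) y) + 1) ≤ n) → # Y < K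
  direct S₁ β₁ S₂ β₂ Y dis big few = inc (two-valued S₁ β₁ S₂ β₂) Y (≤-trans big (R * η ⊗ two-valued-dom S₁ β₁ S₂ β₂ dis))
    (λ y q → ≤-trans (ω ⊗ two-valued-errors G S₁ β₁ S₂ β₂ y) (few y q))

  -- Here the vertices of `S₁` and `S₂` are almost homogeneous to `B`, instead of those of `B` to
  -- the domain. By `markov` at least half of `B` obeys the prediction with values `β₁` on `S₁` and
  -- `β₂` on `S₂`, so `direct` applies to that half.
  dual : ∀ S₁ β₁ S₂ β₂ (B : Pred n) → 0 < n → 0 < R → 2 * ω ≤ n → (∀ x → S₁ x ≡ true → S₂ x ≡ true → ⊥) →
    (η + R) * n ≤ R * η * (# S₁ + # S₂) →
    (∀ v → S₁ v ≡ true → 2 * (2 * ω) * # (B ∩ nb G (not β₁) v) ≤ # B) →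
    (∀ v → S₂ v ≡ true → 2 * (2 * ω) * # (B ∩ nb G (not β₂) v) ≤ # B) → 2 * K ≤ # B → ⊥
  dual S₁ β₁ S₂ β₂ B n>0 R>0 ω≤n dis big f₁ f₂ B≥ = <⇒≱ (direct S₁ β₁ S₂ β₂ Y dis big few) (*-cancelˡ-≤ 2 (≤-trans B≥ half))
    where
    open ≤-Reasoning
    H : Pred n
    H = S₁ ∪ S₂
    rel : Fin n → Fin n → Bool
    rel x v = (S₁ v ∧ nb G (not β₁) x v) ∨ (S₂ v ∧ nb G (not β₂) x v)
    Y : Pred n
    Y x = B x ∧ ⌊ 2 * ω * # (λ v → H v ∧ rel x v) ≤? # H ⌋
    H>0 : 0 < # H
    H>0 = n≢0⇒n>0 λ e → <⇒≱ (≤-trans (*-mono-≤ {1} {η + R} {1} (≤-trans R>0 (m≤n+m R η)) n>0) big)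
      (≤-trans (R * η ⊗ ≤-trans (#-⊎ S₁ S₂ dis) (≤-reflexive e)) (≤-reflexive (*-zeroʳ (R * η))))
    column : ∀ v → H v ≡ true → 2 * (2 * ω) * # (λ x → B x ∧ rel x v) ≤ # B
    column v h with ∨-elim {S₁ v} h
    ... | inj₁ s = ≤-trans (2 * (2 * ω) ⊗ #-mono {S = λ x → B x ∧ rel x v} {R = B ∩ nb G (not β₁) v} (λ {x} q → ∧-intro (∧-left {B x} q)
            ([ (λ p → nb-sym G (∧-right {S₁ v} p)) , (λ p → ⊥-elim (dis v s (∧-left {S₂ v} p))) ]′ (∨-elim {S₁ v ∧ nb G (not β₁) x v} (∧-right {B x} q))))) (f₁ v s)
    ... | inj₂ s = ≤-trans (2 * (2 * ω) ⊗ #-mono {S = λ x → B x ∧ rel x v} {R = B ∩ nb G (not β₂) v} (λ {x} q → ∧-intro (∧-left {B x} q)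
            ([ (λ p → ⊥-elim (dis v (∧-left {S₁ v} p) s)) , (λ p → nb-sym G (∧-right {S₂ v} p)) ]′ (∨-elim {S₁ v ∧ nb G (not β₁) x v} (∧-right {B x} q))))) (f₂ v s)
    half : # B ≤ 2 * # Y
    half = markov (2 * ω) B H rel H>0 column
    few : ∀ y → Y y ≡ true → ω * (# (S₁ ∩ nb G (not β₁) y) + # (S₂ ∩ nb G (not β₂) y) + 1) ≤ n
    few y q = *-cancelˡ-≤ 2 (begin
      2 * (ω * (c₁ + c₂ + 1))  ≡⟨ re ω (c₁ + c₂) ⟩
      2 * ω * (c₁ + c₂) + 2 * ω ≤⟨ ≤-trans (2 * ω ⊗ both) (dec-elim {d = _ ≤? _} (∧-right {B y} q)) ⊕ ω≤n ⟩
      # H + n ≤⟨ #≤n H ⊕ ≤-refl ⟩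
      n + n ≡⟨ cong (n +_) (sym (+-identityʳ n)) ⟩
      2 * n ∎)
      where
      c₁ c₂ : ℕ
      c₁ = # (S₁ ∩ nb G (not β₁) y)
      c₂ = # (S₂ ∩ nb G (not β₂) y)
      re : ∀ ω c → 2 * (ω * (c + 1)) ≡ 2 * ω * c + 2 * ω
      re = solve-∀
      both : c₁ + c₂ ≤ # (λ v → H v ∧ rel y v)
      both = ≤-trans (#-⊎ (S₁ ∩ nb G (not β₁) y) (S₂ ∩ nb G (not β₂) y) (λ v p p' → dis v (∧-left {S₁ v} p) (∧-left {S₂ v} p')))
        (#-mono λ {v} p → [ (λ h → ∧-intro (∨-introˡ (∧-left {S₁ v} h)) (∨-introˡ h)) , (λ h → ∧-intro (∨-introʳ {S₁ v} (∧-left {S₂ v} h)) (∨-introʳ {S₁ v ∧ nb G (not β₁) y v} h)) ]′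
          (∨-elim {(S₁ ∩ nb G (not β₁) y) v} p))

-- Enlarging the set to which a given set is homogeneous

module Saturation {n : ℕ} (G : Graph n) (n>0 : 0 < n) (lam z w : ℕ) (U : Pred n) where

  -- Adjacency to `B` is predicted on `S₁`, non-adjacency on `S₀`. The index `t` counts
  -- enlargements: each costs a factor `lam` in the size of `B` and adds at least `n / z` vertices
  -- to the domain.
  record Flat (B₀ : Pred n) (t : ℕ) : Set where
    field
      B S₁ S₀ : Pred n
      B⊑ : B ⊑ B₀
      size : # B₀ ≤ lam ^ t * # B
      S₁⊑ : S₁ ⊑ U
      S₀⊑ : S₀ ⊑ U
      disjoint : ∀ x → S₁ x ≡ true → S₀ x ≡ true → ⊥
      few : ∀ x → B x ≡ true → w * (# (S₁ ∩ nb G false x) + # (S₀ ∩ nb G true x)) ≤ # S₁ + # S₀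
      grown : n * t ≤ z * (# S₁ + # S₀)

  Saturated : ∀ {B₀ t} → Flat B₀ t → Set
  Saturated F = ∀ b Q → Q ⊑ U → (∀ x → Q x ≡ true → S₁ x ≡ true → ⊥) → (∀ x → Q x ≡ true → S₀ x ≡ true → ⊥) → n ≤ z * # Q →
    lam * # (B ∩ λ x → ⌊ w * # (Q ∩ nb G b x) <? # Q ⌋) < # B
    where open Flat F

  ∩∪-≤ : ∀ (S Q P : Pred n) → # ((S ∪ Q) ∩ P) ≤ # (S ∩ P) + # (Q ∩ P)
  ∩∪-≤ S Q P = #-cover {S = (S ∪ Q) ∩ P} (λ x q → [ (λ h → inj₁ (∧-intro h (∧-right {(S ∪ Q) x} q))) , (λ h → inj₂ (∧-intro h (∧-right {(S ∪ Q) x} q))) ]′ (∨-elim {S x} (∧-left {(S ∪ Q) x} q)))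

  add₁ : ∀ {B₀ t} (F : Flat B₀ t) → let open Flat F in ∀ Q → Q ⊑ U → (∀ x → Q x ≡ true → S₁ x ≡ true → ⊥) → (∀ x → Q x ≡ true → S₀ x ≡ true → ⊥) →
    n ≤ z * # Q → # B ≤ lam * # (B ∩ λ x → ⌊ w * # (Q ∩ nb G false x) <? # Q ⌋) → Flat B₀ (suc t)
  add₁ {B₀} {t} F Q Q⊑ d₁ d₀ big loss = record
    { B = B ∩ λ x → ⌊ w * # (Q ∩ nb G false x) <? # Q ⌋ ; S₁ = S₁ ∪ Q ; S₀ = S₀
    ; B⊑ = λ {x} q → B⊑ (∧-left {B x} q)
    ; size = ≤-trans size (≤-trans (lam ^ t ⊗ loss) (≤-reflexive (re₁ (lam ^ t) lam _)))
    ; S₁⊑ = λ {x} q → [ S₁⊑ , Q⊑ ]′ (∨-elim {S₁ x} q)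
    ; S₀⊑ = S₀⊑
    ; disjoint = λ x q q' → [ (λ h → disjoint x h q') , (λ h → d₀ x h q') ]′ (∨-elim {S₁ x} q)
    ; few = λ x q → ≤-trans (w ⊗ (∩∪-≤ S₁ Q (nb G false x) ⊕ ≤-refl)) (≤-trans (≤-reflexive (re₂ w (# (S₁ ∩ nb G false x)) (# (Q ∩ nb G false x)) (# (S₀ ∩ nb G true x))))
        (≤-trans (few x (∧-left {B x} q) ⊕ <⇒≤ (dec-elim {d = _ <? _} (∧-right {B x} q))) total))
    ; grown = ≤-trans (≤-reflexive (*-suc n t)) (≤-trans (big ⊕ grown) (≤-trans (≤-reflexive (re₃ z (# Q) (# S₁ + # S₀))) (z ⊗ total))) }
    where
    open Flat F
    re₁ : ∀ a b c → a * (b * c) ≡ b * a * c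
    re₁ = solve-∀
    re₂ : ∀ w a b c → w * (a + b + c) ≡ w * (a + c) + w * b
    re₂ = solve-∀
    re₃ : ∀ z q s → z * q + z * s ≡ z * (s + q)
    re₃ = solve-∀
    re₄ : ∀ a b c → a + b + c ≡ a + c + b
    re₄ = solve-∀
    total : # S₁ + # S₀ + # Q ≤ # (S₁ ∪ Q) + # S₀
    total = ≤-trans (≤-reflexive (re₄ (# S₁) (# S₀) (# Q))) (#-⊎ S₁ Q (λ x p q → d₁ x q p) ⊕ ≤-refl)

  add₀ : ∀ {B₀ t} (F : Flat B₀ t) → let open Flat F in ∀ Q → Q ⊑ U → (∀ x → Q x ≡ true → S₁ x ≡ true → ⊥) → (∀ x → Q x ≡ true → S₀ x ≡ true → ⊥) →
    n ≤ z * # Q → # B ≤ lam * # (B ∩ λ x → ⌊ w * # (Q ∩ nb G true x) <? # Q ⌋) → Flat B₀ (suc t)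
  add₀ {B₀} {t} F Q Q⊑ d₁ d₀ big loss = record
    { B = B ∩ λ x → ⌊ w * # (Q ∩ nb G true x) <? # Q ⌋ ; S₁ = S₁ ; S₀ = S₀ ∪ Q
    ; B⊑ = λ {x} q → B⊑ (∧-left {B x} q)
    ; size = ≤-trans size (≤-trans (lam ^ t ⊗ loss) (≤-reflexive (re₁ (lam ^ t) lam _)))
    ; S₁⊑ = S₁⊑
    ; S₀⊑ = λ {x} q → [ S₀⊑ , Q⊑ ]′ (∨-elim {S₀ x} q)
    ; disjoint = λ x q q' → [ (λ h → disjoint x q h) , (λ h → d₁ x h q) ]′ (∨-elim {S₀ x} q')
    ; few = λ x q → ≤-trans (w ⊗ (≤-refl ⊕ ∩∪-≤ S₀ Q (nb G true x))) (≤-trans (≤-reflexive (re₂ w (# (S₁ ∩ nb G false x)) (# (S₀ ∩ nb G true x)) (# (Q ∩ nb G true x))))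
        (≤-trans (few x (∧-left {B x} q) ⊕ <⇒≤ (dec-elim {d = _ <? _} (∧-right {B x} q))) total))
    ; grown = ≤-trans (≤-reflexive (*-suc n t)) (≤-trans (big ⊕ grown) (≤-trans (≤-reflexive (re₃ z (# Q) (# S₁ + # S₀))) (z ⊗ total))) }
    where
    open Flat F
    re₁ : ∀ a b c → a * (b * c) ≡ b * a * c
    re₁ = solve-∀
    re₂ : ∀ w a b c → w * (a + (b + c)) ≡ w * (a + b) + w * c
    re₂ = solve-∀
    re₃ : ∀ z q s → z * q + z * s ≡ z * (s + q)
    re₃ = solve-∀
    total : # S₁ + # S₀ + # Q ≤ # S₁ + # (S₀ ∪ Q)
    total = ≤-trans (≤-reflexive (+-assoc (# S₁) (# S₀) (# Q))) (≤-refl {# S₁} ⊕ #-⊎ S₀ Q (λ x p q → d₀ x q p))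

  dom≤n : ∀ {B₀ t} (F : Flat B₀ t) → # (Flat.S₁ F) + # (Flat.S₀ F) ≤ n
  dom≤n F = ≤-trans (#-⊎ S₁ S₀ disjoint) (#≤n _)
    where open Flat F

  t≤z : ∀ {B₀ t} → Flat B₀ t → t ≤ z
  t≤z {t = t} F = *-cancelˡ-≤ n ⦃ >-nonZero n>0 ⦄ (≤-trans (Flat.grown F) (≤-trans (z ⊗ dom≤n F) (≤-reflexive (*-comm z n))))

  -- A failure of saturation is precisely a set `Q` that permits one more enlargement. As every
  -- enlargement adds `n / z` vertices, more than `z` of them are impossible.
  saturate : ∀ k {B₀ t} → k + t ≡ suc z → (F : Flat B₀ t) → (∀ {t} (F : Flat B₀ t) → Saturated F → ⊥) → ⊥
  saturate zero e F _ = <-irrefl refl (<-≤-trans (≤-reflexive (sym e)) (t≤z F))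
  saturate (suc k) {B₀} {t} e F done = done F sat
    where
    open Flat F
    e' : k + suc t ≡ suc z
    e' = trans (+-suc k t) e
    sat : Saturated F
    sat b Q Q⊑ d₁ d₀ big with lam * # (B ∩ λ x → ⌊ w * # (Q ∩ nb G b x) <? # Q ⌋) <? # B
    ... | yes p = p
    sat true Q Q⊑ d₁ d₀ big | no q = ⊥-elim (saturate k e' (add₀ F Q Q⊑ d₁ d₀ big (≮⇒≥ q)) done)
    sat false Q Q⊑ d₁ d₀ big | no q = ⊥-elim (saturate k e' (add₁ F Q Q⊑ d₁ d₀ big (≮⇒≥ q)) done)

  initial : ∀ B₀ → Flat B₀ 0
  initial B₀ = record { B = B₀ ; S₁ = λ _ → false ; S₀ = λ _ → false ; B⊑ = id ; size = ≤-reflexive (sym (+-identityʳ _))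
    ; S₁⊑ = λ () ; S₀⊑ = λ () ; disjoint = λ _ () ; few = λ x _ → ≤-trans (≤-reflexive (trans (cong (w *_) (cong₂ _+_ #-empty #-empty)) (*-zeroʳ w))) z≤n
    ; grown = ≤-trans (≤-reflexive (*-zeroʳ n)) z≤n }

-- The chain of pairwise generic almost homogeneous sets

-- T has m vertices, G has R parts, and candidate sets initially make up 1/κ of their part.
module ChainConstants (m R η ω K κ : ℕ) where

  w : ℕ
  w = 2 * ω

  Λ : ℕ → ℕ
  Λ ℓ = w ^ ℓ * κ

  lam : ℕ
  lam = suc m * Λ m

  -- If the later parts have at least `n / y` vertices, their subsets relevant to `cross` have at
  -- least `n / zOf y`. Saturation at that scale may shrink the new part by `lam ^ zOf y`, a loss
  -- which its homogeneity `1 / εOf y` must survive. So the constants are determined from the last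
  -- part backwards.
  zOf εOf : ℕ → ℕ
  zOf y = y * Λ m
  εOf y = lam ^ zOf y * (2 * Λ m)

  opaque
    -- the j parts constructed last have size at least n / chainY j
    chainY : ℕ → ℕ
    chainY zero = 1
    chainY (suc j) = chainY j + R * η * rödl-constant m (εOf (chainY j)) * lam ^ zOf (chainY j)

    chainN : ℕ → ℕ
    chainN zero = 0
    chainN (suc j) = chainN j + (R * η * finds-constant m (3 * εOf (chainY j)) (3 * εOf (chainY j)) + (chainY (suc j) * K + w))

    chainY-≤ : ∀ j → chainY j ≤ chainY (suc j)
    chainY-≤ j = m≤m+n _ _

    chainY-step : ∀ j → R * η * rödl-constant m (εOf (chainY j)) * lam ^ zOf (chainY j) ≤ chainY (suc j)
    chainY-step j = m≤n+m _ _

    chainN-≤ : ∀ j → chainN j ≤ chainN (suc j)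
    chainN-≤ j = m≤m+n _ _

    chainN-finds : ∀ j → R * η * finds-constant m (3 * εOf (chainY j)) (3 * εOf (chainY j)) ≤ chainN (suc j)
    chainN-finds j = ≤-trans (m≤m+n _ _) (m≤n+m _ (chainN j))

    chainN-K : ∀ j → chainY (suc j) * K ≤ chainN (suc j)
    chainN-K j = ≤-trans (m≤m+n _ w) (≤-trans (m≤n+m _ (R * η * finds-constant m (3 * εOf (chainY j)) (3 * εOf (chainY j)))) (m≤n+m _ (chainN j)))

    chainN-w : ∀ j → w ≤ chainN (suc j)
    chainN-w j = ≤-trans (m≤n+m w (chainY (suc j) * K)) (≤-trans (m≤n+m _ (R * η * finds-constant m (3 * εOf (chainY j)) (3 * εOf (chainY j)))) (m≤n+m _ (chainN j)))

record Chain {n : ℕ} (G : Graph n) (m : ℕ) (Λ : ℕ → ℕ) (y : ℕ) (U : Pred n) (j : ℕ) : Set where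
  field
    B : Fin j → Pred n
    σ : Fin j → Bool
    B⊑ : ∀ i → B i ⊑ U
    size : ∀ i → n ≤ y * # (B i)
    inner : ∀ i x → B i x ≡ true → 2 * (Λ m * # (B i ∩ ∁ (nb G (σ i) x))) ≤ # (B i)
    cross : ∀ i k → toℕ i < toℕ k → ∀ b ℓ → ℓ < m → ∀ Q → Q ⊑ B k → # (B k) ≤ Λ ℓ * # Q →
      m * (Λ ℓ * # (B i ∩ λ x → ⌊ Λ (suc ℓ) * # (Q ∩ nb G b x) <? # (B k) ⌋)) < # (B i)

module BuildChain {m n : ℕ} (T : Graph m) (G : Graph n) (free : ¬ Contains T G) (R η ω K κ : ℕ)
  (inc : Incompressible G R η ω K) (n>0 : 0 < n) (R>0 : 0 < R) (η>0 : 0 < η) (ω>0 : 0 < ω) (κ>0 : 0 < κ) (K>0 : 0 < K) (η≥ : R * R ≤ η) where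

  open ChainConstants m R η ω K κ
  open ≤-Reasoning

  w>0 : 0 < w
  w>0 = ≤-trans ω>0 (m≤m+n ω _)

  Λ>0 : ∀ ℓ → 0 < Λ ℓ
  Λ>0 ℓ = *-mono-≤ (m^n>0 w ⦃ >-nonZero w>0 ⦄ ℓ) κ>0

  Λ-mono : ∀ {ℓ} → ℓ ≤ m → Λ ℓ ≤ Λ m
  Λ-mono le = *-monoˡ-≤ κ (^-monoʳ-≤ w ⦃ >-nonZero w>0 ⦄ le)

  lam>0 : 0 < lam
  lam>0 = *-mono-≤ {1} {suc m} {1} (s≤s z≤n) (Λ>0 m)

  lam^>0 : ∀ k → 0 < lam ^ k
  lam^>0 = m^n>0 lam ⦃ >-nonZero lam>0 ⦄

  -- d parts have already been used, each with a domain of size at most n/R + n/η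
  build : ∀ d j → d + j ≤ R → chainN j ≤ n → ∀ U → R * η * n ≤ R * η * # U + d * ((η + R) * n) →
    (Chain G m Λ (chainY j) U j → ⊥) → ⊥
  build d zero _ _ U _ done = done record { B = λ () ; σ = λ () ; B⊑ = λ () ; size = λ () ; inner = λ () ; cross = λ () }
  build d (suc j) d+j≤R large U deficit done = Homogeneous.rödl T G free ε U U-big homogeneous
    where
    y z ε rc fc : ℕ
    y = chainY j
    z = zOf y
    ε = εOf y
    rc = rödl-constant m ε
    fc = finds-constant m (3 * ε) (3 * ε)
    Rη>0 : 0 < R * η
    Rη>0 = *-mono-≤ R>0 η>0
    d<R : suc d ≤ R
    d<R = ≤-trans (m≤m+n (suc d) j) (≤-trans (≤-reflexive (sym (+-suc d j))) d+j≤R)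
    -- At most `R - 1` domains of size at most `n/R + n/η` have been removed; because of `R * R ≤ η`
    -- at least `n / (R * η)` vertices remain in `U`.
    n≤RηU : n ≤ R * η * # U
    n≤RηU = certify 0 (deficit ⊕ (*-monoˡ-≤ ((η + R) * n) d<R) ⊕ *-monoˡ-≤ n η≥ ⊕ *-monoˡ-≤ n R>0) (re R η d n (# U))
      where
      re : ∀ R η d n u → n + (R * η * u + d * ((η + R) * n) + R * ((η + R) * n) + η * n + R * n) + 0 ≡
        R * η * u + (R * η * n + suc d * ((η + R) * n) + R * R * n + 1 * n)
      re = solve-∀
    U-big : fc ≤ # U
    U-big = *-cancelˡ-≤ (R * η) ⦃ >-nonZero Rη>0 ⦄ (≤-trans (≤-trans (chainN-finds j) large) n≤RηU)
    homogeneous : ∀ σ B₀ → B₀ ⊑ U → # U ≤ rc * # B₀ → (∀ x → B₀ x ≡ true → ε * # (B₀ ∩ ∁ (nb G σ x)) ≤ # B₀) → ⊥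
    homogeneous σ₀ B₀ B₀⊑ U≤ hom = saturate (suc z) (+-identityʳ _) (initial B₀) finish
      where
      open Saturation G n>0 lam z w U
      finish : ∀ {t} (F : Flat B₀ t) → Saturated F → ⊥
      finish {t} F sat = build (suc d) j (≤-trans (≤-reflexive (sym (+-suc d j))) d+j≤R) (≤-trans (chainN-≤ j) large) U' deficit' extend
        where
        open Flat F renaming (B to B'; B⊑ to B'⊑; size to B'size)
        B₀≤ : # B₀ ≤ lam ^ z * # B'
        B₀≤ = ≤-trans B'size (*-monoˡ-≤ _ (^-monoʳ-≤ lam ⦃ >-nonZero lam>0 ⦄ (t≤z F)))
        n≤B' : n ≤ R * η * rc * lam ^ z * # B'
        n≤B' = begin
          n  ≤⟨ n≤RηU ⟩
          R * η * # U  ≤⟨ R * η ⊗ ≤-trans U≤ (rc ⊗ B₀≤) ⟩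
          R * η * (rc * (lam ^ z * # B'))  ≡⟨ re (R * η) rc (lam ^ z) (# B') ⟩
          R * η * rc * lam ^ z * # B' ∎
          where
          re : ∀ a b c d → a * (b * (c * d)) ≡ a * b * c * d
          re = solve-∀
        n≤B : n ≤ chainY (suc j) * # B'
        n≤B = ≤-trans n≤B' (*-monoˡ-≤ (# B') (chainY-step j))
        K≤B : K ≤ # B'
        K≤B = *-cancelˡ-≤ (chainY (suc j)) ⦃ >-nonZero y'>0 ⦄ (≤-trans (≤-trans (chainN-K j) large) n≤B)
          where
          y'>0 : 0 < chainY (suc j)
          y'>0 = n≢0⇒n>0 λ e → <⇒≱ n>0 (≤-trans n≤B (≤-reflexive (cong (_* # B') e)))
        w≤n : w ≤ n
        w≤n = ≤-trans (chainN-w j) large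
        -- A larger domain would give a prediction obeyed by all of `B'`, which has at least `K`
        -- elements.
        dom-small : R * η * (# S₁ + # S₀) ≤ (η + R) * n
        dom-small = ≮⇒≥ λ lt → <⇒≱ (UseIncompressible.direct G R η ω K inc S₁ true S₀ false B' disjoint (<⇒≤ lt) few') K≤B
          where
          few' : ∀ x → B' x ≡ true → ω * (# (S₁ ∩ nb G false x) + # (S₀ ∩ nb G true x) + 1) ≤ n
          few' x q = *-cancelˡ-≤ 2 (certify 0 (≤-trans (few x q) (dom≤n F) ⊕ w≤n) (re ω (# (S₁ ∩ nb G false x) + # (S₀ ∩ nb G true x)) n))
            where
            re : ∀ ω c n → 2 * (ω * (c + 1)) + (n + n) + 0 ≡ 2 * n + (2 * ω * c + 2 * ω)
            re = solve-∀
        -- The remaining parts are sought outside the domain, where saturation makes `B'` generic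
        -- towards every large set.
        U' : Pred n
        U' = U ∩ ∁ (S₁ ∪ S₀)
        U'-off₁ : ∀ x → U' x ≡ true → S₁ x ≡ true → ⊥
        U'-off₁ x p q = not-elim (∧-right {U x} p) (∨-introˡ q)
        U'-off₀ : ∀ x → U' x ≡ true → S₀ x ≡ true → ⊥
        U'-off₀ x p q = not-elim (∧-right {U x} p) (∨-introʳ {S₁ x} q)
        U≤U' : # U ≤ # S₁ + # S₀ + # U'
        U≤U' = ≤-trans (#-cover {P = S₁ ∪ S₀} {R = U'} sort) (#-∪ S₁ S₀ ⊕ ≤-refl)
          where
          sort : ∀ x → U x ≡ true → (S₁ ∪ S₀) x ≡ true ⊎ U' x ≡ true
          sort x u with (S₁ ∪ S₀) x in eq
          ... | true = inj₁ refl
          ... | false = inj₂ (∧-intro u refl)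
        deficit' : R * η * n ≤ R * η * # U' + suc d * ((η + R) * n)
        deficit' = certify 0 (deficit ⊕ (R * η ⊗ U≤U') ⊕ dom-small) (re (R * η) n (# U') ((η + R) * n) (# S₁ + # S₀) (# U) d)
          where
          re : ∀ a n u' h s u d → a * n + (a * u + d * h + a * (s + u') + h) + 0 ≡ a * u' + suc d * h + (a * n + a * u + a * s)
          re = solve-∀
        extend : Chain G m Λ y U' j → ⊥
        extend C = done record { B = B ; σ = σ ; B⊑ = B⊑ ; size = size ; inner = inner ; cross = cross }
          where
          module C = Chain C
          B : Fin (suc j) → Pred n
          B zero = B'
          B (suc i) = C.B i
          σ : Fin (suc j) → Bool
          σ zero = σ₀
          σ (suc i) = C.σ i
          B⊑ : ∀ i → B i ⊑ U
          B⊑ zero q = B₀⊑ (B'⊑ q)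
          B⊑ (suc i) {x} q = ∧-left {U x} (C.B⊑ i q)
          size : ∀ i → n ≤ chainY (suc j) * # (B i)
          size zero = n≤B
          size (suc i) = ≤-trans (C.size i) (*-monoˡ-≤ _ (chainY-≤ j))
          inner : ∀ i x → B i x ≡ true → 2 * (Λ m * # (B i ∩ ∁ (nb G (σ i) x))) ≤ # (B i)
          inner (suc i) x q = C.inner i x q
          inner zero x q = *-cancelˡ-≤ (lam ^ z) ⦃ >-nonZero (lam^>0 z) ⦄ (begin
            lam ^ z * (2 * (Λ m * e'))  ≡⟨ re (lam ^ z) (Λ m) e' ⟩
            ε * e'  ≤⟨ ε ⊗ #-mono {S = B' ∩ ∁ (nb G σ₀ x)} {R = B₀ ∩ ∁ (nb G σ₀ x)} (λ {v} r → ∧-intro (B'⊑ (∧-left {B' v} r)) (∧-right {B' v} r)) ⟩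
            ε * # (B₀ ∩ ∁ (nb G σ₀ x)) ≤⟨ hom x (B'⊑ q) ⟩
            # B₀ ≤⟨ B₀≤ ⟩
            lam ^ z * # B' ∎)
            where
            e' : ℕ
            e' = # (B' ∩ ∁ (nb G σ₀ x))
            re : ∀ a b c → a * (2 * (b * c)) ≡ a * (2 * b) * c
            re = solve-∀
          cross : ∀ i k → toℕ i < toℕ k → ∀ b ℓ → ℓ < m → ∀ Q → Q ⊑ B k → # (B k) ≤ Λ ℓ * # Q →
            m * (Λ ℓ * # (B i ∩ λ x → ⌊ Λ (suc ℓ) * # (Q ∩ nb G b x) <? # (B k) ⌋)) < # (B i)
          cross (suc i) (suc k) (s≤s lt) b ℓ ℓ<m Q Q⊑ big = C.cross i k lt b ℓ ℓ<m Q Q⊑ big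
          cross zero (suc k) _ b ℓ ℓ<m Q Q⊑ big = ≤-<-trans (begin
            m * (Λ ℓ * # bad)  ≤⟨ ≤-reflexive (sym (*-assoc m (Λ ℓ) _)) ⟩
            m * Λ ℓ * # bad    ≤⟨ *-mono-≤ (*-mono-≤ (n≤1+n m) (Λ-mono (<⇒≤ ℓ<m))) (#-mono {S = bad} {R = bad'} bad⊑) ⟩
            lam * # bad' ∎) (sat b Q (λ {x} q → ∧-left {U x} (C.B⊑ k (Q⊑ q))) (λ x q → U'-off₁ x (C.B⊑ k (Q⊑ q))) (λ x q → U'-off₀ x (C.B⊑ k (Q⊑ q))) Q-big)
            where
            bad bad' : Pred n
            bad = B' ∩ λ x → ⌊ Λ (suc ℓ) * # (Q ∩ nb G b x) <? # (C.B k) ⌋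
            bad' = B' ∩ λ x → ⌊ w * # (Q ∩ nb G b x) <? # Q ⌋
            bad⊑ : bad ⊑ bad'
            bad⊑ {x} q = ∧-intro (∧-left {B' x} q) (dec-intro {d = _ <? _} (*-cancelˡ-< (Λ ℓ) _ _
              (≤-trans (subst (_< # (C.B k)) (re w (w ^ ℓ) κ _) (dec-elim {d = _ <? _} (∧-right {B' x} q))) big)))
              where
              re : ∀ w p k c → w * p * k * c ≡ p * k * (w * c)
              re = solve-∀
            Q-big : n ≤ z * # Q
            Q-big = ≤-trans (C.size k) (≤-trans (y ⊗ ≤-trans big (*-monoˡ-≤ (# Q) (Λ-mono (<⇒≤ ℓ<m)))) (≤-reflexive (sym (*-assoc y (Λ m) (# Q)))))

union-bound : ∀ {n} r c D (S : Pred n) (F : Fin r → Pred n) → (∀ x → S x ≡ true → ∃ λ i → F i x ≡ true) →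
  (∀ i → c * # (F i) ≤ D) → c * # S ≤ r * D
union-bound zero c D S F cov _ = ≤-reflexive (trans (cong (c *_) (#-zero S (λ x s → noFin (proj₁ (cov x s))))) (*-zeroʳ c))
  where
  noFin : Fin 0 → ⊥
  noFin ()
union-bound {n} (suc r) c D S F cov small = begin
  c * # S  ≤⟨ c ⊗ #-cover {P = F zero} {R = S'} split ⟩
  c * (# (F zero) + # S')  ≡⟨ *-distribˡ-+ c _ _ ⟩
  c * # (F zero) + c * # S'  ≤⟨ small zero ⊕ union-bound r c D S' (F ∘ suc) cov' (small ∘ suc) ⟩
  D + r * D ∎
  where
  open ≤-Reasoning
  S' : Pred n
  S' = S ∩ ∁ (F zero)
  split : ∀ x → S x ≡ true → F zero x ≡ true ⊎ S' x ≡ true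
  split x s with F zero x
  ... | true = inj₁ refl
  ... | false = inj₂ (∧-intro s refl)
  cov' : ∀ x → S' x ≡ true → ∃ λ i → F (suc i) x ≡ true
  cov' x s with cov x (∧-left {S x} s)
  ... | zero , p = ⊥-elim (not-elim (∧-right {S x} s) p)
  ... | suc i , p = i , p

-- First round: near-cliques from the chain

-- The parts have size at least n/R - n/θ and all degrees inside the complements are at most n/θ.
record NearCliques {n : ℕ} (G : Graph n) (R θ : ℕ) : Set where
  field
    V : Fin R → Pred n
    disjoint : ∀ i j x → i ≢ j → V i x ≡ true → V j x ≡ true → ⊥
    size : ∀ i → θ * n ≤ R * θ * # (V i) + R * n
    dense : ∀ i u → V i u ≡ true → θ * # (V i ∩ nb G false u) ≤ n

some-true : ∀ {r} (f : Fin r → Bool) → ((∀ i → f i ≡ true → ⊥) → ⊥) → ∃ λ i → f i ≡ true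
some-true f k with any? (λ i → f i ≟B true)
... | yes p = p
... | no none = ⊥-elim (k (λ i p → none (i , p)))

-- The factor `a` is the one demanded by `dual`, and `κ = a * a` permits two successive restrictions
-- to a neighbourhood. The factor `4 * r * R` in `η` pays for a union over `r` parts and four
-- adjacency patterns.
module FirstConstants (m r ω K θ : ℕ) where
  R a κ : ℕ
  R = suc r
  a = 2 * (2 * ω)
  κ = a * a

  opaque
    η y firstN : ℕ
    η = θ * (4 * r * R)
    y = ChainConstants.chainY m R η ω K κ R
    firstN = ChainConstants.chainN m R η ω K κ R + y * a * (2 * K) + y * (2 * κ) + 2 * ω + 1

    η-def : η ≡ θ * (4 * r * R)
    η-def = refl

    y-def : y ≡ ChainConstants.chainY m R η ω K κ R
    y-def = refl

    firstN-chain : ChainConstants.chainN m R η ω K κ R ≤ firstN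
    firstN-chain = ≤-trans (≤-trans (≤-trans (m≤m+n _ _) (m≤m+n _ _)) (m≤m+n _ _)) (m≤m+n _ _)

    firstN-K : y * a * (2 * K) ≤ firstN
    firstN-K = ≤-trans (≤-trans (≤-trans (m≤n+m _ (ChainConstants.chainN m R η ω K κ R)) (m≤m+n _ _)) (m≤m+n _ _)) (m≤m+n _ _)

    firstN-κ : y * (2 * κ) ≤ firstN
    firstN-κ = ≤-trans (≤-trans (m≤n+m _ (ChainConstants.chainN m R η ω K κ R + y * a * (2 * K))) (m≤m+n _ _)) (m≤m+n _ _)

    firstN-ω : 2 * ω ≤ firstN
    firstN-ω = ≤-trans (m≤n+m _ (ChainConstants.chainN m R η ω K κ R + y * a * (2 * K) + y * (2 * κ))) (m≤m+n _ _)

    firstN-pos : 0 < firstN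
    firstN-pos = m≤n+m 1 _

module FirstPartition {m n r : ℕ} (T : Graph m) (G : Graph n) (free : ¬ Contains T G)
  (sh₁ : Shape₁ T r) (sh₂ : Shape₂ T r) (shS : ShapeS T r) (bip : Bipartition T) (ω K θ : ℕ)
  (ω>0 : 0 < ω) (K>0 : 0 < K) (r>0 : 0 < r) (R≤θ : suc r ≤ θ)
  (inc : Incompressible G (suc r) (FirstConstants.η m r ω K θ) ω K) (large : FirstConstants.firstN m r ω K θ ≤ n) where

  open FirstConstants m r ω K θ
  open ChainConstants m R η ω K κ using (Λ; chainN)
  open ≤-Reasoning

  p₂ : ∀ {x} → 0 < x → 0 < 2 * x
  p₂ q = ≤-trans q (m≤m+n _ _)
  n>0 : 0 < n
  n>0 = ≤-trans firstN-pos large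
  a>0 : 0 < a
  a>0 = p₂ (p₂ ω>0)
  a≥4 : 4 ≤ a
  a≥4 = 2 ⊗ (2 ⊗ ω>0)
  κ>0 : 0 < κ
  κ>0 = *-mono-≤ a>0 a>0
  a≤κ : a ≤ κ
  a≤κ = m≤m*n a a ⦃ >-nonZero a>0 ⦄
  c>0 : 0 < 4 * r * R
  c>0 = *-mono-≤ {1} {4 * r} {1} (*-mono-≤ {1} {4} {1} (s≤s z≤n) r>0) (s≤s z≤n)
  θ>0 : 0 < θ
  θ>0 = ≤-trans (s≤s z≤n) R≤θ
  η>0 : 0 < η
  η>0 = subst (0 <_) (sym η-def) (*-mono-≤ θ>0 c>0)
  R*R≤η : R * R ≤ η
  R*R≤η = ≤-trans (*-mono-≤ R≤θ (m≤n*m R (4 * r) ⦃ >-nonZero (*-mono-≤ {1} {4} {1} (s≤s z≤n) r>0) ⦄)) (≤-reflexive (sym η-def))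

  large₁ : chainN R ≤ n
  large₁ = ≤-trans firstN-chain large
  large₂ : y * a * (2 * K) ≤ n
  large₂ = ≤-trans firstN-K large
  large₃ : y * (2 * κ) ≤ n
  large₃ = ≤-trans firstN-κ large
  large₄ : 2 * ω ≤ n
  large₄ = ≤-trans firstN-ω large

  open BuildChain T G free R η ω K κ inc n>0 (s≤s z≤n) η>0 ω>0 κ>0 K>0 R*R≤η using (build)

  module _ (C : Chain G m Λ y (λ _ → true) R) where
    open Chain C renaming (size to B-size)

    cancel-y : ∀ {x} X → y * x ≤ n → n ≤ y * X → x ≤ X
    cancel-y X p q = *-cancelˡ-≤ y ⦃ >-nonZero (n≢0⇒n>0 λ e → <⇒≱ n>0 (≤-trans q (≤-reflexive (cong (_* X) e)))) ⦄ (≤-trans p q)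

    B>0 : ∀ i → 0 < # (B i)
    B>0 i = n≢0⇒n>0 λ e → <⇒≱ n>0 (≤-trans (B-size i) (≤-reflexive (trans (cong (y *_) e) (*-zeroʳ y))))

    B≥κ : ∀ i → 2 * κ ≤ # (B i)
    B≥κ i = cancel-y (# (B i)) large₃ (B-size i)

    Λ-double : ∀ ℓ → 2 * Λ ℓ ≤ Λ (suc ℓ)
    Λ-double ℓ = ≤-trans (*-monoˡ-≤ (Λ ℓ) (2 ⊗ ω>0)) (≤-reflexive (sym (*-assoc (2 * ω) _ κ)))

    Λ0 : Λ 0 ≡ κ
    Λ0 = +-identityʳ κ

    rawParts : Parts G m R σ
    rawParts = record { Λ = Λ ; Λ-double = Λ-double ; B = B ; N = λ i → # (B i) ; N>0 = B>0 ; cross = cross ; inner = inner }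

    open Forbidden {r = r} T G free

    σ≡ : ∀ k → σ k ≡ true
    σ≡ = all-cliques shS bip rawParts (λ k → ≤-trans (m≤n*m (# (B k)) κ ⦃ >-nonZero κ>0 ⦄) (≤-reflexive (cong (_* # (B k)) (sym Λ0))))

    parts : Parts G m R (const true)
    parts = record { Λ = Λ ; Λ-double = Λ-double ; B = B ; N = λ i → # (B i) ; N>0 = B>0 ; cross = cross
      ; inner = λ i x q → subst (λ b → 2 * (Λ m * # (B i ∩ ∁ (nb G b x))) ≤ # (B i)) (σ≡ i) (inner i x q) }

    poor : ℕ → Bool → Fin R → Pred n
    poor k b i v = ⌊ k * # (B i ∩ nb G b v) <? # (B i) ⌋

    poor-elim : ∀ {k b i v} → poor k b i v ≡ true → k * # (B i ∩ nb G b v) < # (B i)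
    poor-elim {k} {b} {i} {v} p = dec-elim {d = k * # (B i ∩ nb G b v) <? # (B i)} p

    ¬poor : ∀ {k b i v} → poor k b i v ≡ false → # (B i) ≤ k * # (B i ∩ nb G b v)
    ¬poor {k} {b} {i} {v} p = ≮⇒≥ (λ q → true≢false (trans (sym (dec-intro {d = _ <? _} q)) p))

    poor-intro : ∀ {k b i v} → k * # (B i ∩ nb G b v) < # (B i) → poor k b i v ≡ true
    poor-intro {k} {b} {i} {v} q = dec-intro {d = k * # (B i ∩ nb G b v) <? # (B i)} q

    -- The vertices almost homogeneous to `B j`, split disjointly by the kind of homogeneity as
    -- `dual` requires. By incompressibility there are at most `n/R + n/η` of them.
    H : Fin R → Pred n
    H j = poor a false j ∪ (poor a true j ∩ ∁ (poor a false j))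

    not-H : ∀ {j v} → H j v ≡ false → ∀ b → poor a b j v ≡ false
    not-H {j} {v} e b with poor a false j v in e₀ | poor a true j v in e₁
    not-H {j} {v} e false | false | false = e₀
    not-H {j} {v} e true | false | false = e₁

    H-small : ∀ j → R * η * # (H j) ≤ (η + R) * n
    H-small j = ≤-trans (R * η ⊗ #-∪ S₁ S₂) (<⇒≤ (≰⇒> λ big → UseIncompressible.dual G R η ω K inc S₁ true S₂ false (B j) n>0 (s≤s z≤n) large₄
        (λ x p q → not-elim (∧-right {poor a true j x} q) p) big
        (λ v p → <⇒≤ (poor-elim {a} {false} {j} {v} p)) (λ v p → <⇒≤ (poor-elim {a} {true} {j} {v} (∧-left {poor a true j v} p)))
        (cancel-y (# (B j)) (≤-trans (*-monoˡ-≤ (2 * K) (m≤m*n y a ⦃ >-nonZero a>0 ⦄)) large₂) (B-size j))))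
      where
      S₁ S₂ : Pred n
      S₁ = poor a false j
      S₂ = poor a true j ∩ ∁ (poor a false j)

    inV : ∀ k v → Dec (∀ j → j ≡ k ⊎ H j v ≡ false)
    inV k v = all? (λ j → (j ≟F k) ⊎-dec (H j v ≟B false))

    -- Vertices almost homogeneous to none of the sets other than `B k`. The `r` excluded sets have
    -- at most about `n/R` elements each, so about `n/R` vertices or more are left.
    V : Fin R → Pred n
    V k v = ⌊ inV k v ⌋

    V-elim : ∀ {k v} → V k v ≡ true → ∀ j → j ≢ k → H j v ≡ false
    V-elim {k} {v} p j d = [ (λ e → ⊥-elim (d e)) , id ]′ (dec-elim {d = inV k v} p j)

    V-rich : ∀ {k v} → V k v ≡ true → ∀ j → j ≢ k → ∀ b → # (B j) ≤ a * # (B j ∩ nb G b v)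
    V-rich {k} {v} p j d b = ¬poor {a} {b} {j} {v} (not-H {j} {v} (V-elim {k} {v} p j d) b)

    -- Otherwise `v` could play the vertex `w` of `Shape₂`. Consequently `v` is almost complete to
    -- `B k` and lies in `H k`, which keeps it out of every other `V j`.
    V-poor : ∀ {k v} → V k v ≡ true → κ * # (B k ∩ nb G false v) < # (B k)
    V-poor {k} {v} p with κ * # (B k ∩ nb G false v) <? # (B k)
    ... | yes q = q
    ... | no q = ⊥-elim (no-shape₂ sh₂ v k parts (≤-trans (≮⇒≥ q) (*-monoˡ-≤ _ (≤-reflexive (sym Λ0))))
        (λ j d b → ≤-trans (V-rich {k} {v} p j d b) (*-monoˡ-≤ _ (≤-trans a≤κ (≤-reflexive (sym Λ0))))))

    V-disjoint : ∀ i j x → i ≢ j → V i x ≡ true → V j x ≡ true → ⊥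
    V-disjoint i j x d p q = true≢false (trans (sym (∨-introˡ (poor-intro {a} {false} {i} {x}
      (≤-<-trans (*-monoˡ-≤ (# (B i ∩ nb G false x)) a≤κ) (V-poor {i} {x} p))))) (V-elim {j} {x} q i d))

    V-size : ∀ k → R * η * n ≤ R * η * # (V k) + r * ((η + R) * n)
    V-size k = begin
      R * η * n  ≡⟨ cong (R * η *_) (sym (#-full n)) ⟩
      R * η * # {n} (λ _ → true)  ≤⟨ R * η ⊗ #-cover {S = λ _ → true} {P = V k} {R = ∁ (V k)} (λ x _ → lem (V k x)) ⟩
      R * η * (# (V k) + # (∁ (V k))) ≡⟨ *-distribˡ-+ (R * η) _ _ ⟩
      R * η * # (V k) + R * η * # (∁ (V k)) ≤⟨ ≤-refl ⊕ union-bound r (R * η) ((η + R) * n) (∁ (V k)) (λ i → H (punchIn k i)) cov (λ i → H-small (punchIn k i)) ⟩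
      R * η * # (V k) + r * ((η + R) * n) ∎
      where
      lem : ∀ b → b ≡ true ⊎ not b ≡ true
      lem true = inj₁ refl
      lem false = inj₂ refl
      every : ∀ x → (∀ i → H (punchIn k i) x ≡ true → ⊥) → ∀ j → Dec (k ≡ j) → j ≡ k ⊎ H j x ≡ false
      every x none j (yes e) = inj₁ (sym e)
      every x none j (no d) = inj₂ (¬true⇒false (λ h → none (punchOut d) (subst (λ j → H j x ≡ true) (sym (punchIn-punchOut d)) h)))
      cov : ∀ x → ∁ (V k) x ≡ true → ∃ λ i → H (punchIn k i) x ≡ true
      cov x q = some-true (λ i → H (punchIn k i) x) λ none → not-elim q (dec-intro {d = inV k x} (λ j → every x none j (k ≟F j)))

    V-size' : ∀ k → η * n ≤ R * η * # (V k) + R * r * n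
    V-size' k = certify 0 (V-size k) (re r η n (# (V k)))
      where
      re : ∀ r η n v → η * n + (suc r * η * v + r * ((η + suc r) * n)) + 0 ≡ suc r * η * v + suc r * r * n + suc r * η * n
      re = solve-∀

    V-size'' : ∀ k → θ * n ≤ R * θ * # (V k) + R * n
    V-size'' k = *-cancelˡ-≤ (4 * r * R) ⦃ >-nonZero c>0 ⦄ (begin
      4 * r * R * (θ * n)  ≡⟨ trans (re₁ (4 * r * R) θ n) (cong (_* n) (sym η-def)) ⟩
      η * n  ≤⟨ V-size' k ⟩
      R * η * # (V k) + R * r * n ≤⟨ ≤-refl {R * η * # (V k)} ⊕ *-monoˡ-≤ n (R ⊗ r≤c) ⟩
      R * η * # (V k) + R * (4 * r * R) * n ≡⟨ cong (λ h → R * h * # (V k) + R * (4 * r * R) * n) η-def ⟩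
      R * (θ * (4 * r * R)) * # (V k) + R * (4 * r * R) * n ≡⟨ re₂ R θ (4 * r * R) (# (V k)) n ⟩
      4 * r * R * (R * θ * # (V k) + R * n) ∎)
      where
      re₁ : ∀ c t n → c * (t * n) ≡ t * c * n
      re₁ = solve-∀
      re₂ : ∀ R t c v n → R * (t * c) * v + R * c * n ≡ c * (R * t * v + R * n)
      re₂ = solve-∀
      r≤c : r ≤ 4 * r * R
      r≤c = ≤-trans (m≤n*m r 4) (m≤m*n (4 * r) R)

    module _ (k : Fin R) (u : Fin n) (u∈V : V k u ≡ true) where

      Bad : Fin R → Bool → Bool → Pred n
      Bad j b b' v = (V k v ∧ nb G false u v) ∧ ⌊ κ * # (B j ∩ nb G b u ∩ nb G b' v) <? # (B j) ⌋

      -- Restricted to the neighbourhood pattern of `u` in `B j`, the vertices of `V j` are still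
      -- almost complete and those of `Bad j b b'` are almost homogeneous. If the latter were
      -- numerous, the two together would exceed the `n/R + n/η` vertices that `dual` permits.
      Bad-small : ∀ j → j ≢ k → ∀ b b' → 4 * r * θ * # (Bad j b b') ≤ n
      Bad-small j j≢k b b' = ≮⇒≥ contra
        where
        B' : Pred n
        B' = B j ∩ nb G b u
        transfer : ∀ X → κ * # X < # (B j) → a * # X ≤ # B'
        transfer X lt = *-cancelˡ-≤ a ⦃ >-nonZero a>0 ⦄ (≤-trans (≤-reflexive (sym (*-assoc a a (# X)))) (≤-trans (<⇒≤ lt) (V-rich {k} {u} u∈V j j≢k b)))
        n≤B' : n ≤ y * a * # B'
        n≤B' = ≤-trans (B-size j) (≤-trans (y ⊗ V-rich {k} {u} u∈V j j≢k b) (≤-reflexive (sym (*-assoc y a _))))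
        B'-big : 2 * K ≤ # B'
        B'-big = *-cancelˡ-≤ (y * a) ⦃ >-nonZero (n≢0⇒n>0 λ e → <⇒≱ n>0 (≤-trans n≤B' (≤-reflexive (cong (_* # B') e)))) ⦄ (≤-trans large₂ n≤B')
        f₂ : ∀ v → Bad j b b' v ≡ true → 2 * (2 * ω) * # (B' ∩ nb G (not (not b')) v) ≤ # B'
        f₂ v q rewrite not-involutive b' = ≤-trans (a ⊗ #-mono {S = B' ∩ nb G b' v} {R = B j ∩ nb G b u ∩ nb G b' v} (λ {z} p →
            ∧-intro (∧-left {B j z} (∧-left {B' z} p)) (∧-intro (∧-right {B j z} (∧-left {B' z} p)) (∧-right {B' z} p))))
            (transfer (B j ∩ nb G b u ∩ nb G b' v) (dec-elim {d = _ <? _} (∧-right {V k v ∧ nb G false u v} q)))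
        f₁ : ∀ v → V j v ≡ true → 2 * (2 * ω) * # (B' ∩ nb G false v) ≤ # B'
        f₁ v q = ≤-trans (a ⊗ #-mono {S = B' ∩ nb G false v} {R = B j ∩ nb G false v} (λ {z} p → ∧-intro (∧-left {B j z} (∧-left {B' z} p)) (∧-right {B' z} p)))
            (transfer (B j ∩ nb G false v) (V-poor {j} {v} q))
        contra : n < 4 * r * θ * # (Bad j b b') → ⊥
        contra lt = UseIncompressible.dual G R η ω K inc (V j) true (Bad j b b') (not b') B' n>0 (s≤s z≤n) large₄
          (λ x p q → V-disjoint j k x j≢k p (∧-left {V k x} (∧-left {V k x ∧ nb G false u x} q)))
          (certify 0 (V-size' j ⊕ (R * R ⊗ <⇒≤ lt)) (subst (λ h → (h + R) * n + (R * h * # (V j) + R * r * n + R * R * (4 * r * θ * # (Bad j b b'))) + 0 ≡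
              R * h * (# (V j) + # (Bad j b b')) + (h * n + R * R * n)) (sym η-def) (re r θ n (# (V j)) (# (Bad j b b')))))
          f₁ f₂ B'-big
          where
          re : ∀ r θ n v c → (θ * (4 * r * suc r) + suc r) * n + (suc r * (θ * (4 * r * suc r)) * v + suc r * r * n + suc r * suc r * (4 * r * θ * c)) + 0
            ≡ suc r * (θ * (4 * r * suc r)) * (v + c) + (θ * (4 * r * suc r) * n + suc r * suc r * n)
          re = solve-∀

      common : ∀ v → V k v ≡ true → # (B k) ≤ Λ 0 * # (B k ∩ nb G true u ∩ nb G true v)
      common v q = ≤-trans (certify (4 * # (B k) * 0) ((κ ⊗ cover) ⊕ <⇒≤ (V-poor {k} {u} u∈V) ⊕ <⇒≤ (V-poor {k} {v} q) ⊕ B≥κ k ⊕ *-monoˡ-≤ (# (B k)) 4≤κ)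
          (re κ (# (B k)) (# (B k ∩ nb G false u)) (# (B k ∩ nb G false v)) (# (B k ∩ nb G true u ∩ nb G true v)))) (*-monoˡ-≤ _ (≤-reflexive (sym Λ0)))
        where
        4≤κ : 4 ≤ κ
        4≤κ = ≤-trans a≥4 a≤κ
        cover : # (B k) ≤ # (B k ∩ nb G true u ∩ nb G true v) + (# (B k ∩ nb G false u) + 1 + (# (B k ∩ nb G false v) + 1))
        cover = ≤-trans (#-cover {P = B k ∩ nb G true u ∩ nb G true v} {R = ((B k ∩ nb G false u) ∪ (λ z → ⌊ z ≟F u ⌋)) ∪ ((B k ∩ nb G false v) ∪ (λ z → ⌊ z ≟F v ⌋))} sort)
          (≤-refl ⊕ ≤-trans (#-∪ _ _) (≤-trans (#-∪ _ _) (≤-refl ⊕ ≤-reflexive (#-single u)) ⊕ ≤-trans (#-∪ _ _) (≤-refl ⊕ ≤-reflexive (#-single v))))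
          where
          side : ∀ u z → B k z ≡ true → nb G true u z ≡ true ⊎ ((B k ∩ nb G false u) ∪ (λ z → ⌊ z ≟F u ⌋)) z ≡ true
          side u z s with z ≟F u | E G u z in e
          ... | yes p | _ = inj₂ (∨-introʳ {B k z ∧ false} refl)
          ... | no p | true = inj₁ refl
          ... | no p | false = inj₂ (∨-introˡ (∧-intro s refl))
          sort : ∀ z → B k z ≡ true → (B k ∩ nb G true u ∩ nb G true v) z ≡ true ⊎
            (((B k ∩ nb G false u) ∪ (λ z → ⌊ z ≟F u ⌋)) ∪ ((B k ∩ nb G false v) ∪ (λ z → ⌊ z ≟F v ⌋))) z ≡ true
          sort z s with side u z s | side v z s
          ... | inj₁ p | inj₁ q = inj₁ (∧-intro s (∧-intro p q))
          ... | inj₂ p | _ = inj₂ (∨-introˡ p)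
          ... | inj₁ _ | inj₂ q = inj₂ (∨-introʳ {((B k ∩ nb G false u) ∪ (λ z → ⌊ z ≟F u ⌋)) z} q)
        re : ∀ κ B f g c → B + (κ * (c + (f + 1 + (g + 1))) + B + B + B + κ * B) + 4 * B * 0 ≡ κ * c + (κ * B + κ * f + κ * g + 2 * κ + 4 * B)
        re = solve-∀

      -- A non-neighbour `v` of `u` in `V k` outside all the bad sets would sit with `u` at the
      -- special vertices of `Shape₁`, so the bad sets cover all these non-neighbours.
      dense : θ * # (V k ∩ nb G false u) ≤ n
      dense = *-cancelˡ-≤ (r * 4) ⦃ >-nonZero (*-mono-≤ {1} {r} {1} r>0 (s≤s z≤n)) ⦄ (begin
        r * 4 * (θ * # X)  ≡⟨ re r θ (# X) ⟩
        4 * r * θ * # X  ≤⟨ union-bound r (4 * r * θ) (4 * n) X (λ i → F (punchIn k i)) cov (λ i → F-small (punchIn k i) (λ e → punchInᵢ≢i k i e)) ⟩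
        r * (4 * n) ≡⟨ sym (*-assoc r 4 n) ⟩
        r * 4 * n ∎)
        where
        X : Pred n
        X = V k ∩ nb G false u
        F : Fin R → Pred n
        F j = (Bad j true true ∪ Bad j true false) ∪ (Bad j false true ∪ Bad j false false)
        re : ∀ r θ x → r * 4 * (θ * x) ≡ 4 * r * θ * x
        re = solve-∀
        F-small : ∀ j → j ≢ k → 4 * r * θ * # (F j) ≤ 4 * n
        F-small j d = ≤-trans (4 * r * θ ⊗ ≤-trans (#-∪ _ _) (#-∪ _ _ ⊕ #-∪ _ _)) (certify 0
            (Bad-small j d true true ⊕ Bad-small j d true false ⊕ Bad-small j d false true ⊕ Bad-small j d false false)
            (re₂ (4 * r * θ) n (# (Bad j true true)) (# (Bad j true false)) (# (Bad j false true)) (# (Bad j false false))))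
          where
          re₂ : ∀ c n p q s t → c * (p + q + (s + t)) + (n + n + n + n) + 0 ≡ 4 * n + (c * p + c * q + c * s + c * t)
          re₂ = solve-∀
        Bad-∈F : ∀ j b b' v → Bad j b b' v ≡ true → F j v ≡ true
        Bad-∈F j true true v p = ∨-introˡ (∨-introˡ p)
        Bad-∈F j true false v p = ∨-introˡ (∨-introʳ {Bad j true true v} p)
        Bad-∈F j false true v p = ∨-introʳ {(Bad j true true ∪ Bad j true false) v} (∨-introˡ p)
        Bad-∈F j false false v p = ∨-introʳ {(Bad j true true ∪ Bad j true false) v} (∨-introʳ {Bad j false true v} p)
        Bad-intro : ∀ j b b' v → X v ≡ true → κ * # (B j ∩ nb G b u ∩ nb G b' v) < # (B j) → Bad j b b' v ≡ true
        Bad-intro j b b' v x lt = ∧-intro x (dec-intro {d = κ * # (B j ∩ nb G b u ∩ nb G b' v) <? # (B j)} lt)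
        rich : ∀ v → X v ≡ true → (∀ i → F (punchIn k i) v ≡ true → ⊥) → ∀ j → j ≢ k → ∀ b b' → # (B j) ≤ Λ 0 * # (B j ∩ nb G b u ∩ nb G b' v)
        rich v x none j d b b' = ≤-trans (≮⇒≥ (λ lt → none (punchOut k≢j)
            (subst (λ j → F j v ≡ true) (sym (punchIn-punchOut k≢j)) (Bad-∈F j b b' v (Bad-intro j b b' v x lt)))))
            (*-monoˡ-≤ (# (B j ∩ nb G b u ∩ nb G b' v)) (≤-reflexive (sym Λ0)))
          where
          k≢j : k ≢ j
          k≢j e = d (sym e)
        cov : ∀ v → X v ≡ true → ∃ λ i → F (punchIn k i) v ≡ true
        cov v x = some-true (λ i → F (punchIn k i) v) λ none →
          no-shape₁ sh₁ u v k (λ e → nb-≢ G (∧-right {V k v} x) (sym e)) (nb-E G (∧-right {V k v} x)) parts (common v (∧-left {V k v} x)) (rich v x none)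

    nearCliques : NearCliques G R θ
    nearCliques = record { V = V ; disjoint = V-disjoint ; size = V-size'' ; dense = dense }

  first : (NearCliques G R θ → ⊥) → ⊥
  first k = build 0 R ≤-refl large₁ (λ _ → true) (≤-trans (≤-reflexive (cong (R * η *_) (sym (#-full n)))) (m≤m+n _ _)) (λ C → k (nearCliques (subst (λ y → Chain G m Λ y (λ _ → true) R) (sym y-def) C)))

-- Second round: predictions described by boundedly many vertices

joined : ∀ {n k} → Graph n → Vec (Fin n) k → Pred n
joined G [] z = true
joined G (x ∷ X) z = E G x z ∧ joined G X z

restricted : ∀ {n} → Graph n → Maybe (Fin n × Bool) → Pred n
restricted G nothing z = true
restricted G (just (u , b)) z = ⌊ E G u z ≟B b ⌋

-- A prediction determined by boundedly many vertices: there are only polynomially many of these.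
predictor : ∀ {n k} → Graph n → Vec (Fin n) k → Bool → Vec (Fin n) k → Maybe (Fin n × Bool) → Bool → Fin n → Maybe Bool
predictor G X₁ β₁ X₂ c β₂ = two-valued (joined G X₁) β₁ (joined G X₂ ∩ restricted G c) β₂

-- The prediction for `v` must be computable in the graph without `v`, because it is needed when `v`
-- is restored.
avoids : ∀ {n k} → Fin n → Vec (Fin n) k → Set
avoids v [] = ⊤
avoids v (x ∷ X) = x ≢ v × avoids v X

avoids-c : ∀ {n} → Fin n → Maybe (Fin n × Bool) → Set
avoids-c v nothing = ⊤
avoids-c v (just (u , _)) = u ≢ v

Unpredictable : ∀ {n} → Graph n → (R η ω k : ℕ) → Set
Unpredictable {n} G R η ω k = ∀ v (X₁ X₂ : Vec (Fin n) k) β₁ β₂ c → avoids v X₁ → avoids v X₂ → avoids-c v c →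
  (η + R) * n ≤ R * η * # (isJust ∘ predictor G X₁ β₁ X₂ c β₂) → ω * # (errors G (predictor G X₁ β₁ X₂ c β₂) v) ≤ n → ⊥

sumTo : (ℕ → ℕ) → ℕ → ℕ
sumTo f zero = f 0
sumTo f (suc k) = sumTo f k + f (suc k)

≤sumTo : ∀ f {i k} → i ≤ k → f i ≤ sumTo f k
≤sumTo f {zero} {zero} z≤n = ≤-refl
≤sumTo f {i} {suc k} p with m≤n⇒m<n∨m≡n p
... | inj₁ (s≤s q) = ≤-trans (≤sumTo f q) (m≤m+n _ _)
... | inj₂ refl = m≤n+m _ _

-- Each constant dominates the error rates `ωf` at the scales fixed before it: first `ρ` for two
-- whole parts, then `Λ₀` for a part and a neighbourhood of size `n / ρ`, then the scales `Λ ℓ` of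
-- the embedding. The quality `θ` of the near-cliques comes after these, and `H` bounds every `η`
-- that is used.
module SecondConstants (m r : ℕ) (ωf Kf : ℕ → ℕ) where
  R ω₁ : ℕ
  R = suc r
  ω₁ = ωf (2 * (2 * R))

  opaque
    ρ : ℕ
    ρ = 8 * ω₁ + 1
    8ω₁≤ρ : 8 * ω₁ ≤ ρ
    8ω₁≤ρ = m≤m+n _ _
    ρ>0 : 0 < ρ
    ρ>0 = m≤n+m 1 (8 * ω₁)

  ω₂ : ℕ
  ω₂ = ωf (2 * ρ)

  opaque
    Λ₀ : ℕ
    Λ₀ = ρ + 8 * ω₂ + 16 * R * (ω₁ + ω₂) + 8 * R
    ρ≤Λ₀ : ρ ≤ Λ₀
    ρ≤Λ₀ = ≤-trans (≤-trans (m≤m+n _ _) (m≤m+n _ _)) (m≤m+n _ _)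
    8ω₂≤Λ₀ : 8 * ω₂ ≤ Λ₀
    8ω₂≤Λ₀ = ≤-trans (≤-trans (m≤n+m _ ρ) (m≤m+n _ _)) (m≤m+n _ _)
    16Rω≤Λ₀ : 16 * R * (ω₁ + ω₂) ≤ Λ₀
    16Rω≤Λ₀ = ≤-trans (m≤n+m _ (ρ + 8 * ω₂)) (m≤m+n _ _)
    8R≤Λ₀ : 8 * R ≤ Λ₀
    8R≤Λ₀ = m≤n+m (8 * R) (ρ + 8 * ω₂ + 16 * R * (ω₁ + ω₂))

  Λ : ℕ → ℕ
  Λ zero = Λ₀
  Λ (suc ℓ) = 2 * Λ ℓ + 4 * ωf (2 * Λ ℓ)

  opaque
    top k₀ θ Kmax H secondN : ℕ
    top = Λ (suc m)
    k₀ = suc (Λ 1)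
    θ = 4 * top + 16 * (2 * R + ρ) * k₀ + 16 * R * (ω₁ + ω₂)
    Kmax = sumTo (λ ℓ → Kf (2 * Λ ℓ)) m
    H = 2 * (2 * R) + 2 * ρ + 2 * top + θ * (4 * r * R)
    secondN = θ + suc m * (top * Kmax) + 2 * R * (suc R * suc Kmax) + 1

    top-def : top ≡ Λ (suc m)
    top-def = refl
    k₀-def : k₀ ≡ suc (Λ 1)
    k₀-def = refl
    Kmax-≥ : ∀ ℓ → ℓ ≤ m → Kf (2 * Λ ℓ) ≤ Kmax
    Kmax-≥ ℓ = ≤sumTo (λ ℓ → Kf (2 * Λ ℓ))
    4top≤θ : 4 * top ≤ θ
    4top≤θ = ≤-trans (m≤m+n _ _) (m≤m+n _ _)
    k₀≤θ : 16 * (2 * R + ρ) * k₀ ≤ θ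
    k₀≤θ = ≤-trans (m≤n+m _ (4 * top)) (m≤m+n _ _)
    16Rω≤θ : 16 * R * (ω₁ + ω₂) ≤ θ
    16Rω≤θ = m≤n+m (16 * R * (ω₁ + ω₂)) (4 * top + 16 * (2 * R + ρ) * k₀)
    4R≤H : 2 * (2 * R) ≤ H
    4R≤H = ≤-trans (≤-trans (m≤m+n _ _) (m≤m+n _ _)) (m≤m+n _ _)
    2ρ≤H : 2 * ρ ≤ H
    2ρ≤H = ≤-trans (≤-trans (m≤n+m _ (2 * (2 * R))) (m≤m+n _ _)) (m≤m+n _ _)
    2top≤H : 2 * top ≤ H
    2top≤H = ≤-trans (m≤n+m _ (2 * (2 * R) + 2 * ρ)) (m≤m+n _ _)
    first≤H : θ * (4 * r * R) ≤ H
    first≤H = m≤n+m (θ * (4 * r * R)) (2 * (2 * R) + 2 * ρ + 2 * top)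
    θ≤N : θ ≤ secondN
    θ≤N = ≤-trans (≤-trans (m≤m+n _ _) (m≤m+n _ _)) (m≤m+n _ _)
    cross<N : suc m * (top * Kmax) < secondN
    cross<N = ≤-trans (≤-reflexive (+-comm 1 _)) (+-monoˡ-≤ 1 (≤-trans (m≤n+m _ θ) (m≤m+n _ _)))
    room≤N : 2 * R * (suc R * suc Kmax) ≤ secondN
    room≤N = ≤-trans (m≤n+m _ (θ + suc m * (top * Kmax))) (m≤m+n _ _)
    N>0 : 0 < secondN
    N>0 = m≤n+m 1 _

module SecondPartition {m n r : ℕ} (T : Graph m) (G : Graph n) (free : ¬ Contains T G)
  (sh₁ : Shape₁ T r) (sh₂ : Shape₂ T r) (r>0 : 0 < r) (ωf Kf : ℕ → ℕ)
  (inc : ∀ η → η ≤ SecondConstants.H m r ωf Kf → Incompressible G (suc r) η (ωf η) (Kf η))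
  (unp : ∀ η → η ≤ SecondConstants.H m r ωf Kf → Unpredictable G (suc r) η (ωf η) (SecondConstants.k₀ m r ωf Kf))
  (large : SecondConstants.secondN m r ωf Kf ≤ n)
  (NC : NearCliques G (suc r) (SecondConstants.θ m r ωf Kf)) where

  open SecondConstants m r ωf Kf renaming (N>0 to secondN>0)
  open NearCliques NC
  open ≤-Reasoning

  Λ-double : ∀ ℓ → 2 * Λ ℓ ≤ Λ (suc ℓ)
  Λ-double ℓ = m≤m+n _ _

  Λ-mono : ∀ {k ℓ} → k ≤ ℓ → Λ k ≤ Λ ℓ
  Λ-mono {k} {zero} z≤n = ≤-refl
  Λ-mono {k} {suc ℓ} p with m≤n⇒m<n∨m≡n p
  ... | inj₁ (s≤s q) = ≤-trans (Λ-mono q) (≤-trans (m≤m+n _ _) (Λ-double ℓ))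
  ... | inj₂ refl = ≤-refl

  n>0 : 0 < n
  n>0 = ≤-trans secondN>0 large
  θ≤n : θ ≤ n
  θ≤n = ≤-trans θ≤N large
  Λ≤top : ∀ {ℓ} → ℓ ≤ suc m → Λ ℓ ≤ top
  Λ≤top p = ≤-trans (Λ-mono p) (≤-reflexive (sym top-def))
  Λ0≤θ : Λ 0 ≤ θ
  Λ0≤θ = ≤-trans (Λ≤top z≤n) (≤-trans (m≤n*m top 4) 4top≤θ)

  scale : ∀ {a b} X {D} → a ≤ b → b * X ≤ D → a * X ≤ D
  scale X p q = ≤-trans (*-monoˡ-≤ X p) q

  -- The deficit `n - R * # (V i)` is at most `R * n / θ`, hence at most `R * n / η`. The case
  -- distinction avoids truncated subtraction.
  size-at : ∀ η → η ≤ θ → ∀ i → η * n ≤ R * η * # (V i) + R * n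
  size-at η η≤θ i with ≤-total n (R * # (V i))
  ... | inj₁ p = ≤-trans (η ⊗ p) (≤-trans (≤-reflexive (re η R _)) (m≤m+n _ _))
    where
    re : ∀ η R v → η * (R * v) ≡ R * η * v
    re = solve-∀
  ... | inj₂ p with m≤n⇒∃[o]m+o≡n p
  ... | d , e = begin
    η * n  ≡⟨ cong (η *_) (sym e) ⟩
    η * (R * # (V i) + d)  ≡⟨ re₁ η R (# (V i)) d ⟩
    R * η * # (V i) + η * d  ≤⟨ ≤-refl ⊕ scale d η≤θ θd ⟩
    R * η * # (V i) + R * n ∎
    where
    re₁ : ∀ η R v d → η * (R * v + d) ≡ R * η * v + η * d
    re₁ = solve-∀
    θd : θ * d ≤ R * n
    θd = +-cancelˡ-≤ (R * θ * # (V i)) _ _ (≤-trans (≤-reflexive (trans (sym (re₁ θ R (# (V i)) d)) (cong (θ *_) e))) (size i))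

  V-large : ∀ i → n ≤ 2 * R * # (V i)
  V-large i = *-cancelˡ-≤ R (certify 0 (size-at (2 * R) 2R≤θ i) (re R n (# (V i))))
    where
    2R≤θ : 2 * R ≤ θ
    2R≤θ = ≤-trans (≤-trans (*-monoˡ-≤ R (m≤m+n 2 6)) 8R≤Λ₀) Λ0≤θ
    re : ∀ R n v → R * n + (R * (2 * R) * v + R * n) + 0 ≡ R * (2 * R * v) + 2 * R * n
    re = solve-∀

  loses : ℕ → Bool → Pred n → Pred n
  loses ℓ b Q x = ⌊ Λ (suc ℓ) * # (Q ∩ nb G b x) <? n ⌋

  -- The vertices counted obey the prediction `true` on `V i` and `not b` on `Q`. Its domain exceeds
  -- `n/R` by at least `n / (2 * Λ ℓ)`, which accounts for the choice `η = 2 * Λ ℓ`; the bound on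
  -- the exceptions does not depend on `n`.
  generic : ∀ i k → i ≢ k → ∀ b ℓ → ℓ ≤ m → ∀ Q → Q ⊑ V k → n ≤ Λ ℓ * # Q → # (V i ∩ loses ℓ b Q) < Kf (2 * Λ ℓ)
  generic i k i≢k b ℓ ℓ≤m Q Q⊑ big = UseIncompressible.direct G R η ω (Kf η) (inc η η≤H) (V i) true Q (not b) (V i ∩ loses ℓ b Q)
      (λ x p q → disjoint i k x i≢k p (Q⊑ q)) (certify 0 (size-at η η≤θ i ⊕ (2 * R) ⊗ big) (re R (Λ ℓ) n (# (V i)) (# Q))) few
    where
    η ω : ℕ
    η = 2 * Λ ℓ
    ω = ωf η
    η≤2top : η ≤ 2 * top
    η≤2top = 2 ⊗ Λ≤top (≤-trans ℓ≤m (n≤1+n m))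
    η≤H : η ≤ H
    η≤H = ≤-trans η≤2top 2top≤H
    η≤θ : η ≤ θ
    η≤θ = ≤-trans η≤2top (≤-trans (*-monoˡ-≤ top (m≤m+n 2 2)) 4top≤θ)
    re : ∀ R Λ n v q → (2 * Λ + R) * n + (R * (2 * Λ) * v + R * n + 2 * R * (Λ * q)) + 0 ≡ R * (2 * Λ) * (v + q) + (2 * Λ * n + 2 * R * n)
    re = solve-∀
    4ω≤ : 4 * ω ≤ Λ (suc ℓ)
    4ω≤ = m≤n+m (4 * ω) (2 * Λ ℓ)
    4ω≤θ : 4 * ω ≤ θ
    4ω≤θ = ≤-trans 4ω≤ (≤-trans (Λ≤top (s≤s ℓ≤m)) (≤-trans (m≤n*m top 4) 4top≤θ))
    few : ∀ x → (V i ∩ loses ℓ b Q) x ≡ true → ω * (# (V i ∩ nb G false x) + # (Q ∩ nb G (not (not b)) x) + 1) ≤ n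
    few x q rewrite not-involutive b = *-cancelˡ-≤ 4 (certify n
      (scale (# (V i ∩ nb G false x)) 4ω≤θ (dense i x (∧-left {V i x} q)) ⊕ scale (# (Q ∩ nb G b x)) 4ω≤ (<⇒≤ (dec-elim {d = _ <? _} (∧-right {V i x} q))) ⊕ ≤-trans 4ω≤θ θ≤n)
      (re₂ ω (# (V i ∩ nb G false x)) (# (Q ∩ nb G b x)) n))
      where
      re₂ : ∀ ω a c n → 4 * (ω * (a + c + 1)) + (n + n + n) + n ≡ 4 * n + (4 * ω * a + 4 * ω * c + 4 * ω)
      re₂ = solve-∀

  parts : Parts G m R (const true)
  parts = record { Λ = Λ ; Λ-double = Λ-double ; B = V ; N = const n ; N>0 = λ _ → n>0 ; cross = cross ; inner = inner }
    where
    cross : ∀ i k → toℕ i < toℕ k → ∀ b ℓ → ℓ < m → ∀ Q → Q ⊑ V k → n ≤ Λ ℓ * # Q → m * (Λ ℓ * # (V i ∩ loses ℓ b Q)) < n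
    cross i k lt b ℓ ℓ<m Q Q⊑ big = ≤-<-trans (*-mono-≤ (n≤1+n m) (*-mono-≤ (Λ≤top (≤-trans (<⇒≤ ℓ<m) (n≤1+n m)))
        (≤-trans (<⇒≤ (generic i k (λ e → <⇒≢ lt (cong toℕ e)) b ℓ (<⇒≤ ℓ<m) Q Q⊑ big)) (Kmax-≥ ℓ (<⇒≤ ℓ<m)))))
      (≤-trans cross<N large)
    inner : ∀ i x → V i x ≡ true → 2 * (Λ m * # (V i ∩ ∁ (nb G true x))) ≤ n
    inner i x q = *-cancelˡ-≤ 2 (≤-trans (2 ⊗ (2 ⊗ (Λ m ⊗ cover))) (certify 0
        (scale (# (V i ∩ nb G false x)) 4Λm≤θ (dense i x q) ⊕ ≤-trans 4Λm≤θ θ≤n) (re (Λ m) (# (V i ∩ nb G false x)) n)))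
      where
      4Λm≤θ : 4 * Λ m ≤ θ
      4Λm≤θ = ≤-trans (4 ⊗ Λ≤top (n≤1+n m)) 4top≤θ
      re : ∀ l a n → 2 * (2 * (l * (a + 1))) + (n + n) + 0 ≡ 2 * n + (4 * l * a + 4 * l)
      re = solve-∀
      cover : # (V i ∩ ∁ (nb G true x)) ≤ # (V i ∩ nb G false x) + 1
      cover = ≤-trans (#-cover {P = V i ∩ nb G false x} {R = λ z → ⌊ z ≟F x ⌋} sort) (≤-refl ⊕ ≤-reflexive (#-single x))
        where
        sort : ∀ z → (V i ∩ ∁ (nb G true x)) z ≡ true → (V i ∩ nb G false x) z ≡ true ⊎ ⌊ z ≟F x ⌋ ≡ true
        sort z p with z ≟F x
        ... | yes e = inj₂ refl
        ... | no d with E G x z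
        ... | true = ⊥-elim (not-elim (∧-right {V i z} p) refl)
        ... | false = inj₁ (∧-intro (∧-left {V i z} p) refl)

  outside : θ * # (λ z → not ⌊ any? (λ i → V i z ≟B true) ⌋) ≤ R * n
  outside = +-cancelˡ-≤ (θ * sumF {R} (λ i → # (V i))) _ _ (begin
    θ * sumF {R} (λ i → # (V i)) + θ * # none  ≡⟨ sym (*-distribˡ-+ θ _ _) ⟩
    θ * (sumF {R} (λ i → # (V i)) + # none)  ≤⟨ θ ⊗ packing R V none (λ i j x → disjoint i j x) (λ i x p q → not-elim q (dec-intro {d = any? (λ i → V i x ≟B true)} (i , p))) ⟩
    θ * n  ≤⟨ *-cancelˡ-≤ R (begin
      R * (θ * n) ≡⟨ sym (sumF-const R (θ * n)) ⟩
      sumF {R} (λ _ → θ * n)  ≤⟨ sumF-mono size ⟩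
      sumF {R} (λ i → R * θ * # (V i) + R * n)  ≡⟨ sumF-+ _ _ ⟩
      sumF {R} (λ i → R * θ * # (V i)) + sumF {R} (λ _ → R * n)  ≡⟨ cong₂ _+_ (sumF-* (R * θ) _) (sumF-const R (R * n)) ⟩
      R * θ * sumF {R} (λ i → # (V i)) + R * (R * n)  ≡⟨ re R θ (sumF {R} (λ i → # (V i))) n ⟩
      R * (θ * sumF {R} (λ i → # (V i)) + R * n) ∎) ⟩
    θ * sumF {R} (λ i → # (V i)) + R * n ∎)
    where
    none : Pred n
    none z = not ⌊ any? (λ i → V i z ≟B true) ⌋
    re : ∀ R t s n → R * t * s + R * (R * n) ≡ R * (t * s + R * n)
    re = solve-∀
    packing : ∀ k (W : Fin k → Pred n) (S : Pred n) → (∀ i j x → i ≢ j → W i x ≡ true → W j x ≡ true → ⊥) →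
      (∀ i x → W i x ≡ true → S x ≡ true → ⊥) → sumF (λ i → # (W i)) + # S ≤ n
    packing zero W S _ _ = ≤-trans (≤-reflexive (cong (_+ # S) (≤-antisym (≤-trans (sumF-mono {g = λ i → # (W i)} {h = λ _ → 0} (λ ())) (≤-reflexive (sumF-0 0))) z≤n))) (#≤n S)
    packing (suc k) W S dis off = begin
      sumF (λ i → # (W i)) + # S  ≡⟨ cong (_+ # S) (sumF-suc (λ i → # (W i))) ⟩
      # (W zero) + sumF (λ i → # (W (suc i))) + # S  ≡⟨ re₁ (# (W zero)) _ (# S) ⟩
      sumF (λ i → # (W (suc i))) + (# (W zero) + # S) ≤⟨ ≤-refl ⊕ #-⊎ (W zero) S (off zero) ⟩
      sumF (λ i → # (W (suc i))) + # (W zero ∪ S) ≤⟨ packing k (W ∘ suc) (W zero ∪ S) (λ i j x d → dis (suc i) (suc j) x (λ e → d (suc-injective e)))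
          (λ i x p q → [ dis (suc i) zero x (λ ()) p , off (suc i) x p ]′ (∨-elim {W zero x} q)) ⟩
      n ∎
      where
      re₁ : ∀ a b c → a + b + c ≡ b + (a + c)
      re₁ = solve-∀

  -- V i is approximated by the common neighbourhood of k₀ of its vertices, so that predictions
  -- based on V i become predictions determined by few vertices.
  record Approx (v : Fin n) (i : Fin R) : Set where
    field
      X : Vec (Fin n) k₀
      avoid-v : avoids v X
      inside : θ * # (V i ∩ ∁ (joined G X)) ≤ k₀ * (2 * n)
      beyond : ∀ k → k ≢ i → Λ 0 * # (V k ∩ joined G X) ≤ n

  module Approximate (v : Fin n) (i : Fin R) where

    -- For each foreign part either its trace is already small, or every one of the `t` chosen
    -- vertices has removed `n / Λ 1` vertices from it. The second alternative is impossible for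
    -- `t = suc (Λ 1)`, the value of `k₀`.
    record Stage (t : ℕ) : Set where
      field
        X : Vec (Fin n) t
        avoid-v : avoids v X
        inside : θ * # (V i ∩ ∁ (joined G X)) ≤ t * (2 * n)
        beyond : ∀ k → k ≢ i → Λ 0 * # (V k ∩ joined G X) ≤ n ⊎ Λ 1 * # (V k ∩ joined G X) + t * n ≤ Λ 1 * n

    stage₀ : Stage 0
    stage₀ = record { X = [] ; avoid-v = tt
      ; inside = ≤-trans (≤-reflexive (trans (cong (θ *_) (#-zero _ (λ z p → not-elim (∧-right {V i z} p) refl))) (*-zeroʳ θ))) z≤n
      ; beyond = λ k _ → inj₂ (≤-trans (≤-reflexive (+-identityʳ _)) (Λ 1 ⊗ #≤n _)) }

    module _ (S : Pred n) where

      Q : Fin R → Pred n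
      Q k = V k ∩ S

      bad : Fin R → Pred n
      bad k z = V i z ∧ (⌊ n ≤? Λ 0 * # (Q k) ⌋ ∧ (not ⌊ k ≟F i ⌋ ∧ loses 0 false (Q k) z))

      bad-small : ∀ k → Dec (n ≤ Λ 0 * # (Q k)) → Dec (k ≡ i) → # (bad k) < suc Kmax
      bad-small k (no q) _ = ≤-<-trans (≤-reflexive (#-zero (bad k) (λ z p → q (dec-elim {d = n ≤? Λ 0 * # (Q k)} (∧-left {⌊ n ≤? Λ 0 * # (Q k) ⌋} (∧-right {V i z} p)))))) (s≤s z≤n)
      bad-small k (yes _) (yes e) = ≤-<-trans (≤-reflexive (#-zero (bad k) (λ z p → not-elim (∧-left {not ⌊ k ≟F i ⌋} (∧-right {⌊ n ≤? Λ 0 * # (Q k) ⌋} (∧-right {V i z} p))) (dec-intro {d = k ≟F i} e)))) (s≤s z≤n)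
      bad-small k (yes big) (no d) = ≤-<-trans (#-mono {S = bad k} {R = V i ∩ loses 0 false (Q k)}
          (λ {z} p → ∧-intro (∧-left {V i z} p) (∧-right {not ⌊ k ≟F i ⌋} (∧-right {⌊ n ≤? Λ 0 * # (Q k) ⌋} (∧-right {V i z} p)))))
        (≤-trans (generic i k (λ e → d (sym e)) false 0 z≤n (Q k) (λ {z} q → ∧-left {V k z} q) big) (≤-trans (Kmax-≥ 0 z≤n) (n≤1+n Kmax)))

      -- A strict upper bound for a cardinality is positive; a second part to which `generic`
      -- applies exists because `r > 0`.
      Kmax>0 : 0 < Kmax
      Kmax>0 = ≤-trans (≤-trans (s≤s z≤n) (generic i k' i≢k' false 0 z≤n (V k') id bigV)) (Kmax-≥ 0 z≤n)
        where
        k' : Fin R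
        k' = punchIn i (fromℕ< r>0)
        i≢k' : i ≢ k'
        i≢k' e = punchInᵢ≢i i _ (sym e)
        bigV : n ≤ Λ 0 * # (V k')
        bigV = ≤-trans (V-large k') (*-monoˡ-≤ _ (≤-trans (*-monoˡ-≤ R (m≤m+n 2 6)) 8R≤Λ₀))

      room : suc R * suc Kmax ≤ # (V i)
      room = *-cancelˡ-≤ (2 * R) (≤-trans (≤-trans room≤N large) (V-large i))

      choose : ∃ λ x → V i x ≡ true × x ≢ v × (∀ k → k ≢ i → n ≤ Λ 0 * # (Q k) → n ≤ Λ 1 * # (Q k ∩ nb G false x))
      choose = x , proj₁ (proj₂ chosen) , (λ e → true≢false (trans (sym (dec-intro {d = x ≟F v} e)) (AllM.head (proj₂ (proj₂ chosen))))) , keeps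
        where
        allBad : ∀ L → All (λ b → suc R * # b < # (V i)) (map bad L)
        allBad [] = []
        allBad (k ∷ L) = <-≤-trans (*-monoʳ-< (suc R) (bad-small k (n ≤? Λ 0 * # (Q k)) (k ≟F i))) room ∷ allBad L
        map-length : ∀ L → length (map bad L) ≡ length L
        map-length [] = refl
        map-length (_ ∷ L) = cong suc (map-length L)
        chosen : ∃ λ x → V i x ≡ true × All (λ b → b x ≡ false) ((λ z → ⌊ z ≟F v ⌋) ∷ map bad (allFin R))
        chosen = avoid (suc R) (V i) _ (<-≤-trans (*-monoʳ-< (suc R) (s≤s (≤-trans (≤-reflexive (#-single v)) Kmax>0))) room ∷ allBad (allFin R))
          (s≤s (≤-reflexive (trans (map-length (allFin R)) (length-tabulate id)))) (≤-trans (s≤s z≤n) room)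
        x : Fin n
        x = proj₁ chosen
        good : ∀ L → All (λ b → b x ≡ false) (map bad L) → ∀ {k} → k ∈ L → bad k x ≡ false
        good (k ∷ L) (p ∷ ps) (here refl) = p
        good (_ ∷ L) (_ ∷ ps) (there q) = good L ps q
        keeps : ∀ k → k ≢ i → n ≤ Λ 0 * # (Q k) → n ≤ Λ 1 * # (Q k ∩ nb G false x)
        keeps k k≢i big = ≮⇒≥ λ lt → true≢false (trans (sym (∧-intro (proj₁ (proj₂ chosen)) (∧-intro (dec-intro {d = n ≤? Λ 0 * # (Q k)} big)
          (∧-intro (not-intro (λ e → k≢i (dec-elim {d = k ≟F i} e))) (dec-intro {d = Λ 1 * # (Q k ∩ nb G false x) <? n} lt)))))
          (good (allFin R) (AllM.tail (proj₂ (proj₂ chosen))) (∈-allFin k)))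

    module Extend {t : ℕ} (St : Stage t) (x : Fin n) (x∈V : V i x ≡ true) (x≢v : x ≢ v)
      (keeps : ∀ k → k ≢ i → n ≤ Λ 0 * # (V k ∩ joined G (Stage.X St)) → n ≤ Λ 1 * # ((V k ∩ joined G (Stage.X St)) ∩ nb G false x)) where
      open Stage St

      W W' : Pred n
      W = joined G X
      W' z = E G x z ∧ W z

      sort : ∀ z → (V i ∩ ∁ W') z ≡ true → ((V i ∩ nb G false x) ∪ (λ z → ⌊ z ≟F x ⌋)) z ≡ true ⊎ (V i ∩ ∁ W) z ≡ true
      sort z p = decide (W z) (z ≟F x) (E G x z) refl refl
        where
        decide : ∀ b → Dec (z ≡ x) → ∀ e → W z ≡ b → E G x z ≡ e → ((V i ∩ nb G false x) ∪ (λ z → ⌊ z ≟F x ⌋)) z ≡ true ⊎ (V i ∩ ∁ W) z ≡ true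
        decide false _ _ eb _ = inj₂ (∧-intro (∧-left {V i z} p) (cong not eb))
        decide true (yes q) _ _ _ = inj₁ (∨-introʳ {(V i ∩ nb G false x) z} (dec-intro {d = z ≟F x} q))
        decide true (no d) false _ ee = inj₁ (∨-introˡ (∧-intro (∧-left {V i z} p) (nb-intro G d ee)))
        decide true (no d) true eb ee = ⊥-elim (not-elim (∧-right {V i z} p) (∧-intro ee eb))

      inside' : θ * # (V i ∩ ∁ W') ≤ suc t * (2 * n)
      inside' = ≤-trans (θ ⊗ #-cover {P = (V i ∩ nb G false x) ∪ (λ z → ⌊ z ≟F x ⌋)} {R = V i ∩ ∁ W} sort)
        (≤-trans (θ ⊗ (≤-trans (#-∪ (V i ∩ nb G false x) (λ z → ⌊ z ≟F x ⌋)) (≤-refl ⊕ ≤-reflexive (#-single x)) ⊕ ≤-refl))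
          (certify 0 (dense i x x∈V ⊕ θ≤n ⊕ inside) (re θ (# (V i ∩ nb G false x)) (# (V i ∩ ∁ W)) n t)))
        where
        re : ∀ θ a b n t → θ * (a + 1 + b) + (n + n + t * (2 * n)) + 0 ≡ suc t * (2 * n) + (θ * a + θ + θ * b)
        re = solve-∀

      shrink : ∀ k → # (V k ∩ W') ≤ # (V k ∩ W)
      shrink k = #-mono {S = V k ∩ W'} {R = V k ∩ W} λ {z} p → ∧-intro (∧-left {V k z} p) (∧-right {E G x z} (∧-right {V k z} p))

      parted : ∀ k → # (V k ∩ W') + # ((V k ∩ W) ∩ nb G false x) ≤ # (V k ∩ W)
      parted k = ≤-trans (#-⊎ (V k ∩ W') ((V k ∩ W) ∩ nb G false x) (λ z a b → true≢false (trans (sym (∧-left {E G x z} (∧-right {V k z} a))) (nb-E G (∧-right {(V k ∩ W) z} b)))))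
        (#-mono {S = (V k ∩ W') ∪ ((V k ∩ W) ∩ nb G false x)} {R = V k ∩ W} λ {z} q →
          [ (λ p → ∧-intro (∧-left {V k z} p) (∧-right {E G x z} (∧-right {V k z} p))) , (λ p → ∧-left {(V k ∩ W) z} p) ]′ (∨-elim {(V k ∩ W') z} q))

      beyond-step : ∀ l a b q → a + b ≤ q → n ≤ l * b → l * q + t * n ≤ l * n → l * a + suc t * n ≤ l * n
      beyond-step l a b q p₁ p₂ p₃ = certify 0 ((l ⊗ p₁) ⊕ p₂ ⊕ p₃) (re l a b q t n)
        where
        re : ∀ l a b q t n → l * a + suc t * n + (l * q + l * b + l * n) + 0 ≡ l * n + (l * (a + b) + n + (l * q + t * n))
        re = solve-∀

      beyond' : ∀ k → k ≢ i → Λ 0 * # (V k ∩ W') ≤ n ⊎ Λ 1 * # (V k ∩ W') + suc t * n ≤ Λ 1 * n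
      beyond' k k≢i = decide (≤-total (Λ 0 * # (V k ∩ W)) n) (beyond k k≢i)
        where
        decide : Λ 0 * # (V k ∩ W) ≤ n ⊎ n ≤ Λ 0 * # (V k ∩ W) → Λ 0 * # (V k ∩ W) ≤ n ⊎ Λ 1 * # (V k ∩ W) + t * n ≤ Λ 1 * n →
          Λ 0 * # (V k ∩ W') ≤ n ⊎ Λ 1 * # (V k ∩ W') + suc t * n ≤ Λ 1 * n
        decide (inj₁ small) _ = inj₁ (≤-trans (Λ 0 ⊗ shrink k) small)
        decide (inj₂ _) (inj₁ small) = inj₁ (≤-trans (Λ 0 ⊗ shrink k) small)
        decide (inj₂ big) (inj₂ p) = inj₂ (beyond-step (Λ 1) (# (V k ∩ W')) (# ((V k ∩ W) ∩ nb G false x)) (# (V k ∩ W)) (parted k) (keeps k k≢i big) p)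

      next : Stage (suc t)
      next = record { X = x ∷ X ; avoid-v = x≢v , avoid-v ; inside = inside' ; beyond = beyond' }

    grow : ∀ t → Stage t
    grow zero = stage₀
    grow (suc t) = let (x , x∈V , x≢v , keeps) = choose (joined G (Stage.X (grow t))) in Extend.next (grow t) x x∈V x≢v keeps

    approx : Approx v i
    approx = record { X = X ; avoid-v = avoid-v ; inside = inside ; beyond = λ k d → [ id , (λ p → ⊥-elim (absurd k p)) ]′ (beyond k d) }
      where
      open Stage (subst Stage (sym k₀-def) (grow (suc (Λ 1))))
      absurd : ∀ k → Λ 1 * # (V k ∩ joined G X) + k₀ * n ≤ Λ 1 * n → ⊥
      absurd k p = <-irrefl refl (≤-trans (+-monoˡ-≤ (Λ 1 * n) n>0) (≤-trans (≤-reflexive (cong (_* n) (sym k₀-def))) (≤-trans (m≤n+m (k₀ * n) (Λ 1 * # (V k ∩ joined G X))) p)))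

  nowhere : Pred n
  nowhere z = not ⌊ any? (λ i → V i z ≟B true) ⌋

  -- If `Q` has at least `n / μ` vertices, the domain `V i` together with `Q` exceeds `n/R` by
  -- nearly `n / μ`. Only half of this surplus is claimed; the other half pays for the deficit of
  -- `V i` and for replacing both parts by common neighbourhoods.
  module Predict (v : Fin n) (i k : Fin R) (i≢k : i ≢ k) (β₁ β₂ : Bool) (c : Maybe (Fin n × Bool)) (v∉c : avoids-c v c) (μ : ℕ)
    (μ>0 : 0 < μ) (η≤H : 2 * μ ≤ H) (μ≤ : 16 * μ * k₀ ≤ θ) (ω≤θ : 16 * R * ωf (2 * μ) ≤ θ) (ω≤Λ : 16 * R * ωf (2 * μ) ≤ Λ 0) where

    ω : ℕ
    ω = ωf (2 * μ)
    module Ai = Approx (Approximate.approx v i)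
    module Ak = Approx (Approximate.approx v k)
    Wi Wk Q S₂ : Pred n
    Wi = joined G Ai.X
    Wk = joined G Ak.X
    Q = V k ∩ restricted G c
    S₂ = Wk ∩ restricted G c

    k₀>0 : 0 < k₀
    k₀>0 = subst (0 <_) (sym k₀-def) (s≤s z≤n)

    lost-small : ∀ x → θ * x ≤ k₀ * (2 * n) → 8 * μ * x ≤ n
    lost-small x p = *-cancelˡ-≤ (2 * k₀) ⦃ >-nonZero (≤-trans k₀>0 (m≤m+n _ _)) ⦄
      (≤-trans (≤-reflexive (re₁ k₀ μ x)) (≤-trans (scale x μ≤ p) (≤-reflexive (re₂ k₀ n))))
      where
      re₁ : ∀ k μ x → 2 * k * (8 * μ * x) ≡ 16 * μ * k * x
      re₁ = solve-∀
      re₂ : ∀ k n → k * (2 * n) ≡ 2 * k * n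
      re₂ = solve-∀

    domain : n ≤ μ * # Q → (2 * μ + R) * n ≤ R * (2 * μ) * # (isJust ∘ predictor G Ai.X β₁ Ak.X c β₂)
    domain big = *-cancelˡ-≤ 4 (≤-trans (certify (R * n) (size-at (8 * μ) 8μ≤θ i ⊕ (8 * R * μ ⊗ split (V i) Wi) ⊕ (R ⊗ lost-small _ Ai.inside)
          ⊕ (8 * R ⊗ big) ⊕ (8 * R * μ ⊗ splitₖ) ⊕ (R ⊗ lost-small _ Ak.inside))
        (re R μ n (# (V i)) (# (V i ∩ Wi)) (# (V i ∩ ∁ Wi)) (# Q) (# (Q ∩ Wk)) (# (V k ∩ ∁ Wk)))) (4 ⊗ (R * (2 * μ) ⊗ union)))
      where
      8μ≤θ : 8 * μ ≤ θ
      8μ≤θ = ≤-trans (≤-trans (*-monoˡ-≤ μ (m≤m+n 8 8)) (m≤m*n (16 * μ) k₀ ⦃ >-nonZero k₀>0 ⦄)) μ≤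
      split : ∀ (P W : Pred n) → # P ≤ # (P ∩ W) + # (P ∩ ∁ W)
      split P W = ≤-reflexive (#-split P W)
      splitₖ : # Q ≤ # (Q ∩ Wk) + # (V k ∩ ∁ Wk)
      splitₖ = ≤-trans (split Q Wk) (≤-refl ⊕ #-mono {S = Q ∩ ∁ Wk} {R = V k ∩ ∁ Wk} (λ {z} p → ∧-intro (∧-left {V k z} (∧-left {Q z} p)) (∧-right {Q z} p)))
      re : ∀ R μ n v a a' q b b' → 4 * ((2 * μ + R) * n) + (R * (8 * μ) * v + R * n + 8 * R * μ * (a + a') + R * n + 8 * R * (μ * q) + 8 * R * μ * (b + b') + R * n) + R * n
        ≡ 4 * (R * (2 * μ) * (a + b)) + (8 * μ * n + 8 * R * μ * v + R * (8 * μ * a') + 8 * R * n + 8 * R * μ * q + R * (8 * μ * b'))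
      re = solve-∀
      union : # (V i ∩ Wi) + # (Q ∩ Wk) ≤ # (isJust ∘ predictor G Ai.X β₁ Ak.X c β₂)
      union = ≤-trans (#-⊎ (V i ∩ Wi) (Q ∩ Wk) (λ z p q → disjoint i k z i≢k (∧-left {V i z} p) (∧-left {V k z} (∧-left {Q z} q))))
        (#-mono {S = (V i ∩ Wi) ∪ (Q ∩ Wk)} {R = isJust ∘ predictor G Ai.X β₁ Ak.X c β₂} λ {z} p → defined (Wi z) (S₂ z)
          ([ (λ q → inj₁ (∧-right {V i z} q)) , (λ q → inj₂ (∧-intro (∧-right {Q z} q) (∧-right {V k z} (∧-left {Q z} q)))) ]′ (∨-elim {(V i ∩ Wi) z} p)))
        where
        defined : ∀ a b → a ≡ true ⊎ b ≡ true → isJust (if a then just β₁ else (if b then just β₂ else nothing)) ≡ true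
        defined true _ _ = refl
        defined false true _ = refl
        defined false false (inj₁ ())
        defined false false (inj₂ ())

    excess : ∀ j (A : Approx v j) → 16 * ω * # (joined G (Approx.X A) ∩ ∁ (V j)) ≤ 2 * n
    excess j A = *-cancelˡ-≤ R (certify 0 ((16 * R * ω ⊗ cover) ⊕ ≤-trans (scale (# Z) ω≤Λ foreign) (*-monoˡ-≤ n (n≤1+n r)) ⊕ scale (# nowhere) ω≤θ outside)
        (re R ω n (# (W ∩ ∁ (V j))) (# Z) (# nowhere)))
      where
      open Approx A
      W Z : Pred n
      W = joined G X
      Z = (W ∩ ∁ (V j)) ∩ ∁ nowhere
      re : ∀ R ω n x z o → R * (16 * ω * x) + (16 * R * ω * (z + o) + R * n + R * n) + 0 ≡ R * (2 * n) + (16 * R * ω * x + 16 * R * ω * z + 16 * R * ω * o)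
      re = solve-∀
      cover : # (W ∩ ∁ (V j)) ≤ # Z + # nowhere
      cover = ≤-trans (≤-reflexive (#-split (W ∩ ∁ (V j)) nowhere)) (≤-trans (≤-reflexive (+-comm _ (# Z))) (≤-refl ⊕ #-mono {S = (W ∩ ∁ (V j)) ∩ nowhere} {R = nowhere} (λ {z} p → ∧-right {(W ∩ ∁ (V j)) z} p)))
      foreign : Λ 0 * # Z ≤ r * n
      foreign = union-bound r (Λ 0) n Z (λ l → V (punchIn j l) ∩ W) cov (λ l → beyond (punchIn j l) (λ e → punchInᵢ≢i j l e))
        where
        place : ∀ z → W z ≡ true → ∁ (V j) z ≡ true → ∀ l → V l z ≡ true → Dec (j ≡ l) → ∃ λ l → (V (punchIn j l) ∩ W) z ≡ true
        place z w nj l q (yes refl) = ⊥-elim (not-elim nj q)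
        place z w nj l q (no d) = punchOut d , ∧-intro (subst (λ l → V l z ≡ true) (sym (punchIn-punchOut d)) q) w
        cov : ∀ z → Z z ≡ true → ∃ λ l → (V (punchIn j l) ∩ W) z ≡ true
        cov z p = let (l , q) = some-true (λ l → V l z) (λ none → not-elim (∧-right {(W ∩ ∁ (V j)) z} p) (not-intro (λ h → let (l , q) = dec-elim {d = any? (λ i → V i z ≟B true)} h in none l q)))
          in place z (∧-left {W z} (∧-left {(W ∩ ∁ (V j)) z} p)) (∧-right {W z} (∧-left {(W ∩ ∁ (V j)) z} p)) l q (j ≟F l)

    contradiction-from : ∀ e → 8 * ω ≤ e → n ≤ μ * # Q → e * # (V i ∩ nb G (not β₁) v) ≤ n → e * # (Q ∩ nb G (not β₂) v) ≤ n → ⊥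
    contradiction-from e 8ω≤e big f₁ f₂ = unp (2 * μ) η≤H v Ai.X Ak.X β₁ β₂ c Ai.avoid-v Ak.avoid-v v∉c (domain big)
        (≤-trans (ω ⊗ two-valued-errors G Wi β₁ S₂ β₂ v) (*-cancelˡ-≤ 16 (certify (4 * n)
          ((16 * ω ⊗ side₁) ⊕ (16 * ω ⊗ side₂) ⊕ (2 ⊗ scale _ 8ω≤e f₁) ⊕ (2 ⊗ scale _ 8ω≤e f₂) ⊕ excess i (Approximate.approx v i) ⊕ excess k (Approximate.approx v k) ⊕ (4 ⊗ 4ω≤n))
          (re ω n (# (Wi ∩ nb G (not β₁) v)) (# (S₂ ∩ nb G (not β₂) v)) (# (V i ∩ nb G (not β₁) v)) (# (Q ∩ nb G (not β₂) v)) (# (Wi ∩ ∁ (V i))) (# (Wk ∩ ∁ (V k)))))))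
      where
      4ω≤n : 4 * ω ≤ n
      4ω≤n = ≤-trans (*-monoˡ-≤ ω (≤-trans (m≤m+n 4 12) (m≤m*n 16 R))) (≤-trans ω≤θ θ≤n)
      re : ∀ ω n x y a b p q → 16 * (ω * (x + y + 1)) + (16 * ω * (a + p) + 16 * ω * (b + q) + 2 * n + 2 * n + 2 * n + 2 * n + 4 * n) + 4 * n
        ≡ 16 * n + (16 * ω * x + 16 * ω * y + 2 * (8 * ω * a) + 2 * (8 * ω * b) + 16 * ω * p + 16 * ω * q + 4 * (4 * ω))
      re = solve-∀
      side₁ : # (Wi ∩ nb G (not β₁) v) ≤ # (V i ∩ nb G (not β₁) v) + # (Wi ∩ ∁ (V i))
      side₁ = #-cover {P = V i ∩ nb G (not β₁) v} {R = Wi ∩ ∁ (V i)} λ z p → sort (V i z) refl (∧-left {Wi z} p) (∧-right {Wi z} p)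
        where
        sort : ∀ {z} b → V i z ≡ b → Wi z ≡ true → nb G (not β₁) v z ≡ true → (V i ∩ nb G (not β₁) v) z ≡ true ⊎ (Wi ∩ ∁ (V i)) z ≡ true
        sort true e w q = inj₁ (∧-intro e q)
        sort false e w q = inj₂ (∧-intro w (cong not e))
      side₂ : # (S₂ ∩ nb G (not β₂) v) ≤ # (Q ∩ nb G (not β₂) v) + # (Wk ∩ ∁ (V k))
      side₂ = #-cover {P = Q ∩ nb G (not β₂) v} {R = Wk ∩ ∁ (V k)} λ z p → sort (V k z) refl (∧-left {Wk z} (∧-left {S₂ z} p)) (∧-right {Wk z} (∧-left {S₂ z} p)) (∧-right {S₂ z} p)
        where
        sort : ∀ {z} b → V k z ≡ b → Wk z ≡ true → restricted G c z ≡ true → nb G (not β₂) v z ≡ true → (Q ∩ nb G (not β₂) v) z ≡ true ⊎ (Wk ∩ ∁ (V k)) z ≡ true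
        sort true e w s q = inj₁ (∧-intro (∧-intro e s) q)
        sort false e w s q = inj₂ (∧-intro w (cong not e))

  few-at : ℕ → Bool → Fin R → Fin n → Set
  few-at k b i v = k * # (V i ∩ nb G b v) < n

  few-at? : ∀ k b i v → Dec (few-at k b i v)
  few-at? k b i v = k * # (V i ∩ nb G b v) <? n

  16R*-mono : ∀ {x y z} → x ≤ y → 16 * R * y ≤ z → 16 * R * x ≤ z
  16R*-mono p q = ≤-trans (16 * R ⊗ p) q

  k₀-bound : ∀ {μ} → μ ≤ 2 * R + ρ → 16 * μ * k₀ ≤ θ
  k₀-bound p = ≤-trans (*-monoˡ-≤ k₀ (16 ⊗ p)) k₀≤θ

  open Forbidden {r = r} T G free

  -- Almost homogeneous to two parts, `v` would be predicted on about `2n/R` vertices, and a single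
  -- such vertex is already excluded by `Unpredictable`.
  two-poor : ∀ v i k b b' → i ≢ k → few-at ρ b i v → few-at ρ b' k v → ⊥
  two-poor v i k b b' i≢k p q = Predict.contradiction-from v i k i≢k (not b) (not b') nothing tt (2 * R) (s≤s z≤n) 4R≤H (k₀-bound {2 * R} (m≤m+n (2 * R) ρ))
    (16R*-mono (m≤m+n ω₁ ω₂) 16Rω≤θ) (16R*-mono (m≤m+n ω₁ ω₂) 16Rω≤Λ₀) ρ 8ω₁≤ρ
    (≤-trans (V-large k) (2 * R ⊗ #-mono {S = V k} {R = V k ∩ restricted G nothing} (λ s → ∧-intro s refl)))
    (subst (λ b → ρ * # (V i ∩ nb G b v) ≤ n) (sym (not-involutive b)) (<⇒≤ p))
    (≤-trans (ρ ⊗ #-mono {S = (V k ∩ restricted G nothing) ∩ nb G (not (not b')) v} {R = V k ∩ nb G b' v} (λ {z} s →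
      ∧-intro (∧-left {V k z} (∧-left {(V k ∩ restricted G nothing) z} s)) (subst (λ b → nb G b v z ≡ true) (not-involutive b') (∧-right {(V k ∩ restricted G nothing) z} s)))) (<⇒≤ q))

  coarser : ∀ {b i v} → few-at (Λ 0) b i v → few-at ρ b i v
  coarser p = ≤-<-trans (*-monoˡ-≤ _ ρ≤Λ₀) p

  some-poor : ∀ v i → few-at (Λ 0) false i v ⊎ (∃ λ k → k ≢ i × ∃ λ b → few-at (Λ 0) b k v)
  some-poor v i = decide (few-at? (Λ 0) false i v) (any? (λ k → ¬? (k ≟F i) ×-dec (few-at? (Λ 0) true k v ⊎-dec few-at? (Λ 0) false k v)))
    where
    decide : Dec (few-at (Λ 0) false i v) → Dec (∃ λ k → k ≢ i × (few-at (Λ 0) true k v ⊎ few-at (Λ 0) false k v)) →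
      few-at (Λ 0) false i v ⊎ (∃ λ k → k ≢ i × ∃ λ b → few-at (Λ 0) b k v)
    decide (yes p) _ = inj₁ p
    decide (no _) (yes (k , d , inj₁ p)) = inj₂ (k , d , true , p)
    decide (no _) (yes (k , d , inj₂ p)) = inj₂ (k , d , false , p)
    decide (no p) (no none) = ⊥-elim (no-shape₂ sh₂ v i parts (≮⇒≥ p) λ { k d true → ≮⇒≥ (λ q → none (k , d , inj₁ q)) ; k d false → ≮⇒≥ (λ q → none (k , d , inj₂ q)) })

  -- A poor part `k` found when testing `zero` is tested again in the role of the exceptional part:
  -- a further poor part is excluded by `two-poor`, so `v` is almost complete to `V k`.
  class : ∀ v → ∃ λ i → few-at (Λ 0) false i v
  class v = decide (some-poor v zero)
    where
    again : ∀ k b → few-at (Λ 0) b k v → few-at (Λ 0) false k v ⊎ (∃ λ j → j ≢ k × ∃ λ b → few-at (Λ 0) b j v) → ∃ λ i → few-at (Λ 0) false i v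
    again k b p (inj₁ q) = k , q
    again k b p (inj₂ (j , d , b' , q)) = ⊥-elim (two-poor v j k b' b d (coarser q) (coarser p))
    decide : few-at (Λ 0) false zero v ⊎ (∃ λ k → k ≢ zero × ∃ λ b → few-at (Λ 0) b k v) → ∃ λ i → few-at (Λ 0) false i v
    decide (inj₁ p) = zero , p
    decide (inj₂ (k , _ , b , p)) = again k b p (some-poor v k)

  module _ (u v : Fin n) (u≢v : u ≢ v) (i : Fin R) (pu : few-at (Λ 0) false i u) (pv : few-at (Λ 0) false i v) where

    common : n ≤ Λ 0 * # (V i ∩ nb G true u ∩ nb G true v)
    common = certify 0 ((Λ 0 ⊗ cover) ⊕ <⇒≤ pu ⊕ <⇒≤ pv ⊕ 2Λ≤n ⊕ quarter)
        (re (Λ 0) n (# (V i)) (# (V i ∩ nb G false u)) (# (V i ∩ nb G false v)) (# (V i ∩ nb G true u ∩ nb G true v)))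
      where
      2Λ≤n : 2 * Λ 0 ≤ n
      2Λ≤n = ≤-trans (≤-trans (2 ⊗ Λ≤top z≤n) (≤-trans (*-monoˡ-≤ top (m≤m+n 2 2)) 4top≤θ)) θ≤n
      quarter : 4 * n ≤ Λ 0 * # (V i)
      quarter = ≤-trans (4 ⊗ V-large i) (≤-trans (≤-reflexive (re₁ R (# (V i)))) (*-monoˡ-≤ (# (V i)) 8R≤Λ₀))
        where
        re₁ : ∀ R v → 4 * (2 * R * v) ≡ 8 * R * v
        re₁ = solve-∀
      re : ∀ l n v f g c → n + (l * (c + (f + 1 + (g + 1))) + n + n + n + l * v) + 0 ≡ l * c + (l * v + l * f + l * g + 2 * l + 4 * n)
      re = solve-∀
      off : Fin n → Pred n
      off w = (V i ∩ nb G false w) ∪ (λ z → ⌊ z ≟F w ⌋)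
      off-# : ∀ w → # (off w) ≤ # (V i ∩ nb G false w) + 1
      off-# w = ≤-trans (#-∪ (V i ∩ nb G false w) (λ z → ⌊ z ≟F w ⌋)) (≤-refl ⊕ ≤-reflexive (#-single w))
      side : ∀ w z → V i z ≡ true → Dec (z ≡ w) → ∀ b → E G w z ≡ b → nb G true w z ≡ true ⊎ off w z ≡ true
      side w z s (yes p) _ _ = inj₂ (∨-introʳ {(V i ∩ nb G false w) z} (dec-intro {d = z ≟F w} p))
      side w z s (no p) true e = inj₁ (nb-intro G p e)
      side w z s (no p) false e = inj₂ (∨-introˡ (∧-intro s (nb-intro G p e)))
      sort : ∀ z → V i z ≡ true → nb G true u z ≡ true ⊎ off u z ≡ true → nb G true v z ≡ true ⊎ off v z ≡ true →
        (V i ∩ nb G true u ∩ nb G true v) z ≡ true ⊎ (off u ∪ off v) z ≡ true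
      sort z s (inj₁ p) (inj₁ q) = inj₁ (∧-intro s (∧-intro p q))
      sort z s (inj₂ p) _ = inj₂ (∨-introˡ p)
      sort z s (inj₁ _) (inj₂ q) = inj₂ (∨-introʳ {off u z} q)
      cover : # (V i) ≤ # (V i ∩ nb G true u ∩ nb G true v) + (# (V i ∩ nb G false u) + 1 + (# (V i ∩ nb G false v) + 1))
      cover = ≤-trans (#-cover {P = V i ∩ nb G true u ∩ nb G true v} {R = off u ∪ off v} (λ z s → sort z s (side u z s (z ≟F u) (E G u z) refl) (side v z s (z ≟F v) (E G v z) refl)))
        (≤-refl ⊕ ≤-trans (#-∪ (off u) (off v)) (off-# u ⊕ off-# v))

    -- By `two-poor` for `u` the set `V k ∩ nb G b u` has at least `n / ρ` vertices. If `v` had few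
    -- `b'`-neighbours there, it would be predicted on `V i` and on this set; the optional pair in
    -- the predictor serves to describe the set by `u` and `b`.
    rich-pair : ∀ k → k ≢ i → ∀ b b' → n ≤ Λ 0 * # (V k ∩ nb G b u ∩ nb G b' v)
    rich-pair k k≢i b b' = ≮⇒≥ λ lt → Predict.contradiction-from v i k (λ e → k≢i (sym e)) true (not b') (just (u , b)) u≢v ρ ρ>0 2ρ≤H (k₀-bound {ρ} (m≤n+m ρ (2 * R)))
      (16R*-mono (m≤n+m ω₂ ω₁) 16Rω≤θ) (16R*-mono (m≤n+m ω₂ ω₁) 16Rω≤Λ₀) (8 * ω₂) ≤-refl
      (≤-trans (≮⇒≥ (λ q → two-poor u i k false b (λ e → k≢i (sym e)) (coarser pu) q)) (ρ ⊗ #-mono {S = V k ∩ nb G b u} {R = V k ∩ restricted G (just (u , b))}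
        (λ {z} s → ∧-intro (∧-left {V k z} s) (dec-intro {d = E G u z ≟B b} (nb-E G (∧-right {V k z} s))))))
      (≤-trans (*-monoˡ-≤ (# (V i ∩ nb G false v)) 8ω₂≤Λ₀) (<⇒≤ pv))
      (final lt)
      where
      Q' : Pred n
      Q' = V k ∩ restricted G (just (u , b))
      final : Λ 0 * # (V k ∩ nb G b u ∩ nb G b' v) < n → 8 * ω₂ * # (Q' ∩ nb G (not (not b')) v) ≤ n
      final lt = *-cancelˡ-≤ 2 (≤-trans (2 ⊗ (8 * ω₂ ⊗ cover)) (certify 0 (≤-trans (*-monoˡ-≤ _ 16ω₂≤Λ₀) (<⇒≤ lt) ⊕ ≤-trans 16ω₂≤Λ₀ (≤-trans Λ0≤θ θ≤n))
          (re ω₂ (# (V k ∩ nb G b u ∩ nb G b' v)) n)))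
        where
        16ω₂≤Λ₀ : 16 * ω₂ ≤ Λ 0
        16ω₂≤Λ₀ = ≤-trans (*-monoˡ-≤ ω₂ (m≤m*n 16 R)) (16R*-mono (m≤n+m ω₂ ω₁) 16Rω≤Λ₀)
        re : ∀ w c n → 2 * (8 * w * (c + 1)) + (n + n) + 0 ≡ 2 * n + (16 * w * c + 16 * w)
        re = solve-∀
        sort : ∀ z → Dec (z ≡ u) → (Q' ∩ nb G (not (not b')) v) z ≡ true → (V k ∩ nb G b u ∩ nb G b' v) z ≡ true ⊎ ⌊ z ≟F u ⌋ ≡ true
        sort z (yes e) _ = inj₂ (dec-intro {d = z ≟F u} e)
        sort z (no d) p = inj₁ (∧-intro (∧-left {V k z} (∧-left {Q' z} p)) (∧-intro (nb-intro G d (dec-elim {d = E G u z ≟B b} (∧-right {V k z} (∧-left {Q' z} p))))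
          (subst (λ b → nb G b v z ≡ true) (not-involutive b') (∧-right {Q' z} p))))
        cover : # (Q' ∩ nb G (not (not b')) v) ≤ # (V k ∩ nb G b u ∩ nb G b' v) + 1
        cover = ≤-trans (#-cover {P = V k ∩ nb G b u ∩ nb G b' v} {R = λ z → ⌊ z ≟F u ⌋} (λ z → sort z (z ≟F u))) (≤-refl ⊕ ≤-reflexive (#-single u))

    adjacent : E G u v ≡ true
    adjacent = decide (E G u v) refl
      where
      decide : ∀ b → E G u v ≡ b → E G u v ≡ true
      decide true e = e
      decide false e = ⊥-elim (no-shape₁ sh₁ u v i u≢v e parts common rich-pair)

  cliques : Σ (Fin n → Fin R) λ part → ∀ u v → part u ≡ part v → u ≢ v → E G u v ≡ true
  cliques = (λ v → proj₁ (class v)) , λ u v e d → adjacent u v d (proj₁ (class v)) (subst (λ i → few-at (Λ 0) false i u) e (proj₂ (class u))) (proj₂ (class v))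

-- Lists without repetitions and counting

∈-index : ∀ {A : Set} {x : A} {L} → x ∈ L → ∃ λ i → lookup L i ≡ x
∈-index (here e) = zero , sym e
∈-index (there p) = let (i , e) = ∈-index p in suc i , e

Unique-⊆-length : ∀ {A : Set} {xs ys : List A} → Unique xs → (∀ {x} → x ∈ xs → x ∈ ys) → length xs ≤ length ys
Unique-⊆-length {xs = xs} {ys} u inc with length xs ≤? length ys
... | yes p = p
... | no p =
  let pos = λ i → ∈-index (inc (∈-lookup {xs = xs} i))
      (i , j , i<j , e) = pigeonhole (≰⇒> p) (λ i → proj₁ (pos i))
  in ⊥-elim (<⇒≢ i<j (cong toℕ (Unique-lookup u i j (trans (sym (proj₂ (pos i))) (trans (cong (lookup ys) e) (proj₂ (pos j)))))))

pairs-with : ∀ {A B C : Set} → (A → B → C) → List A → (A → List B) → List C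
pairs-with f [] g = []
pairs-with f (a ∷ L) g = map (f a) (g a) ++ pairs-with f L g

∈-pairs-with : ∀ {A B C : Set} (f : A → B → C) {L g a b} → a ∈ L → b ∈ g a → f a b ∈ pairs-with f L g
∈-pairs-with f (here refl) q = ∈-++⁺ˡ (∈-map⁺ (f _) q)
∈-pairs-with f {L = x ∷ L} {g} (there p) q = ∈-++⁺ʳ (map (f x) (g x)) (∈-pairs-with f p q)

pairs-with-∈ : ∀ {A B C : Set} (f : A → B → C) {L g c} → c ∈ pairs-with f L g → ∃ λ a → ∃ λ b → a ∈ L × b ∈ g a × c ≡ f a b
pairs-with-∈ f {a ∷ L} {g} p with ∈-++⁻ (map (f a) (g a)) p
... | inj₁ q = let (b , b∈ , e) = ∈-map⁻ (f a) q in a , b , here refl , b∈ , e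
... | inj₂ q = let (a' , b , a∈ , b∈ , e) = pairs-with-∈ f q in a' , b , there a∈ , b∈ , e

pairs-with-≤ : ∀ {A B C : Set} (f : A → B → C) L g M → (∀ a → length (g a) ≤ M) → length (pairs-with f L g) ≤ length L * M
pairs-with-≤ f [] g M _ = z≤n
pairs-with-≤ f (a ∷ L) g M h = ≤-trans (≤-reflexive (trans (length-++ (map (f a) (g a))) (cong (_+ length (pairs-with f L g)) (length-map (f a) (g a))))) (h a ⊕ pairs-with-≤ f L g M h)

pairs-with-≥ : ∀ {A B C : Set} (f : A → B → C) L g M → (∀ a → a ∈ L → M ≤ length (g a)) → length L * M ≤ length (pairs-with f L g)
pairs-with-≥ f [] g M _ = z≤n
pairs-with-≥ f (a ∷ L) g M h = ≤-trans (h a (here refl) ⊕ pairs-with-≥ f L g M (λ a p → h a (there p)))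
  (≤-reflexive (sym (trans (length-++ (map (f a) (g a))) (cong (_+ length (pairs-with f L g)) (length-map (f a) (g a))))))

vectors : ∀ {A : Set} → List A → ∀ n → List (Vec A n)
vectors L zero = [] ∷ []
vectors L (suc n) = pairs-with _∷_ L (λ _ → vectors L n)

vectors-complete : ∀ {A : Set} {L : List A} → (∀ a → a ∈ L) → ∀ {n} (v : Vec A n) → v ∈ vectors L n
vectors-complete c [] = here refl
vectors-complete c (a ∷ v) = ∈-pairs-with _∷_ (c a) (vectors-complete c v)

vectors-length : ∀ {A : Set} (L : List A) n → length (vectors L n) ≤ length L ^ n
vectors-length L zero = ≤-refl
vectors-length L (suc n) = pairs-with-≤ _∷_ L (λ _ → vectors L n) _ (λ _ → vectors-length L n)

bits : List Bool
bits = true ∷ false ∷ []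

bits-complete : ∀ b → b ∈ bits
bits-complete true = here refl
bits-complete false = there (here refl)

-- Counting 0-1 vectors close to a partial prediction

#errors : ∀ {n} → Vec (Maybe Bool) n → Vec Bool n → ℕ
#errors [] [] = 0
#errors (p ∷ φ) (b ∷ N) = b2n (wrong p b) + #errors φ N

#stars : ∀ {n} → Vec (Maybe Bool) n → ℕ
#stars [] = 0
#stars (p ∷ φ) = b2n (not (isJust p)) + #stars φ

near : ∀ {n} → Vec (Maybe Bool) n → ℕ → List (Vec Bool n)
near [] e = [] ∷ []
near (nothing ∷ φ) e = map (true ∷_) (near φ e) ++ map (false ∷_) (near φ e)
near (just b ∷ φ) zero = map (b ∷_) (near φ zero)
near (just b ∷ φ) (suc e) = map (b ∷_) (near φ (suc e)) ++ map (not b ∷_) (near φ e)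

near-complete : ∀ {n} (φ : Vec (Maybe Bool) n) N e → #errors φ N ≤ e → N ∈ near φ e
near-complete [] [] e _ = here refl
near-complete (nothing ∷ φ) (true ∷ N) e p = ∈-++⁺ˡ (∈-map⁺ (true ∷_) (near-complete φ N e p))
near-complete (nothing ∷ φ) (false ∷ N) e p = ∈-++⁺ʳ (map (true ∷_) (near φ e)) (∈-map⁺ (false ∷_) (near-complete φ N e p))
near-complete (just true ∷ φ) (true ∷ N) zero p = ∈-map⁺ (true ∷_) (near-complete φ N zero p)
near-complete (just false ∷ φ) (false ∷ N) zero p = ∈-map⁺ (false ∷_) (near-complete φ N zero p)
near-complete (just true ∷ φ) (true ∷ N) (suc e) p = ∈-++⁺ˡ (∈-map⁺ (true ∷_) (near-complete φ N (suc e) p))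
near-complete (just true ∷ φ) (false ∷ N) (suc e) (s≤s p) = ∈-++⁺ʳ (map (true ∷_) (near φ (suc e))) (∈-map⁺ (false ∷_) (near-complete φ N e p))
near-complete (just false ∷ φ) (false ∷ N) (suc e) p = ∈-++⁺ˡ (∈-map⁺ (false ∷_) (near-complete φ N (suc e) p))
near-complete (just false ∷ φ) (true ∷ N) (suc e) (s≤s p) = ∈-++⁺ʳ (map (false ∷_) (near φ (suc e))) (∈-map⁺ (true ∷_) (near-complete φ N e p))

length-maps : ∀ {A B C : Set} (f : A → C) (g : B → C) xs ys → length (map f xs ++ map g ys) ≡ length xs + length ys
length-maps f g xs ys = trans (length-++ (map f xs)) (cong₂ _+_ (length-map f xs) (length-map g ys))

-- The weight 1/q per error makes the generating function (1 + 1/q)^dom appear.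
near-weight : ∀ q → 0 < q → ∀ {n} (φ : Vec (Maybe Bool) n) → ∃ λ d → d + #stars φ ≡ n ×
  (∀ e → length (near φ e) * q ^ d ≤ 2 ^ #stars φ * q ^ e * suc q ^ d)
near-weight q q>0 [] = 0 , refl , λ e → *-monoˡ-≤ 1 (≤-trans (m^n>0 q ⦃ >-nonZero q>0 ⦄ e) (≤-reflexive (sym (+-identityʳ (q ^ e)))))
near-weight q q>0 (nothing ∷ φ) = let (d , eq , h) = near-weight q q>0 φ in d , trans (+-suc d _) (cong suc eq) , λ e → begin
  length (near (nothing ∷ φ) e) * q ^ d  ≡⟨ cong (_* q ^ d) (length-maps (true ∷_) (false ∷_) (near φ e) (near φ e)) ⟩
  (length (near φ e) + length (near φ e)) * q ^ d  ≡⟨ re₁ (length (near φ e)) (q ^ d) ⟩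
  2 * (length (near φ e) * q ^ d)  ≤⟨ 2 ⊗ h e ⟩
  2 * (2 ^ #stars φ * q ^ e * suc q ^ d)  ≡⟨ re₂ (2 ^ #stars φ) (q ^ e) (suc q ^ d) ⟩
  2 * 2 ^ #stars φ * q ^ e * suc q ^ d ∎
  where
  open ≤-Reasoning
  re₁ : ∀ a b → (a + a) * b ≡ 2 * (a * b)
  re₁ = solve-∀
  re₂ : ∀ a b c → 2 * (a * b * c) ≡ 2 * a * b * c
  re₂ = solve-∀
near-weight q q>0 (just b ∷ φ) = let (d , eq , h) = near-weight q q>0 φ in suc d , cong suc eq , bound d h
  where
  open ≤-Reasoning
  re₁ : ∀ a q t → a * (q * t) ≡ q * (a * t)
  re₁ = solve-∀
  re₂ : ∀ a c q t → (a + c) * (q * t) ≡ q * (a * t) + q * (c * t)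
  re₂ = solve-∀
  re₃ : ∀ s p q t → q * (s * (q * p) * t) + q * (s * p * t) ≡ s * (q * p) * (t + q * t)
  re₃ = solve-∀
  bound : ∀ d → (∀ e → length (near φ e) * q ^ d ≤ 2 ^ #stars φ * q ^ e * suc q ^ d) →
    ∀ e → length (near (just b ∷ φ) e) * q ^ suc d ≤ 2 ^ #stars φ * q ^ e * suc q ^ suc d
  bound d h zero = begin
    length (map (b ∷_) (near φ zero)) * (q * q ^ d)  ≡⟨ trans (cong (_* (q * q ^ d)) (length-map (b ∷_) (near φ zero))) (re₁ (length (near φ zero)) q (q ^ d)) ⟩
    q * (length (near φ zero) * q ^ d)  ≤⟨ q ⊗ h zero ⟩
    q * (2 ^ #stars φ * 1 * suc q ^ d)  ≤⟨ *-monoˡ-≤ _ (n≤1+n q) ⟩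
    suc q * (2 ^ #stars φ * 1 * suc q ^ d)  ≡⟨ sym (re₁ (2 ^ #stars φ * 1) (suc q) (suc q ^ d)) ⟩
    2 ^ #stars φ * 1 * (suc q * suc q ^ d) ∎
  bound d h (suc e) = begin
    length (near (just b ∷ φ) (suc e)) * (q * q ^ d)  ≡⟨ trans (cong (_* (q * q ^ d)) (length-maps (b ∷_) (not b ∷_) (near φ (suc e)) (near φ e))) (re₂ (length (near φ (suc e))) (length (near φ e)) q (q ^ d)) ⟩
    q * (length (near φ (suc e)) * q ^ d) + q * (length (near φ e) * q ^ d)  ≤⟨ (q ⊗ h (suc e)) ⊕ (q ⊗ h e) ⟩
    q * (2 ^ #stars φ * (q * q ^ e) * suc q ^ d) + q * (2 ^ #stars φ * q ^ e * suc q ^ d)  ≡⟨ re₃ (2 ^ #stars φ) (q ^ e) q (suc q ^ d) ⟩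
    2 ^ #stars φ * (q * q ^ e) * (suc q ^ d + q * suc q ^ d) ∎

-- Bernoulli's inequality for the power `k` of `q / (q + 1)`, with the denominators cleared.
bernoulli : ∀ q k → suc q * suc q ^ k ≤ suc q * q ^ k + k * suc q ^ k
bernoulli q zero = m≤m+n _ _
bernoulli q (suc k) = certify (k * suc q ^ k) (q ⊗ bernoulli q k) (re q k (suc q ^ k) (q ^ k))
  where
  re : ∀ q k a b → suc q * (suc q * a) + q * (suc q * b + k * a) + k * a ≡ suc q * (q * b) + suc k * (suc q * a) + q * (suc q * a)
  re = solve-∀

doubling : ∀ x → suc (2 * x) ^ x ≤ 2 * (2 * x) ^ x
doubling x = *-cancelˡ-≤ (suc (2 * x)) (certify (suc (2 * x) ^ x) (2 ⊗ bernoulli (2 * x) x) (re x (suc (2 * x) ^ x) ((2 * x) ^ x)))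
  where
  re : ∀ x a b → suc (2 * x) * a + 2 * (suc (2 * x) * b + x * a) + a ≡ suc (2 * x) * (2 * b) + 2 * (suc (2 * x) * a)
  re = solve-∀

-- With `q = 2 * x` in `near-weight`, the factor `q ^ e` is at most `2 ^ (x * e)`. By `doubling`,
-- `x` factors `1 + 1/q` contribute at most 2, and the `d ≤ x * t` factors are padded to `t` blocks
-- of length `x`.
near-length : ∀ x → 0 < x → ∀ {n} (φ : Vec (Maybe Bool) n) e t → n ≤ x * t → length (near φ e) ≤ 2 ^ (#stars φ + x * e + t)
near-length x x>0 {n} φ e t n≤xt with near-weight (2 * x) (≤-trans x>0 (m≤m+n _ _)) φ
... | d , eq , h = *-cancelʳ-≤ _ _ (q ^ d) (begin
  length (near φ e) * q ^ d  ≤⟨ h e ⟩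
  2 ^ #stars φ * q ^ e * suc q ^ d  ≤⟨ *-mono-≤ (2 ^ #stars φ ⊗ qe) power ⟩
  2 ^ #stars φ * 2 ^ (x * e) * (2 ^ t * q ^ d)  ≡⟨ re (2 ^ #stars φ) (2 ^ (x * e)) (2 ^ t) (q ^ d) ⟩
  2 ^ #stars φ * 2 ^ (x * e) * 2 ^ t * q ^ d  ≡⟨ cong (_* q ^ d) (trans (cong (_* 2 ^ t) (sym (^-distribˡ-+-* 2 (#stars φ) (x * e)))) (sym (^-distribˡ-+-* 2 (#stars φ + x * e) t))) ⟩
  2 ^ (#stars φ + x * e + t) * q ^ d ∎)
  where
  open ≤-Reasoning
  q : ℕ
  q = 2 * x
  instance
    q≢0 : NonZero q
    q≢0 = >-nonZero (≤-trans x>0 (m≤m+n x _))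
    qd≢0 : NonZero (q ^ d)
    qd≢0 = >-nonZero (m^n>0 q d)
  re : ∀ a b c d → a * b * (c * d) ≡ a * b * c * d
  re = solve-∀
  q≤2^x : q ≤ 2 ^ x
  q≤2^x = lem x x>0
    where
    lem : ∀ x → 0 < x → 2 * x ≤ 2 ^ x
    lem (suc x) _ = 2 ⊗ k<2^k x
  qe : q ^ e ≤ 2 ^ (x * e)
  qe = ≤-trans (^-monoˡ-≤ e q≤2^x) (≤-reflexive (^-*-assoc 2 x e))
  d≤xt : d ≤ x * t
  d≤xt = ≤-trans (≤-trans (m≤m+n d _) (≤-reflexive eq)) n≤xt
  rest : ℕ
  rest = x * t ∸ d
  split : d + rest ≡ x * t
  split = m+[n∸m]≡n d≤xt
  power : suc q ^ d ≤ 2 ^ t * q ^ d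
  power = *-cancelʳ-≤ _ _ (q ^ rest) ⦃ >-nonZero (m^n>0 q rest) ⦄ (begin
    suc q ^ d * q ^ rest  ≤⟨ suc q ^ d ⊗ ^-monoˡ-≤ rest (n≤1+n q) ⟩
    suc q ^ d * suc q ^ rest  ≡⟨ trans (sym (^-distribˡ-+-* (suc q) d rest)) (cong (suc q ^_) split) ⟩
    suc q ^ (x * t)  ≡⟨ sym (^-*-assoc (suc q) x t) ⟩
    (suc q ^ x) ^ t  ≤⟨ ^-monoˡ-≤ t (doubling x) ⟩
    (2 * q ^ x) ^ t  ≡⟨ *-^ 2 (q ^ x) t ⟩
    2 ^ t * (q ^ x) ^ t  ≡⟨ cong (2 ^ t *_) (trans (^-*-assoc q x t) (trans (cong (q ^_) (sym split)) (^-distribˡ-+-* q d rest))) ⟩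
    2 ^ t * (q ^ d * q ^ rest)  ≡⟨ sym (*-assoc (2 ^ t) (q ^ d) (q ^ rest)) ⟩
    2 ^ t * q ^ d * q ^ rest ∎)

-- Labelled graphs: enumeration, deletion of a vertex and induced subgraphs

codes : ∀ n → List (Code n)
codes zero = tt ∷ []
codes (suc n) = cartesianProduct (codes n) (vectors bits n)

codes-complete : ∀ {n} (G : Code n) → G ∈ codes n
codes-complete {zero} tt = here refl
codes-complete {suc n} (G , v) = ∈-cartesianProduct⁺ (codes-complete G) (vectors-complete bits-complete v)

Unique-pairs : ∀ {A B C : Set} (f : A → B → C) → (∀ {a b a' b'} → f a b ≡ f a' b' → a ≡ a' × b ≡ b') →
  ∀ {L} {g : A → List B} → Unique L → (∀ a → Unique (g a)) → Unique (pairs-with f L g)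
Unique-pairs f inj [] u = []
Unique-pairs f inj {a ∷ L} {g} (d ∷ ds) u = Unique-++⁺ (Unique-map⁺ (λ e → proj₂ (inj e)) (u a)) (Unique-pairs f inj ds u)
  λ { (p , q) → let (b , _ , e) = ∈-map⁻ (f a) p ; (a' , b' , a'∈ , _ , e') = pairs-with-∈ f q
                in AllM.lookup d a'∈ (proj₁ (inj (trans (sym e) e'))) }

vectors-unique : ∀ {A : Set} {L : List A} → Unique L → ∀ n → Unique (vectors L n)
vectors-unique u zero = [] ∷ []
vectors-unique u (suc n) = Unique-pairs _∷_ (λ { refl → refl , refl }) u (λ _ → vectors-unique u n)

codes-unique : ∀ n → Unique (codes n)
codes-unique zero = [] ∷ []
codes-unique (suc n) = Unique-cartesianProduct⁺ (codes-unique n) (vectors-unique (((λ ()) ∷ []) ∷ [] ∷ []) n)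

Code-≟ : ∀ {n} (G H : Code n) → Dec (G ≡ H)
Code-≟ {zero} tt tt = yes refl
Code-≟ {suc n} = ×-≡-dec Code-≟ (Vec-≡-dec _≟B_)

toCode : ∀ {n} → (Fin n → Fin n → Bool) → Code n
toCode {zero} A = tt
toCode {suc n} A = toCode (λ i j → A (suc i) (suc j)) , vtabulate (λ j → A zero (suc j))

adj-toCode : ∀ {n} (A : Fin n → Fin n → Bool) → (∀ x y → A x y ≡ A y x) → (∀ x → A x x ≡ false) → ∀ x y → adjB (toCode A) x y ≡ A x y
adj-toCode {suc n} A s i zero zero = sym (i zero)
adj-toCode {suc n} A s i zero (suc y) = lookup∘tabulate _ y
adj-toCode {suc n} A s i (suc x) zero = trans (lookup∘tabulate _ x) (s zero (suc x))
adj-toCode {suc n} A s i (suc x) (suc y) = adj-toCode (λ i j → A (suc i) (suc j)) (λ x y → s (suc x) (suc y)) (λ x → i (suc x)) x y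

Vec-ext : ∀ {A : Set} {n} (v w : Vec A n) → (∀ i → vlookup v i ≡ vlookup w i) → v ≡ w
Vec-ext v w h = trans (sym (tabulate∘lookup v)) (trans (tabulate-cong h) (tabulate∘lookup w))

Code-ext : ∀ {n} (G H : Code n) → (∀ x y → adjB G x y ≡ adjB H x y) → G ≡ H
Code-ext {zero} tt tt _ = refl
Code-ext {suc n} (G , v) (H , w) h = cong₂ _,_ (Code-ext G H (λ x y → h (suc x) (suc y))) (Vec-ext v w (λ j → h zero (suc j)))

remove : ∀ {n} → Fin (suc n) → Code (suc n) → Code n
remove v G = toCode (λ x y → adjB G (punchIn v x) (punchIn v y))

adj-remove : ∀ {n} (v : Fin (suc n)) G x y → adjB (remove v G) x y ≡ adjB G (punchIn v x) (punchIn v y)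
adj-remove v G = adj-toCode _ (λ x y → E-sym (ofCode G) (punchIn v x) (punchIn v y)) (λ x → E-irr (ofCode G) (punchIn v x))

neighbours : ∀ {n} → Fin (suc n) → Code (suc n) → Vec Bool n
neighbours v G = vtabulate (λ x → adjB G v (punchIn v x))

joinAdj : ∀ {n} (v : Fin (suc n)) → Code n → Vec Bool n → (x y : Fin (suc n)) → Dec (v ≡ x) → Dec (v ≡ y) → Bool
joinAdj v G N x y (yes _) (yes _) = false
joinAdj v G N x y (yes _) (no q) = vlookup N (punchOut q)
joinAdj v G N x y (no p) (yes _) = vlookup N (punchOut p)
joinAdj v G N x y (no p) (no q) = adjB G (punchOut p) (punchOut q)

restore : ∀ {n} → Fin (suc n) → Code n → Vec Bool n → Code (suc n)
restore v G N = toCode (λ x y → joinAdj v G N x y (v ≟F x) (v ≟F y))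

restore-remove : ∀ {n} (v : Fin (suc n)) G → restore v (remove v G) (neighbours v G) ≡ G
restore-remove v G = Code-ext _ G (λ x y → trans (adj-toCode _
    (λ x y → trans (back x y (v ≟F x) (v ≟F y)) (trans (E-sym (ofCode G) x y) (sym (back y x (v ≟F y) (v ≟F x)))))
    (λ x → trans (back x x (v ≟F x) (v ≟F x)) (E-irr (ofCode G) x)) x y) (back x y (v ≟F x) (v ≟F y)))
  where
  row : ∀ {x} (p : v ≢ x) → vlookup (neighbours v G) (punchOut p) ≡ adjB G v x
  row p = trans (lookup∘tabulate _ (punchOut p)) (cong (adjB G v) (punchIn-punchOut p))
  back : ∀ x y d d' → joinAdj v (remove v G) (neighbours v G) x y d d' ≡ adjB G x y
  back x y (yes refl) (yes refl) = sym (E-irr (ofCode G) v)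
  back x y (yes refl) (no q) = row q
  back x y (no p) (yes refl) = trans (row p) (E-sym (ofCode G) v x)
  back x y (no p) (no q) = trans (adj-remove v G _ _) (cong₂ (adjB G) (punchIn-punchOut p) (punchIn-punchOut q))

∃-Vec? : ∀ {A : Set} {L : List A} → (∀ a → a ∈ L) → ∀ n {P : Vec A n → Set} → (∀ v → Dec (P v)) → Dec (∃ P)
∃-Vec? {L = L} c n dec with AnyM.any? dec (vectors L n)
... | yes p = let (v , _ , q) = find p in yes (v , q)
... | no none = no (λ { (v , q) → none (lose (vectors-complete c v) q) })

contains? : ∀ {m n} (T : Graph m) (G : Graph n) → Dec (Contains T G)
contains? {m} {n} T G with ∃-Vec? ∈-allFin m {λ f → ∀ u v → u ≢ v → nb G (E T u v) (vlookup f u) (vlookup f v) ≡ true}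
    (λ f → all? (λ u → all? (λ v → ¬? (u ≟F v) →-dec (_ ≟B true))))
... | yes (f , h) = yes (vlookup f , h)
... | no none = no (λ { (f , h) → none (vtabulate f , λ u v d →
        subst₂ (λ x y → nb G (E T u v) x y ≡ true) (sym (lookup∘tabulate f u)) (sym (lookup∘tabulate f v)) (h u v d)) })

free⇒ : ∀ {m n} (T : Code m) (G : Code n) → Free T G → ¬ Contains (ofCode T) (ofCode G)
free⇒ T G free (f , h) = free (f , inj , adj)
  where
  inj : Injective _≡_ _≡_ f
  inj {u} {v} e with u ≟F v
  ... | yes p = p
  ... | no d = ⊥-elim (nb-≢ (ofCode G) (h u v d) (sym e))
  adj : ∀ u v → adjB G (f u) (f v) ≡ adjB T u v
  adj u v with u ≟F v
  ... | yes refl = trans (E-irr (ofCode G) (f u)) (sym (E-irr (ofCode T) u))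
  ... | no d = nb-E (ofCode G) (h u v d)

⇒free : ∀ {m n} (T : Code m) (G : Code n) → ¬ Contains (ofCode T) (ofCode G) → Free T G
⇒free T G free (f , inj , adj) = free (f , λ u v d → nb-intro (ofCode G) (λ e → d (sym (inj e))) (adj u v))

free? : ∀ {m n} (T : Code m) (G : Code n) → Dec (Free T G)
free? T G = map′ (⇒free T G) (free⇒ T G) (¬? (contains? (ofCode T) (ofCode G)))

remove-free : ∀ {m n} (T : Code m) (G : Code (suc n)) v → Free T G → Free T (remove v G)
remove-free T G v free (f , inj , adj) = free (punchIn v ∘ f , (λ e → inj (punchIn-injective v _ _ e)) , λ x y → trans (sym (adj-remove v G (f x) (f y))) (adj x y))

cliquePartition? : ∀ {n} r (G : Code n) → Dec (CliquePartition G r)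
cliquePartition? {n} r G with ∃-Vec? {L = allFin r} ∈-allFin n {λ part → ∀ u v → vlookup part u ≡ vlookup part v → ¬ (u ≡ v) → Adj G u v}
    (λ part → all? (λ u → all? (λ v → (vlookup part u ≟F vlookup part v) →-dec (¬? (u ≟F v) →-dec (adjB G u v ≟B true)))))
... | yes (part , h) = yes (vlookup part , h)
... | no none = no (λ { (part , h) → none (vtabulate part , λ u v e d → h u v (trans (sym (lookup∘tabulate part u)) (trans e (lookup∘tabulate part v))) d) })

-- Two of the `suc r` vertices of a stable set of `T` would be mapped into the same clique.
good⇒free : ∀ {m n r} (T : Code m) (G : Code n) → StableOfSize T (suc r) → CliquePartition G r → Free T G
good⇒free T G (s , s-inj , stable) (part , h) (f , inj , adj) =
  let (i , j , i<j , e) = pigeonhole ≤-refl (part ∘ f ∘ s)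
  in stable i j (trans (sym (adj (s i) (s j))) (h (f (s i)) (f (s j)) e (λ q → <⇒≢ i<j (cong toℕ (s-inj (inj q))))))

opaque
  unfolding #

  #-suc : ∀ {n} (S : Pred (suc n)) → # S ≡ b2n (S zero) + # (S ∘ suc)
  #-suc S = sumF-suc _

  parts-total : ∀ {n R} (part : Fin n → Fin R) → sumF (λ i → # (λ x → ⌊ part x ≟F i ⌋)) ≤ n
  parts-total {n} {R} part = ≤-trans (≤-reflexive (sumF-swap (λ i x → b2n ⌊ part x ≟F i ⌋)))
    (≤-trans (sumF-mono {h = λ _ → 1} (λ x → ≤-reflexive (trans (sumF-cong (λ i → cong b2n (flip x i))) (#-single (part x))))) (≤-reflexive (trans (sumF-const n 1) (*-identityʳ n))))
    where
    flip : ∀ x i → ⌊ part x ≟F i ⌋ ≡ ⌊ i ≟F part x ⌋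
    flip x i with part x ≟F i | i ≟F part x
    ... | yes _ | yes _ = refl
    ... | no _ | no _ = refl
    ... | yes e | no d = ⊥-elim (d (sym e))
    ... | no d | yes e = ⊥-elim (d (sym e))

-- The new vertex is joined completely to a smallest part and arbitrarily to the other vertices.
module Growth (R : ℕ) (R>0 : 0 < R) where

  instance
    R≢0 : NonZero R
    R≢0 = >-nonZero R>0

  goodL : ∀ n → List (Code n)
  goodL n = filter (cliquePartition? R) (codes n)

  goodL-unique : ∀ n → Unique (goodL n)
  goodL-unique n = Unique-filter⁺ (cliquePartition? R) (codes-unique n)

  ∈-goodL : ∀ {n} {G : Code n} → CliquePartition G R → G ∈ goodL n
  ∈-goodL {G = G} p = ∈-filter⁺ (cliquePartition? R) (codes-complete G) p

  fills : ∀ {n} → Pred n → List (Vec Bool n)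
  fills {zero} S = [] ∷ []
  fills {suc n} S = if S zero then map (true ∷_) (fills (S ∘ suc)) else map (true ∷_) (fills (S ∘ suc)) ++ map (false ∷_) (fills (S ∘ suc))

  ∷-injective : ∀ {n b} {v w : Vec Bool n} → b ∷ v ≡ b ∷ w → v ≡ w
  ∷-injective refl = refl

  fills-unique : ∀ {n} (S : Pred n) → Unique (fills S)
  fills-unique {zero} S = [] ∷ []
  fills-unique {suc n} S with S zero
  ... | true = Unique-map⁺ ∷-injective (fills-unique (S ∘ suc))
  ... | false = Unique-++⁺ (Unique-map⁺ ∷-injective (fills-unique (S ∘ suc))) (Unique-map⁺ ∷-injective (fills-unique (S ∘ suc))) apart
    where
    apart : ∀ {v} → v ∈ map (true ∷_) (fills (S ∘ suc)) × v ∈ map (false ∷_) (fills (S ∘ suc)) → ⊥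
    apart (p , q) with ∈-map⁻ (true ∷_) p | ∈-map⁻ (false ∷_) q
    ... | _ , _ , refl | _ , _ , ()

  fills-sound : ∀ {n} (S : Pred n) {v} → v ∈ fills S → ∀ x → S x ≡ true → vlookup v x ≡ true
  fills-sound {suc n} S p zero s with S zero
  fills-sound {suc n} S p zero s | true with ∈-map⁻ (true ∷_) p
  ... | _ , _ , refl = refl
  fills-sound {suc n} S p (suc x) s with S zero
  fills-sound {suc n} S p (suc x) s | true with ∈-map⁻ (true ∷_) p
  ... | _ , q , refl = fills-sound (S ∘ suc) q x s
  fills-sound {suc n} S p (suc x) s | false with ∈-++⁻ (map (true ∷_) (fills (S ∘ suc))) p
  ... | inj₁ h with ∈-map⁻ (true ∷_) h
  ...   | _ , q , refl = fills-sound (S ∘ suc) q x s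
  fills-sound {suc n} S p (suc x) s | false | inj₂ h with ∈-map⁻ (false ∷_) h
  ...   | _ , q , refl = fills-sound (S ∘ suc) q x s

  fills-length : ∀ {n} (S : Pred n) j → j + # S ≤ n → 2 ^ j ≤ length (fills S)
  fills-length {zero} S j p = ≤-reflexive (cong (2 ^_) (n≤0⇒n≡0 (≤-trans (m≤m+n j _) p)))
  fills-length {suc n} S j p rewrite #-suc S with S zero
  ... | true = ≤-trans (fills-length (S ∘ suc) j (s≤s⁻¹ (≤-trans (≤-reflexive (sym (+-suc j _))) p))) (≤-reflexive (sym (length-map (true ∷_) (fills (S ∘ suc)))))
  fills-length {suc n} S zero p | false = ≤-trans (fills-length (S ∘ suc) zero (#≤n (S ∘ suc)))
      (≤-trans (m≤m+n _ _) (≤-reflexive (sym (length-maps (true ∷_) (false ∷_) (fills (S ∘ suc)) (fills (S ∘ suc))))))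
  fills-length {suc n} S (suc j) p | false = ≤-trans (≤-reflexive (cong (2 ^ j +_) (+-identityʳ _)))
      (≤-trans (ih ⊕ ih) (≤-reflexive (sym (length-maps (true ∷_) (false ∷_) (fills (S ∘ suc)) (fills (S ∘ suc))))))
    where
    ih : 2 ^ j ≤ length (fills (S ∘ suc))
    ih = fills-length (S ∘ suc) j (s≤s⁻¹ p)

  smallest : ∀ {n} (part : Fin n → Fin R) → ∃ λ i → R * # (λ x → ⌊ part x ≟F i ⌋) ≤ n
  smallest {n} part with any? (λ i → R * # (λ x → ⌊ part x ≟F i ⌋) ≤? n)
  ... | yes p = p
  ... | no none = ⊥-elim (<-irrefl refl (≤-trans (s≤s (*-comm-≤ R n)) (≤-trans (≤-trans (m<m+n (n * R) R>0) (≤-reflexive (trans (+-comm (n * R) R) (*-comm (suc n) R)))) (≤-trans (≤-reflexive (sym (sumF-const R (suc n))))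
      (≤-trans (sumF-mono {g = λ _ → suc n} (λ i → ≰⇒> (λ p → none (i , p)))) (≤-trans (≤-reflexive (sumF-* R _)) (R ⊗ total)))))))
    where
    *-comm-≤ : ∀ a b → a * b ≤ b * a
    *-comm-≤ a b = ≤-reflexive (*-comm a b)
    total : sumF (λ i → # (λ x → ⌊ part x ≟F i ⌋)) ≤ n
    total = parts-total part

  extensions : ∀ {n} → Code n → List (Vec Bool n)
  extensions G with cliquePartition? R G
  ... | yes (part , _) = fills (λ x → ⌊ part x ≟F proj₁ (smallest part) ⌋)
  ... | no _ = []

  extensions-unique : ∀ {n} (G : Code n) → Unique (extensions G)
  extensions-unique G with cliquePartition? R G
  ... | yes _ = fills-unique _
  ... | no _ = []

  extensions-good : ∀ {n} (G : Code n) v → v ∈ extensions G → CliquePartition {suc n} (G , v) R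
  extensions-good {n} G v p with cliquePartition? R G
  ... | yes (part , h) = part' , h'
    where
    i : Fin R
    i = proj₁ (smallest part)
    part' : Fin (suc n) → Fin R
    part' zero = i
    part' (suc x) = part x
    h' : ∀ x y → part' x ≡ part' y → ¬ (x ≡ y) → Adj {suc n} (G , v) x y
    h' zero zero _ d = ⊥-elim (d refl)
    h' zero (suc y) e _ = fills-sound _ p y (dec-intro {d = part y ≟F i} (sym e))
    h' (suc x) zero e _ = fills-sound _ p x (dec-intro {d = part x ≟F i} e)
    h' (suc x) (suc y) e d = h x y e (λ q → d (cong suc q))

  extensions-length : ∀ {n} (G : Code n) → CliquePartition G R → ∀ j → j + n / R ≤ n → 2 ^ j ≤ length (extensions G)
  extensions-length {n} G good j p with cliquePartition? R G
  ... | no q = ⊥-elim (q good)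
  ... | yes (part , _) = fills-length _ j (≤-trans (+-monoʳ-≤ j (≤-trans (≤-reflexive (sym (m*n/n≡m _ R))) (/-monoˡ-≤ R (≤-trans (≤-reflexive (*-comm _ R)) (proj₂ (smallest part)))))) p)

  add : ∀ {n} → Code n → Vec Bool n → Code (suc n)
  add G v = G , v

  growth : ∀ n j → j + n / R ≤ n → length (goodL n) * 2 ^ j ≤ length (goodL (suc n))
  growth n j p = ≤-trans (pairs-with-≥ add (goodL n) extensions (2 ^ j) (λ G G∈ → extensions-length G (proj₂ (∈-filter⁻ (cliquePartition? R) {xs = codes n} G∈)) j p))
    (Unique-⊆-length (Unique-pairs add (λ { refl → refl , refl }) (goodL-unique n) extensions-unique)
      (λ {H} q → let (G , v , _ , v∈ , e) = pairs-with-∈ add {goodL n} {extensions} q in subst (_∈ goodL (suc n)) (sym e) (∈-goodL (extensions-good G v v∈))))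

  -- One exponent `q` serves all `K` steps: the hypothesis takes the loss `n/R` at the largest size
  -- and the available room at the smallest.
  growths : ∀ K p q → q + (p + K) / R ≤ p → length (goodL p) * 2 ^ (K * q) ≤ length (goodL (p + K))
  growths zero p q _ = ≤-reflexive (trans (*-identityʳ _) (cong (length ∘ goodL) (sym (+-identityʳ p))))
  growths (suc K) p q h = begin
    length (goodL p) * 2 ^ (q + K * q)  ≡⟨ cong (length (goodL p) *_) (trans (cong (2 ^_) (+-comm q (K * q))) (^-distribˡ-+-* 2 (K * q) q)) ⟩
    length (goodL p) * (2 ^ (K * q) * 2 ^ q)  ≡⟨ sym (*-assoc (length (goodL p)) _ _) ⟩
    length (goodL p) * 2 ^ (K * q) * 2 ^ q  ≤⟨ *-monoˡ-≤ (2 ^ q) (growths K p q le) ⟩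
    length (goodL (p + K)) * 2 ^ q  ≤⟨ growth (p + K) q (≤-trans le (m≤m+n p K)) ⟩
    length (goodL (suc (p + K)))  ≡⟨ cong (length ∘ goodL) (sym (+-suc p K)) ⟩
    length (goodL (p + suc K)) ∎
    where
    open ≤-Reasoning
    le : q + (p + K) / R ≤ p
    le = ≤-trans (+-monoʳ-≤ q (/-monoˡ-≤ R (+-monoʳ-≤ p (n≤1+n K)))) h

  good-exists : ∀ n → 1 ≤ length (goodL n)
  good-exists n = nonempty (∈-goodL {n} {toCode complete} ((λ _ → fromℕ< R>0) , λ x y _ d → trans (adj-toCode complete sy ir x y) (not-intro (λ e → d (dec-elim {d = x ≟F y} e)))))
    where
    complete : Fin n → Fin n → Bool
    complete x y = not ⌊ x ≟F y ⌋
    sy : ∀ x y → complete x y ≡ complete y x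
    sy x y with x ≟F y | y ≟F x
    ... | yes _ | yes _ = refl
    ... | no _ | no _ = refl
    ... | yes e | no d = ⊥-elim (d (sym e))
    ... | no d | yes e = ⊥-elim (d (sym e))
    ir : ∀ x → complete x x ≡ false
    ir x with x ≟F x
    ... | yes _ = refl
    ... | no d = ⊥-elim (d refl)
    nonempty : ∀ {A : Set} {a : A} {L} → a ∈ L → 1 ≤ length L
    nonempty (here _) = s≤s z≤n
    nonempty (there _) = s≤s z≤n

-- Reconstruction of compressible graphs from smaller ones

opaque
  unfolding #

  #-punchIn : ∀ {n} (S : Pred (suc n)) y → # S ≡ b2n (S y) + # (S ∘ punchIn y)
  #-punchIn S zero = sumF-suc _
  #-punchIn {suc n} S (suc y) = trans (sumF-suc _) (trans (cong (b2n (S zero) +_) (#-punchIn (S ∘ suc) y))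
    (trans (re (b2n (S zero)) (b2n (S (suc y))) _) (cong (b2n (S (suc y)) +_) (sym (sumF-suc _)))))
    where
    re : ∀ a b c → a + (b + c) ≡ b + (a + c)
    re = solve-∀

#-restrict : ∀ {n} (S : Pred (suc n)) y → # (S ∘ punchIn y) ≤ # S
#-restrict S y = ≤-trans (m≤n+m _ (b2n (S y))) (≤-reflexive (sym (#-punchIn S y)))

#stars-# : ∀ {n} (φ : Vec (Maybe Bool) n) → #stars φ ≡ # (λ z → not (isJust (vlookup φ z)))
#stars-# [] = sym (#-zero _ (λ ()))
#stars-# (p ∷ φ) = trans (cong (b2n (not (isJust p)) +_) (#stars-# φ)) (sym (#-suc _))

#errors-# : ∀ {n} (φ : Vec (Maybe Bool) n) N → #errors φ N ≡ # (λ z → wrong (vlookup φ z) (vlookup N z))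
#errors-# [] [] = sym (#-zero _ (λ ()))
#errors-# (p ∷ φ) (b ∷ N) = trans (cong (b2n (wrong p b) +_) (#errors-# φ N)) (sym (#-suc _))

dom-stars : ∀ {n} (φ : Fin n → Maybe Bool) → # (isJust ∘ φ) + # (not ∘ isJust ∘ φ) ≡ n
dom-stars {n} φ = sym (trans (sym (#-full n)) (#-split (λ _ → true) (isJust ∘ φ)))

marks : List (Maybe Bool)
marks = nothing ∷ just true ∷ just false ∷ []

marks-complete : ∀ p → p ∈ marks
marks-complete nothing = here refl
marks-complete (just true) = there (here refl)
marks-complete (just false) = there (there (here refl))

allFin-length : ∀ n → length (allFin n) ≡ n
allFin-length n = length-tabulate id

insertion : ∀ {A : Set} {n} (v : Fin (suc n)) → A → Vec A n → ∀ x → Dec (v ≡ x) → A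
insertion v a w x (yes _) = a
insertion v a w x (no q) = vlookup w (punchOut q)

insertAt : ∀ {A : Set} {n} → Fin (suc n) → A → Vec A n → Vec A (suc n)
insertAt v a w = vtabulate (λ x → insertion v a w x (v ≟F x))

deleteAt : ∀ {A : Set} {n} → Fin (suc n) → Vec A (suc n) → Vec A n
deleteAt v w = vtabulate (λ z → vlookup w (punchIn v z))

insertAt-deleteAt : ∀ {A : Set} {n} v (w : Vec A (suc n)) → insertAt v (vlookup w v) (deleteAt v w) ≡ w
insertAt-deleteAt v w = Vec-ext _ w (λ x → trans (lookup∘tabulate (λ x → insertion v (vlookup w v) (deleteAt v w) x (v ≟F x)) x) (back x (v ≟F x)))
  where
  back : ∀ x d → insertion v (vlookup w v) (deleteAt v w) x d ≡ vlookup w x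
  back x (yes refl) = refl
  back x (no q) = trans (lookup∘tabulate _ (punchOut q)) (cong (vlookup w) (punchIn-punchOut q))

_&_ : {A B : Set} → A → B → A × B
a & b = a , b

∈-product : ∀ {A B : Set} (L : List A) (L' : List B) {a b} → a ∈ L → b ∈ L' → (a , b) ∈ pairs-with _&_ L (λ _ → L')
∈-product L L' p q = ∈-pairs-with _&_ {L} {λ _ → L'} p q

firsts : ∀ {A B : Set} → List (A × B) → List A
firsts [] = []
firsts ((a , _) ∷ L) = a ∷ firsts L

firsts-length : ∀ {A B : Set} (L : List (A × B)) → length (firsts L) ≡ length L
firsts-length [] = refl
firsts-length (_ ∷ L) = cong suc (firsts-length L)

∈-firsts : ∀ {A B : Set} {L : List (A × B)} {a b} → (a , b) ∈ L → a ∈ firsts L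
∈-firsts (here refl) = here refl
∈-firsts {L = _ ∷ _} (there p) = there (∈-firsts p)

product-length : ∀ {A B : Set} (L : List A) (L' : List B) {a b} → length L ≤ a → length L' ≤ b → length (pairs-with _&_ L (λ _ → L')) ≤ a * b
product-length L L' {a} {b} p q = ≤-trans (pairs-with-≤ _&_ L (λ _ → L') b (λ _ → q)) (*-monoˡ-≤ b p)

module Decode {m : ℕ} (T : Code m) (s e : ℕ) where

  freeL : ∀ n → List (Code n)
  freeL n = filter (free? T) (codes n)

  ∈-freeL : ∀ {n} {G : Code n} → Free T G → G ∈ freeL n
  ∈-freeL {G = G} p = ∈-filter⁺ (free? T) (codes-complete G) p

  -- Cutting off predictions with more than `s` undecided positions makes the length bound valid for
  -- every `φ`, also for those that arise in `listA` without coming from an actual graph.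
  near? : ∀ {n} → Vec (Maybe Bool) n → List (Vec Bool n)
  near? φ = if ⌊ #stars φ ≤? s ⌋ then near φ e else []

  near?-complete : ∀ {n} (φ : Vec (Maybe Bool) n) N → #stars φ ≤ s → #errors φ N ≤ e → N ∈ near? φ
  near?-complete φ N p q with #stars φ ≤? s
  ... | yes _ = near-complete φ N e q
  ... | no h = ⊥-elim (h p)

  near?-length : ∀ x → 0 < x → ∀ {n} (φ : Vec (Maybe Bool) n) t → n ≤ x * t → length (near? φ) ≤ 2 ^ (s + x * e + t)
  near?-length x x>0 φ t p with #stars φ ≤? s
  ... | yes h = ≤-trans (near-length x x>0 φ e t p) (^-monoʳ-≤ 2 (+-monoˡ-≤ t (+-monoˡ-≤ (x * e) h)))
  ... | no _ = z≤n

  neighbours-errors : ∀ {n} (v : Fin (suc n)) (G : Code (suc n)) (φ : Vec (Maybe Bool) n) (ψ : Fin (suc n) → Maybe Bool) →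
    (∀ z → vlookup φ z ≡ ψ (punchIn v z)) → #errors φ (neighbours v G) ≤ # (errors (ofCode G) ψ v)
  neighbours-errors v G φ ψ h = ≤-trans (≤-reflexive (trans (#errors-# φ (neighbours v G)) (#-cong (λ z → cong₂ wrong (h z) (lookup∘tabulate _ z)))))
    (#-restrict (errors (ofCode G) ψ v) v)

  pred-stars : ∀ {n} (v : Fin (suc n)) (φ : Vec (Maybe Bool) n) (ψ : Fin (suc n) → Maybe Bool) →
    (∀ z → vlookup φ z ≡ ψ (punchIn v z)) → #stars φ ≤ # (not ∘ isJust ∘ ψ)
  pred-stars v φ ψ h = ≤-trans (≤-reflexive (trans (#stars-# φ) (#-cong (λ z → cong (not ∘ isJust) (h z))))) (#-restrict (not ∘ isJust ∘ ψ) v)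

  -- Graphs in which K vertices obey the same, arbitrary prediction.

  optionsA : ∀ n → Code n × Vec (Maybe Bool) n → List (Fin (suc n) × Maybe Bool × Vec Bool n)
  optionsA n (G , φ) = pairs-with _&_ (allFin (suc n)) (λ _ → pairs-with _&_ marks (λ _ → near? φ))

  buildA : ∀ {n} → Code n × Vec (Maybe Bool) n → Fin (suc n) × Maybe Bool × Vec Bool n → Code (suc n) × Vec (Maybe Bool) (suc n)
  buildA (G , φ) (v , a , N) = restore v G N , insertAt v a φ

  -- Reverses the removal of `K` vertices. The prediction is carried along and loses a coordinate
  -- with each removed vertex; restoring a vertex `v` therefore asks for `v`, the mark at `v` and a
  -- neighbourhood close to the current prediction.
  listA : (K n : ℕ) → List (Code n × Vec (Maybe Bool) n)
  listA zero n = pairs-with _&_ (freeL n) (λ _ → vectors marks n)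
  listA (suc K) zero = []
  listA (suc K) (suc n) = pairs-with buildA (listA K n) (optionsA n)

  listA-length : ∀ x → 0 < x → ∀ N t → N ≤ x * t → ∀ K n → n ≤ N →
    length (listA K n) ≤ length (freeL (n ∸ K)) * 3 ^ N * (N * (3 * 2 ^ (s + x * e + t))) ^ K
  listA-length x x>0 N t le zero n n≤N = ≤-trans (pairs-with-≤ _&_ (freeL n) (λ _ → vectors marks n) (3 ^ n) (λ _ → vectors-length marks n))
    (≤-trans (length (freeL n) ⊗ ^-monoʳ-≤ 3 n≤N) (≤-reflexive (sym (*-identityʳ _))))
  listA-length x x>0 N t le (suc K) zero _ = z≤n
  listA-length x x>0 N t le (suc K) (suc n) n≤N = ≤-trans (pairs-with-≤ buildA (listA K n) (optionsA n) (N * (3 * M)) options)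
      (≤-trans (*-monoˡ-≤ (N * (3 * M)) (listA-length x x>0 N t le K n (≤-trans (n≤1+n n) n≤N)))
        (≤-reflexive (trans (*-assoc (length (freeL (n ∸ K)) * 3 ^ N) _ _) (cong (length (freeL (n ∸ K)) * 3 ^ N *_) (*-comm _ (N * (3 * M)))))))
    where
    M : ℕ
    M = 2 ^ (s + x * e + t)
    options : ∀ a → length (optionsA n a) ≤ N * (3 * M)
    options (G , φ) = ≤-trans (product-length (allFin (suc n)) (pairs-with _&_ marks (λ _ → near? φ)) (≤-trans (≤-reflexive (allFin-length (suc n))) n≤N)
      (product-length marks (near? φ) ≤-refl (near?-length x x>0 φ t (≤-trans (≤-trans (n≤1+n n) n≤N) le)))) ≤-refl

  listA-complete : ∀ K n (G : Code n) → Free T G → (φ : Vec (Maybe Bool) n) (Y : Pred n) → K ≤ # Y → # (not ∘ isJust ∘ vlookup φ) ≤ s →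
    (∀ y → Y y ≡ true → # (errors (ofCode G) (vlookup φ) y) ≤ e) → (G , φ) ∈ listA K n
  listA-complete zero n G free φ Y _ _ _ = ∈-product (freeL n) (vectors marks n) (∈-freeL free) (vectors-complete marks-complete φ)
  listA-complete (suc K) zero G free φ Y K≤ _ _ = ⊥-elim (<⇒≱ (s≤s z≤n) (≤-trans K≤ (#≤n Y)))
  listA-complete (suc K) (suc n) G free φ Y K≤ stars err with witness Y (≤-trans (s≤s z≤n) K≤)
  ... | y , y∈ = subst (_∈ listA (suc K) (suc n)) (cong₂ _,_ (restore-remove y G) (insertAt-deleteAt y φ))
      (∈-pairs-with buildA {listA K n} {optionsA n} (listA-complete K n G' (remove-free T G y free) φ' Y' Y'≥ stars' err')
        (∈-product (allFin (suc n)) (pairs-with _&_ marks (λ _ → near? φ')) (∈-allFin y) (∈-product marks (near? φ') (marks-complete (vlookup φ y)) (near?-complete φ' (neighbours y G)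
          (≤-trans (pred-stars y φ' (vlookup φ) (lookup∘tabulate _)) stars)
          (≤-trans (neighbours-errors y G φ' (vlookup φ) (lookup∘tabulate _)) (err y y∈))))))
    where
    G' : Code n
    G' = remove y G
    φ' : Vec (Maybe Bool) n
    φ' = deleteAt y φ
    Y' : Pred n
    Y' = Y ∘ punchIn y
    Y'≥ : K ≤ # Y'
    Y'≥ = s≤s⁻¹ (≤-trans K≤ (≤-reflexive (trans (#-punchIn Y y) (cong (λ b → b2n b + # Y') y∈))))
    stars' : # (not ∘ isJust ∘ vlookup φ') ≤ s
    stars' = ≤-trans (≤-reflexive (sym (#stars-# φ'))) (≤-trans (pred-stars y φ' (vlookup φ) (lookup∘tabulate _)) stars)
    err' : ∀ z → Y' z ≡ true → # (errors (ofCode G') (vlookup φ') z) ≤ e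
    err' z p = ≤-trans (≤-trans (≤-reflexive (#-cong (λ w → cong₂ wrong (lookup∘tabulate _ w) (adj-remove y G z w)))) (#-restrict (errors (ofCode G) (vlookup φ) (punchIn y z)) y)) (err (punchIn y z) p)

  incompressible : ∀ {n} (G : Code n) R η ω K → Free T G → (∀ d → (η + R) * n ≤ R * η * d → n ≤ s + d) → (∀ x → ω * x ≤ n → x ≤ e) →
    ¬ (G ∈ firsts (listA K n)) → Incompressible (ofCode G) R η ω K
  incompressible {n} G R η ω K free hs he none φ Y big few = ≰⇒> λ K≤ → none (∈-firsts {L = listA K n} (listA-complete K n G free (vtabulate φ) Y K≤
      (≤-trans (≤-reflexive (#-cong (λ z → cong (not ∘ isJust) (lookup∘tabulate φ z)))) (+-cancelʳ-≤ (# (isJust ∘ φ)) _ _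
        (≤-trans (≤-reflexive (trans (+-comm _ (# (isJust ∘ φ))) (dom-stars φ))) (hs _ big))))
      (λ y q → ≤-trans (≤-reflexive (#-cong (λ z → cong (λ p → wrong p (adjB G y z)) (lookup∘tabulate φ z)))) (he _ (few y q)))))

  -- Graphs in which one vertex obeys a prediction determined by few other vertices.

  conditions : ∀ n → List (Maybe (Fin n × Bool))
  conditions n = nothing ∷ map just (pairs-with _&_ (allFin n) (λ _ → bits))

  conditions-complete : ∀ {n} c → c ∈ conditions n
  conditions-complete nothing = here refl
  conditions-complete (just (u , b)) = there (∈-map⁺ just (∈-product (allFin _) bits (∈-allFin u) (bits-complete b)))

  Index : ℕ → ℕ → Set
  Index k n = Fin (suc n) × Vec (Fin n) k × Vec (Fin n) k × Bool × Bool × Maybe (Fin n × Bool)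

  choices : ∀ n → List (Bool × Bool × Maybe (Fin n × Bool))
  choices n = pairs-with _&_ bits (λ _ → pairs-with _&_ bits (λ _ → conditions n))

  approximations : ∀ k n → List (Vec (Fin n) k × Vec (Fin n) k × Bool × Bool × Maybe (Fin n × Bool))
  approximations k n = pairs-with _&_ (vectors (allFin n) k) (λ _ → pairs-with _&_ (vectors (allFin n) k) (λ _ → choices n))

  indices : ∀ k n → List (Index k n)
  indices k n = pairs-with _&_ (allFin (suc n)) (λ _ → approximations k n)

  prediction : ∀ {k n} → Code n → Index k n → Vec (Maybe Bool) n
  prediction G (_ , X₁ , X₂ , β₁ , β₂ , c) = vtabulate (predictor (ofCode G) X₁ β₁ X₂ c β₂)

  buildB : ∀ {k n} → Code n → Index k n × Vec Bool n → Code (suc n)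
  buildB G (i , N) = restore (proj₁ i) G N

  listB : ∀ k n → List (Code (suc n))
  listB k n = pairs-with buildB (freeL n) (λ G → pairs-with _&_ (indices k n) (λ i → near? (prediction G i)))

  listB-length : ∀ x → 0 < x → ∀ k n t → n ≤ x * t →
    length (listB k n) ≤ length (freeL n) * (suc n * (n ^ k * (n ^ k * (2 * (2 * suc (n * 2))))) * 2 ^ (s + x * e + t))
  listB-length x x>0 k n t le = pairs-with-≤ buildB (freeL n) (λ G → pairs-with _&_ (indices k n) (λ i → near? (prediction G i))) _ (λ G → ≤-trans
      (pairs-with-≤ _&_ (indices k n) (λ i → near? (prediction G i)) (2 ^ (s + x * e + t)) (λ i → near?-length x x>0 (prediction G i) t le))
      (*-monoˡ-≤ (2 ^ (s + x * e + t)) count))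
    where
    conds : length (conditions n) ≤ suc (n * 2)
    conds = s≤s (≤-trans (≤-reflexive (length-map just (pairs-with _&_ (allFin n) (λ _ → bits))))
      (≤-trans (pairs-with-≤ _&_ (allFin n) (λ _ → bits) 2 (λ _ → ≤-refl)) (≤-reflexive (cong (_* 2) (allFin-length n)))))
    vecs : length (vectors (allFin n) k) ≤ n ^ k
    vecs = ≤-trans (vectors-length (allFin n) k) (≤-reflexive (cong (_^ k) (allFin-length n)))
    count : length (indices k n) ≤ suc n * (n ^ k * (n ^ k * (2 * (2 * suc (n * 2)))))
    count = product-length (allFin (suc n)) (approximations k n) (≤-reflexive (allFin-length (suc n)))
      (product-length (vectors (allFin n) k) (pairs-with _&_ (vectors (allFin n) k) (λ _ → choices n)) vecs
        (product-length (vectors (allFin n) k) (choices n) vecs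
          (product-length bits (pairs-with _&_ bits (λ _ → conditions n)) ≤-refl (product-length bits (conditions n) ≤-refl conds))))

  pull : ∀ {n k} (v : Fin (suc n)) (X : Vec (Fin (suc n)) k) → avoids v X → ∃ λ X' → vmap (punchIn v) X' ≡ X
  pull v [] _ = [] , refl
  pull v (x ∷ X) (d , ds) = let (X' , e) = pull v X ds in punchOut (λ e → d (sym e)) ∷ X' , cong₂ _∷_ (punchIn-punchOut (λ e → d (sym e))) e

  lift : ∀ {n} → Fin (suc n) → Maybe (Fin n × Bool) → Maybe (Fin (suc n) × Bool)
  lift v nothing = nothing
  lift v (just (u , b)) = just (punchIn v u , b)

  pull-c : ∀ {n} (v : Fin (suc n)) c → avoids-c v c → ∃ λ c' → lift v c' ≡ c
  pull-c v nothing _ = nothing , refl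
  pull-c v (just (u , b)) d = just (punchOut (λ e → d (sym e)) , b) , cong (λ u → just (u , b)) (punchIn-punchOut (λ e → d (sym e)))

  joined-remove : ∀ {n k} (v : Fin (suc n)) G (X : Vec (Fin n) k) z → joined (ofCode (remove v G)) X z ≡ joined (ofCode G) (vmap (punchIn v) X) (punchIn v z)
  joined-remove v G [] z = refl
  joined-remove v G (x ∷ X) z = cong₂ _∧_ (adj-remove v G x z) (joined-remove v G X z)

  restricted-remove : ∀ {n} (v : Fin (suc n)) G c z → restricted (ofCode (remove v G)) c z ≡ restricted (ofCode G) (lift v c) (punchIn v z)
  restricted-remove v G nothing z = refl
  restricted-remove v G (just (u , b)) z = cong (λ e → ⌊ e ≟B b ⌋) (adj-remove v G u z)

  predictor-remove : ∀ {n k} (v : Fin (suc n)) G (X₁ X₂ : Vec (Fin n) k) β₁ c β₂ z → predictor (ofCode (remove v G)) X₁ β₁ X₂ c β₂ z ≡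
    predictor (ofCode G) (vmap (punchIn v) X₁) β₁ (vmap (punchIn v) X₂) (lift v c) β₂ (punchIn v z)
  predictor-remove v G X₁ X₂ β₁ c β₂ z = cong₂ (λ a b → if a then just β₁ else (if b then just β₂ else nothing)) (joined-remove v G X₁ z)
    (cong₂ _∧_ (joined-remove v G X₂ z) (restricted-remove v G c z))

  unpredictable : ∀ {n} (G : Code (suc n)) R η ω k → Free T G → (∀ d → (η + R) * suc n ≤ R * η * d → suc n ≤ s + d) → (∀ x → ω * x ≤ suc n → x ≤ e) →
    ¬ (G ∈ listB k n) → Unpredictable (ofCode G) R η ω k
  unpredictable {n} G R η ω k free hs he none v X₁ X₂ β₁ β₂ c a₁ a₂ ac big few with pull v X₁ a₁ | pull v X₂ a₂ | pull-c v c ac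
  ... | X₁' , refl | X₂' , refl | c' , refl = none (subst (_∈ listB k n) (restore-remove v G)
      (∈-pairs-with buildB {freeL n} {λ G → pairs-with _&_ (indices k n) (λ i → near? (prediction G i))} {remove v G} {i , neighbours v G}
        (∈-freeL (remove-free T G v free))
        (∈-pairs-with _&_ {indices k n} {λ i → near? (prediction (remove v G) i)} {i} {neighbours v G} i∈ (near?-complete φ' (neighbours v G)
          (≤-trans (pred-stars v φ' ψ same) (+-cancelʳ-≤ (# (isJust ∘ ψ)) _ _ (≤-trans (≤-reflexive (trans (+-comm _ (# (isJust ∘ ψ))) (dom-stars ψ))) (hs _ big))))
          (≤-trans (neighbours-errors v G φ' ψ same) (he _ few))))))
    where
    i : Index k n
    i = v , X₁' , X₂' , β₁ , β₂ , c'
    i∈ : i ∈ indices k n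
    i∈ = ∈-product (allFin (suc n)) (approximations k n) (∈-allFin v)
      (∈-product (vectors (allFin n) k) (pairs-with _&_ (vectors (allFin n) k) (λ _ → choices n)) (vectors-complete ∈-allFin X₁')
        (∈-product (vectors (allFin n) k) (choices n) (vectors-complete ∈-allFin X₂')
          (∈-product bits (pairs-with _&_ bits (λ _ → conditions n)) (bits-complete β₁) (∈-product bits (conditions n) (bits-complete β₂) (conditions-complete c')))))
    ψ : Fin (suc n) → Maybe Bool
    ψ = predictor (ofCode G) (vmap (punchIn v) X₁') β₁ (vmap (punchIn v) X₂') (lift v c') β₂
    φ' : Vec (Maybe Bool) n
    φ' = prediction (remove v G) i
    same : ∀ z → vlookup φ' z ≡ ψ (punchIn v z)
    same z = trans (lookup∘tabulate _ z) (predictor-remove v G X₁' X₂' β₁ c' β₂ z)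

-- Asymptotics of the bounds

exponential : ∀ a L → 4 * a ≤ L → a * suc L ≤ 2 ^ L
exponential a L le = subst (λ L → a * suc L ≤ 2 ^ L) (trans (+-comm (L ∸ 4 * a) (4 * a)) (m+[n∸m]≡n le)) (climb (L ∸ 4 * a))
  where
  open ≤-Reasoning
  base : a * suc (4 * a) ≤ 2 ^ (4 * a)
  base = begin
    a * suc (4 * a)  ≤⟨ certify (suc (3 * a)) (≤-refl {0}) (re a) ⟩
    suc (2 * a) * suc (2 * a)  ≤⟨ *-mono-≤ (k<2^k (2 * a)) (k<2^k (2 * a)) ⟩
    2 ^ (2 * a) * 2 ^ (2 * a)  ≡⟨ trans (sym (^-distribˡ-+-* 2 (2 * a) (2 * a))) (cong (2 ^_) (re₂ a)) ⟩
    2 ^ (4 * a) ∎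
    where
    re : ∀ a → a * suc (4 * a) + 0 + suc (3 * a) ≡ suc (2 * a) * suc (2 * a) + 0
    re = solve-∀
    re₂ : ∀ a → 2 * a + 2 * a ≡ 4 * a
    re₂ = solve-∀
  climb : ∀ d → a * suc (d + 4 * a) ≤ 2 ^ (d + 4 * a)
  climb zero = base
  climb (suc d) = certify (a * (d + 4 * a)) (2 ⊗ climb d) (re a (d + 4 * a) (2 ^ (d + 4 * a)))
    where
    re : ∀ a l p → a * suc (suc l) + 2 * p + a * l ≡ 2 * p + 2 * (a * suc l)
    re = solve-∀

m*n/m≡n : ∀ m n .⦃ _ : NonZero m ⦄ → m * n / m ≡ n
m*n/m≡n m n = trans (cong (_/ m) (*-comm m n)) (m*n/n≡m n m)

-- A substitute for the logarithm: all that matters about `L` is that `2 ^ L` bounds `3 * n` while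
-- `Z * L` is at most `n`.
logarithm : ∀ Z → 0 < Z → ∀ n → Z * (4 * (3 * Z)) ≤ n → ∃ λ L → 3 * n ≤ 2 ^ L × Z * L ≤ n
logarithm Z Z>0 n large = L , ≤-trans (3 ⊗ <⇒≤ upper) (≤-trans (≤-reflexive (sym (*-assoc 3 Z (suc L)))) (exponential (3 * Z) L L≥)) , ≤-trans (≤-reflexive (*-comm Z L)) (m/n*n≤m n Z)
  where
  instance
    Z≢0 : NonZero Z
    Z≢0 = >-nonZero Z>0
  L : ℕ
  L = n / Z
  L≥ : 4 * (3 * Z) ≤ L
  L≥ = ≤-trans (≤-reflexive (sym (m*n/m≡n Z (4 * (3 * Z))))) (/-mono-≤ large (≤-refl {Z}))
  upper : n < Z * suc L
  upper = ≤-trans (s≤s (≤-reflexive (m≡m%n+[m/n]*n n Z))) (≤-trans (+-monoˡ-≤ (L * Z) (m%n<n n Z)) (≤-reflexive (re Z L)))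
    where
    re : ∀ z l → z + l * z ≡ z * suc l
    re = solve-∀

below-quotient : ∀ n x .⦃ _ : NonZero x ⦄ → n ≤ x * (n / x) + x
below-quotient n x = ≤-trans (≤-reflexive (m≡m%n+[m/n]*n n x)) (≤-trans (<⇒≤ (m%n<n n x) ⊕ ≤-refl) (≤-reflexive (trans (+-comm x _) (cong (_+ x) (*-comm (n / x) x)))))

below : ∀ n x .⦃ _ : NonZero x ⦄ → x * (n / x) ≤ n
below n x = ≤-trans (≤-reflexive (*-comm x _)) (m/n*n≤m n x)

3^≤ : ∀ n → 3 ^ n ≤ 2 ^ (2 * n)
3^≤ n = ≤-trans (^-monoˡ-≤ n (n≤1+n 3)) (≤-reflexive (^-*-assoc 2 2 n))

-- With `x = 8 * η` these are `x * x` and `2 * x`. Correcting the errors then costs about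
-- `2n/x = n/(4η)` bits per vertex out of the `n/η` saved, and `K = 16 * η` vertices together save
-- about `12n` bits, more than an arbitrary prediction costs.
ωOf KOf : ℕ → ℕ
ωOf η = 8 * η * (8 * η)
KOf η = 2 * (8 * η)

module Rare (R : ℕ) (R≥2 : 2 ≤ R) (n h : ℕ) where

  η x ω K : ℕ
  η = suc (suc h)
  x = 8 * η
  ω = ωOf η
  K = KOf η

  instance
    R≢0 : NonZero R
    R≢0 = >-nonZero (≤-trans (s≤s z≤n) R≥2)

  g D s e t : ℕ
  g = n / η
  D = n / R + g
  s = n ∸ D
  e = n / ω
  t = suc (n / x)

  n≤xt : n ≤ x * t
  n≤xt = ≤-trans (below-quotient n x) (≤-reflexive (trans (+-comm _ x) (sym (*-suc x (n / x)))))

  half : ∀ q → 2 ≤ q → .⦃ _ : NonZero q ⦄ → 2 * (n / q) ≤ n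
  half q p = ≤-trans (*-monoˡ-≤ (n / q) p) (below n q)

  D≤n : D ≤ n
  D≤n = *-cancelˡ-≤ 2 (certify 0 (half R R≥2 ⊕ half η (s≤s (s≤s z≤n))) (re (n / R) g n))
    where
    re : ∀ a b n → 2 * (a + b) + (n + n) + 0 ≡ 2 * n + (2 * a + 2 * b)
    re = solve-∀

  s+D : s + D ≡ n
  s+D = m∸n+n≡m D≤n

  domain : ∀ d → (η + R) * n ≤ R * η * d → n ≤ s + d
  domain d p = ≤-trans (≤-reflexive (sym s+D)) (+-monoʳ-≤ s (*-cancelˡ-≤ (R * η) ⦃ >-nonZero (*-mono-≤ {1} {R} {1} (≤-trans (s≤s z≤n) R≥2) (s≤s z≤n)) ⦄
    (≤-trans (certify 0 ((η ⊗ below n R) ⊕ (R ⊗ below n η)) (re R η n (n / R) g)) p)))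
    where
    re : ∀ R η n a b → R * η * (a + b) + (η * n + R * n) + 0 ≡ (η + R) * n + (η * (R * a) + R * (η * b))
    re = solve-∀

  few : ∀ y → ω * y ≤ n → y ≤ e
  few y p = ≤-trans (≤-reflexive (sym (m*n/m≡n ω y))) (/-mono-≤ p (≤-refl {ω}))

  x[xe+t] : x * (x * e + t) ≤ 2 * n + x
  x[xe+t] = certify 0 (below n ω ⊕ below n x) (re x n e (n / x))
    where
    re : ∀ x n e q → x * (x * e + suc q) + (n + n) + 0 ≡ 2 * n + x + (x * x * e + x * q)
    re = solve-∀

  8n≤ : 8 * n ≤ x * g + x
  8n≤ = ≤-trans (8 ⊗ below-quotient n η) (≤-reflexive (re η g))
    where
    re : ∀ η g → 8 * (η * g + η) ≡ 8 * η * g + 8 * η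
    re = solve-∀

  boundA : ∀ C Γ L (f c : ℕ → ℕ) → (∀ p q → q + (p + K) / R ≤ p → c p * 2 ^ (K * q) ≤ c (p + K)) → f (n ∸ K) ≤ C * c (n ∸ K) →
    Γ ≤ n → 3 * n ≤ 2 ^ L → K * L ≤ n → K * K + 4 * x ≤ n →
    2 ^ Γ * (f (n ∸ K) * 3 ^ n * (n * (3 * 2 ^ (s + x * e + t))) ^ K) ≤ C * c n
  boundA C Γ L f c grow fc Γ≤n L≥ KL≤n big = begin
    2 ^ Γ * (f p * 3 ^ n * (n * (3 * M)) ^ K)  ≤⟨ 2 ^ Γ ⊗ *-mono-≤ (*-mono-≤ fc (3^≤ n)) (^-monoˡ-≤ K (≤-trans (≤-reflexive (re₁ n M)) (*-monoˡ-≤ M L≥))) ⟩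
    2 ^ Γ * (C * c p * 2 ^ (2 * n) * (2 ^ L * M) ^ K)  ≡⟨ cong (λ z → 2 ^ Γ * (C * c p * 2 ^ (2 * n) * z)) (trans (cong (_^ K) (sym (^-distribˡ-+-* 2 L S))) (trans (^-*-assoc 2 (L + S) K) (cong (2 ^_) (*-comm (L + S) K)))) ⟩
    2 ^ Γ * (C * c p * 2 ^ (2 * n) * 2 ^ (K * (L + S)))  ≡⟨ re₂ (2 ^ Γ) (C * c p) (2 ^ (2 * n)) (2 ^ (K * (L + S))) ⟩
    C * c p * (2 ^ Γ * 2 ^ (2 * n) * 2 ^ (K * (L + S)))  ≡⟨ cong (C * c p *_) (trans (cong (_* 2 ^ (K * (L + S))) (sym (^-distribˡ-+-* 2 Γ (2 * n)))) (sym (^-distribˡ-+-* 2 (Γ + 2 * n) (K * (L + S))))) ⟩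
    C * c p * 2 ^ (Γ + 2 * n + K * (L + S))  ≤⟨ C * c p ⊗ ^-monoʳ-≤ 2 exponents ⟩
    C * c p * 2 ^ (K * q)  ≡⟨ *-assoc C (c p) _ ⟩
    C * (c p * 2 ^ (K * q))  ≤⟨ C ⊗ grow p q (≤-reflexive (trans (cong (λ z → q + z / R) p+K) q+)) ⟩
    C * c (p + K)  ≡⟨ cong (λ z → C * c z) p+K ⟩
    C * c n ∎
    where
    open ≤-Reasoning
    p q S M : ℕ
    p = n ∸ K
    q = p ∸ n / R
    S = s + x * e + t
    M = 2 ^ S
    re₁ : ∀ n m → n * (3 * m) ≡ 3 * n * m
    re₁ = solve-∀
    re₂ : ∀ a b c d → a * (b * c * d) ≡ b * (a * c * d)
    re₂ = solve-∀
    2K≤n : 2 * K ≤ n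
    2K≤n = ≤-trans (≤-trans (≤-reflexive (re η)) (m≤n+m (4 * x) (K * K))) big
      where
      re : ∀ η → 2 * (2 * (8 * η)) ≡ 4 * (8 * η)
      re = solve-∀
    K≤n : K ≤ n
    K≤n = ≤-trans (m≤m+n K _) 2K≤n
    p+K : p + K ≡ n
    p+K = m∸n+n≡m K≤n
    n/R≤p : n / R ≤ p
    n/R≤p = *-cancelˡ-≤ 2 (certify 0 (half R R≥2 ⊕ 2K≤n ⊕ ≤-reflexive (cong (2 *_) (sym p+K))) (re (n / R) n K p))
      where
      re : ∀ a n K p → 2 * a + (n + n + 2 * (p + K)) + 0 ≡ 2 * p + (2 * a + 2 * K + 2 * n)
      re = solve-∀
    q+ : q + n / R ≡ p
    q+ = m∸n+n≡m n/R≤p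
    s+g : s + g ≡ q + K
    s+g = +-cancelʳ-≡ (n / R) (s + g) (q + K) (trans (re s g (n / R)) (trans s+D (trans (sym p+K) (trans (cong (_+ K) (sym q+)) (re₃ q (n / R) K)))))
      where
      re : ∀ s g a → s + g + a ≡ s + (a + g)
      re = solve-∀
      re₃ : ∀ q a K → q + a + K ≡ q + K + a
      re₃ = solve-∀
    -- The right-hand side is the growth of the partitionable graphs over `K` steps. The surplus
    -- `K * g` is about `16n`, against `2n` for the prediction, `4n` for the errors and at most `n`
    -- each for `K * L`, for `Γ` and for the lower-order terms; this leaves the slack `7n`.
    exponents : Γ + 2 * n + K * (L + S) ≤ K * q
    exponents = certify (7 * n) ((K ⊗ ≤-reflexive s+g) ⊕ (2 ⊗ 8n≤) ⊕ (2 ⊗ x[xe+t]) ⊕ KL≤n ⊕ Γ≤n ⊕ big)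
      (re Γ n x L s e t q g)
      where
      re : ∀ Γ n x L s e t q g → Γ + 2 * n + 2 * x * (L + (s + x * e + t)) + (2 * x * (q + 2 * x) + 2 * (x * g + x) + 2 * (2 * n + x) + n + n + n) + 7 * n
        ≡ 2 * x * q + (2 * x * (s + g) + 2 * (8 * n) + 2 * (x * (x * e + t)) + 2 * x * L + Γ + (2 * x * (2 * x) + 4 * x))
      re = solve-∀

  -- The description of the prediction contributes a polynomial factor only, at most
  -- `2 ^ (L * (2 * k + 4))`, so the bits saved at a single vertex are enough.
  boundB : ∀ C Γ L k p (f c : ℕ → ℕ) → suc p ≡ n → (∀ p j → j + p / R ≤ p → c p * 2 ^ j ≤ c (suc p)) → f p ≤ C * c p →
    x * Γ ≤ n → 3 * n ≤ 2 ^ L → x * (2 * k + 4) * L ≤ n → 4 * x ≤ n →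
    2 ^ Γ * (f p * (suc p * (p ^ k * (p ^ k * (2 * (2 * suc (p * 2))))) * 2 ^ (s + x * e + t))) ≤ C * c n
  boundB C Γ L k p f c refl grow fc xΓ≤n L≥ ZL≤n big = begin
    2 ^ Γ * (f p * (poly * M))  ≤⟨ 2 ^ Γ ⊗ *-mono-≤ fc (*-monoˡ-≤ M poly≤) ⟩
    2 ^ Γ * (C * c p * (2 ^ (L * (2 * k + 4)) * M))  ≡⟨ re₂ (2 ^ Γ) (C * c p) (2 ^ (L * (2 * k + 4))) M ⟩
    C * c p * (2 ^ Γ * 2 ^ (L * (2 * k + 4)) * M)  ≡⟨ cong (C * c p *_) (trans (cong (_* M) (sym (^-distribˡ-+-* 2 Γ (L * (2 * k + 4))))) (sym (^-distribˡ-+-* 2 (Γ + L * (2 * k + 4)) S))) ⟩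
    C * c p * 2 ^ (Γ + L * (2 * k + 4) + S)  ≤⟨ C * c p ⊗ ^-monoʳ-≤ 2 exponents ⟩
    C * c p * 2 ^ j  ≡⟨ *-assoc C (c p) _ ⟩
    C * (c p * 2 ^ j)  ≤⟨ C ⊗ grow p j (≤-reflexive j+) ⟩
    C * c (suc p) ∎
    where
    open ≤-Reasoning
    poly j S M : ℕ
    poly = suc p * (p ^ k * (p ^ k * (2 * (2 * suc (p * 2)))))
    j = p ∸ p / R
    S = s + x * e + t
    M = 2 ^ S
    re₂ : ∀ a b c d → a * (b * (c * d)) ≡ b * (a * c * d)
    re₂ = solve-∀
    j+ : j + p / R ≡ p
    j+ = m∸n+n≡m (m/n≤m p R)
    P : ℕ
    P = 2 ^ L
    n≤P : suc p ≤ P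
    n≤P = ≤-trans (m≤n*m (suc p) 3) L≥
    p≤P : p ≤ P
    p≤P = ≤-trans (n≤1+n p) n≤P
    2≤P : 2 ≤ P
    2≤P = ≤-trans (≤-trans (s≤s (s≤s z≤n)) (3 ⊗ s≤s (z≤n {p}))) L≥
    last≤P : suc (p * 2) ≤ P
    last≤P = ≤-trans (≤-trans (s≤s (≤-trans (m≤m+n (p * 2) (p + 2)) ≤-refl)) (≤-reflexive (re p))) L≥
      where
      re : ∀ p → suc (p * 2 + (p + 2)) ≡ 3 * suc p
      re = solve-∀
    poly≤ : poly ≤ 2 ^ (L * (2 * k + 4))
    poly≤ = begin
      poly  ≤⟨ *-mono-≤ n≤P (*-mono-≤ (^-monoˡ-≤ k p≤P) (*-mono-≤ (^-monoˡ-≤ k p≤P) (*-mono-≤ 2≤P (*-mono-≤ 2≤P last≤P)))) ⟩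
      P * (P ^ k * (P ^ k * (P * (P * P))))  ≡⟨ re P (P ^ k) ⟩
      P ^ k * (P ^ k) * (P * (P * (P * (P * 1))))  ≡⟨ cong (_* P ^ 4) (trans (sym (^-distribˡ-+-* P k k)) (cong (P ^_) (cong (k +_) (sym (+-identityʳ k))))) ⟩
      P ^ (2 * k) * P ^ 4  ≡⟨ sym (^-distribˡ-+-* P (2 * k) 4) ⟩
      P ^ (2 * k + 4)  ≡⟨ ^-*-assoc 2 L (2 * k + 4) ⟩
      2 ^ (L * (2 * k + 4)) ∎
      where
      re : ∀ P Q → P * (Q * (Q * (P * (P * P)))) ≡ Q * Q * (P * (P * (P * (P * 1))))
      re = solve-∀
    s+g≤ : s + g ≤ suc j
    s+g≤ = +-cancelʳ-≤ (n / R) _ _ (begin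
      s + g + n / R  ≡⟨ re s g (n / R) ⟩
      s + D  ≡⟨ s+D ⟩
      suc p  ≡⟨ cong suc (sym j+) ⟩
      suc j + p / R  ≤⟨ +-monoʳ-≤ (suc j) (/-mono-≤ (n≤1+n p) (≤-refl {R})) ⟩
      suc j + n / R ∎)
      where
      re : ∀ s g a → s + g + a ≡ s + (a + g)
      re = solve-∀
    exponents : Γ + L * (2 * k + 4) + S ≤ j
    exponents = *-cancelˡ-≤ x (certify (x + 3 * n) ((x ⊗ s+g≤) ⊕ 8n≤ ⊕ x[xe+t] ⊕ ZL≤n ⊕ xΓ≤n ⊕ big) (re Γ n x L s e t j g k))
      where
      re : ∀ Γ n x L s e t j g k → x * (Γ + L * (2 * k + 4) + (s + x * e + t)) + (x * suc j + (x * g + x) + (2 * n + x) + n + n + n) + (x + 3 * n)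
        ≡ x * j + (x * (s + g) + 8 * n + x * (x * e + t) + x * (2 * k + 4) * L + x * Γ + 4 * x)
      re = solve-∀

-- Assembly: induction on the number of vertices

module Assembly {m r : ℕ} (T : Code m) (isTree : IsTree T) (stab : IsStabilityNumber T (suc (suc (suc r))))
  (noPM : ¬ HasPerfectMatching T) (noSS : ¬ IsSubdividedStar T) where

  R : ℕ
  R = suc (suc r)

  open TreeShapes T isTree stab noPM noSS using (shapes; bipartition)
  open SecondConstants m (suc r) ωOf KOf using (θ; H; k₀; secondN; ρ; k₀≤θ; k₀-def; first≤H)

  η₁ first : ℕ
  η₁ = θ * (4 * suc r * R)
  first = FirstConstants.firstN m (suc r) (ωOf η₁) (KOf η₁) θ

  R≤θ : R ≤ θ
  R≤θ = ≤-trans (≤-trans (≤-trans (m≤n*m R 16) (16 ⊗ ≤-trans (m≤m+n R (R + 0)) (m≤m+n (2 * R) ρ))) (m≤m*n (16 * (2 * R + ρ)) k₀ ⦃ >-nonZero (subst (0 <_) (sym k₀-def) (s≤s z≤n)) ⦄)) k₀≤θ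

  η₁>0 : 0 < η₁
  η₁>0 = *-mono-≤ (≤-trans (s≤s z≤n) R≤θ) (*-mono-≤ {1} {4 * suc r} {1} (s≤s z≤n) (s≤s z≤n))

  8η₁>0 : 0 < 8 * η₁
  8η₁>0 = ≤-trans η₁>0 (m≤n*m η₁ 8)

  structure : ∀ {n} (G : Graph n) → ¬ Contains (ofCode T) G → secondN ≤ n → first ≤ n →
    (∀ η → η ≤ H → Incompressible G R η (ωOf η) (KOf η)) → (∀ η → η ≤ H → Unpredictable G R η (ωOf η) k₀) →
    ((Σ (Fin n → Fin R) λ part → ∀ u v → part u ≡ part v → u ≢ v → E G u v ≡ true) → ⊥) → ⊥
  structure G free large₂ large₁ inc unp fail =
    FirstPartition.first (ofCode T) G free (proj₁ shapes) (proj₁ (proj₂ shapes)) (proj₂ (proj₂ shapes)) bipartition (ωOf η₁) (KOf η₁) θ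
      (*-mono-≤ 8η₁>0 8η₁>0) (≤-trans 8η₁>0 (m≤m+n _ _)) (s≤s z≤n) R≤θ
      (subst (λ η → Incompressible G R η (ωOf η₁) (KOf η₁)) (sym (FirstConstants.η-def m (suc r) (ωOf η₁) (KOf η₁) θ)) (inc η₁ first≤H)) large₁
      (λ NC → fail (SecondPartition.cliques (ofCode T) G free (proj₁ shapes) (proj₁ (proj₂ shapes)) (s≤s z≤n) ωOf KOf inc unp large₂ NC))

  open Growth R (s≤s z≤n)

  freeL badL : ∀ n → List (Code n)
  freeL n = filter (free? T) (codes n)
  badL n = filter (λ G → free? T G ×-dec ¬? (cliquePartition? R G)) (codes n)

  free-unique : ∀ n → Unique (freeL n)
  free-unique n = Unique-filter⁺ (free? T) (codes-unique n)

  f c b : ℕ → ℕ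
  f n = length (freeL n)
  c n = length (goodL n)
  b n = length (badL n)

  c≤f : ∀ n → c n ≤ f n
  c≤f n = Unique-⊆-length (goodL-unique n) (λ {G} p → ∈-filter⁺ (free? T) (codes-complete G) (good⇒free T G (proj₁ stab') (proj₂ (∈-filter⁻ (cliquePartition? R) {xs = codes n} p))))
    where
    stab' : IsStabilityNumber T (suc R)
    stab' = stab

  f≤c+b : ∀ n → f n ≤ c n + b n
  f≤c+b n = ≤-trans (Unique-⊆-length (free-unique n) sort) (≤-reflexive (length-++ (goodL n)))
    where
    decide : ∀ G → Free T G → Dec (CliquePartition G R) → G ∈ goodL n ++ badL n
    decide G free (yes p) = ∈-++⁺ˡ (∈-goodL p)
    decide G free (no p) = ∈-++⁺ʳ (goodL n) (∈-filter⁺ (λ G → free? T G ×-dec ¬? (cliquePartition? R G)) (codes-complete G) (free , p))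
    sort : ∀ {G} → G ∈ freeL n → G ∈ goodL n ++ badL n
    sort {G} p = decide G (proj₂ (∈-filter⁻ (free? T) {xs = codes n} p)) (cliquePartition? R G)

  R≥2 : 2 ≤ R
  R≥2 = s≤s (s≤s z≤n)

  sOf eOf : ℕ → ℕ → ℕ
  sOf n h = Rare.s R R≥2 n h
  eOf n h = Rare.e R R≥2 n h

  blockA blockB : ∀ p → ℕ → List (Code (suc p))
  blockA p h = firsts (Decode.listA T (sOf (suc p) h) (eOf (suc p) h) (KOf (suc (suc h))) (suc p))
  blockB p h = Decode.listB T (sOf (suc p) h) (eOf (suc p) h) k₀ p

  lists : ∀ p → ℕ → List (Code (suc p))
  lists p zero = []
  lists p (suc h) = (blockA p h ++ blockB p h) ++ lists p h

  ∈-lists : ∀ {p G} l h → h < l → G ∈ blockA p h ++ blockB p h → G ∈ lists p l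
  ∈-lists {p} (suc l) h (s≤s h≤l) q with m≤n⇒m<n∨m≡n h≤l
  ... | inj₁ lt = ∈-++⁺ʳ (blockA p l ++ blockB p l) (∈-lists l h lt q)
  ... | inj₂ refl = ∈-++⁺ˡ q

  -- For `η ≤ 1` no domain is large enough, so both incompressibility conditions hold vacuously and
  -- the lists may start with `η = 2`; there `h` stands for `η = h + 2`.
  too-long : ∀ {n} η d → η ≤ 1 → 0 < n → d ≤ n → (η + R) * n ≤ R * η * d → ⊥
  too-long {n} zero d _ n>0 _ p = <⇒≱ (*-mono-≤ {1} {R} {1} (s≤s z≤n) n>0) (≤-trans p (≤-reflexive (cong (_* d) (*-zeroʳ R))))
  too-long {n} (suc zero) d _ n>0 d≤n p = <⇒≱ (m<n+m (R * n) n>0) (≤-trans p (≤-trans (≤-reflexive (cong (_* d) (*-identityʳ R))) (R ⊗ d≤n)))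
  too-long (suc (suc _)) d (s≤s ()) _ _ _

  bad-listed : ∀ p (G : Code (suc p)) → secondN ≤ suc p → first ≤ suc p → Free T G → ¬ CliquePartition G R → G ∈ lists p H
  bad-listed p G large₂ large₁ free bad with AnyM.any? (Code-≟ G) (lists p H)
  ... | yes q = q
  ... | no none = ⊥-elim (structure (ofCode G) (free⇒ T G free) large₂ large₁ inc unp (λ { (part , h) → bad (part , h) }))
    where
    inc : ∀ η → η ≤ H → Incompressible (ofCode G) R η (ωOf η) (KOf η)
    inc zero _ φ Y big _ = ⊥-elim (too-long {suc p} 0 _ z≤n (s≤s z≤n) (#≤n (isJust ∘ φ)) big)
    inc (suc zero) _ φ Y big _ = ⊥-elim (too-long {suc p} 1 _ (s≤s z≤n) (s≤s z≤n) (#≤n (isJust ∘ φ)) big)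
    inc (suc (suc h)) le φ Y = Decode.incompressible T (sOf (suc p) h) (eOf (suc p) h) G R (suc (suc h)) (ωOf (suc (suc h))) (KOf (suc (suc h))) free
      (Rare.domain R R≥2 (suc p) h) (Rare.few R R≥2 (suc p) h) (λ q → none (∈-lists H h (≤-trans (n≤1+n (suc h)) le) (∈-++⁺ˡ q))) φ Y
    unp : ∀ η → η ≤ H → Unpredictable (ofCode G) R η (ωOf η) k₀
    unp zero _ v X₁ X₂ β₁ β₂ c₀ _ _ _ big _ = too-long {suc p} 0 _ z≤n (s≤s z≤n) (#≤n (isJust ∘ predictor (ofCode G) X₁ β₁ X₂ c₀ β₂)) big
    unp (suc zero) _ v X₁ X₂ β₁ β₂ c₀ _ _ _ big _ = too-long {suc p} 1 _ (s≤s z≤n) (s≤s z≤n) (#≤n (isJust ∘ predictor (ofCode G) X₁ β₁ X₂ c₀ β₂)) big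
    unp (suc (suc h)) le v X₁ X₂ β₁ β₂ c₀ = Decode.unpredictable T (sOf (suc p) h) (eOf (suc p) h) G R (suc (suc h)) (ωOf (suc (suc h))) k₀ free
      (Rare.domain R R≥2 (suc p) h) (Rare.few R R≥2 (suc p) h) (λ q → none (∈-lists H h (≤-trans (n≤1+n (suc h)) le) (∈-++⁺ʳ (blockA p h) q))) v X₁ X₂ β₁ β₂ c₀

  top Z : ℕ
  top = suc H
  Z = 2 * (8 * top) * (2 * k₀ + 4)

  Γ : ℕ → ℕ
  Γ n = n / (8 * top)

  record Large (n : ℕ) : Set where
    field
      second≤ : secondN ≤ n
      first≤ : first ≤ n
      Z≤ : Z * (4 * (3 * Z)) ≤ n
      top≤ : KOf top * KOf top + 4 * (8 * top) ≤ n

  opaque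
    largeN : ℕ
    largeN = suc (secondN + first + Z * (4 * (3 * Z)) + (KOf top * KOf top + 4 * (8 * top)))

    largeN>0 : 0 < largeN
    largeN>0 = s≤s z≤n

    large : ∀ {n} → largeN ≤ n → Large n
    large le = record
      { second≤ = ≤-trans (≤-trans (≤-trans (m≤m+n secondN first) (m≤m+n _ (Z * (4 * (3 * Z))))) (≤-trans (m≤m+n _ (KOf top * KOf top + 4 * (8 * top))) (n≤1+n _))) le
      ; first≤ = ≤-trans (≤-trans (≤-trans (m≤n+m first secondN) (m≤m+n _ (Z * (4 * (3 * Z))))) (≤-trans (m≤m+n _ (KOf top * KOf top + 4 * (8 * top))) (n≤1+n _))) le
      ; Z≤ = ≤-trans (≤-trans (m≤n+m (Z * (4 * (3 * Z))) (secondN + first)) (≤-trans (m≤m+n _ (KOf top * KOf top + 4 * (8 * top))) (n≤1+n _))) le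
      ; top≤ = ≤-trans (≤-trans (m≤n+m (KOf top * KOf top + 4 * (8 * top)) (secondN + first + Z * (4 * (3 * Z)))) (n≤1+n _)) le }

  Z>0 : 0 < Z
  Z>0 = *-mono-≤ {1} {2 * (8 * top)} {1} (s≤s z≤n) (≤-trans (s≤s z≤n) (m≤n+m 4 (2 * k₀)))

  module Step (C p : ℕ) (le : largeN ≤ suc p) (ih : ∀ j → j < suc p → f j ≤ C * c j) where
    open Large (large le)

    n : ℕ
    n = suc p

    block-bound : ∀ h → h < H → 2 ^ Γ n * length (blockA p h ++ blockB p h) ≤ 2 * (C * c n)
    block-bound h h<H = begin
      2 ^ Γ n * length (blockA p h ++ blockB p h)  ≡⟨ cong (2 ^ Γ n *_) (trans (length-++ (blockA p h)) (cong (_+ length (blockB p h)) (firsts-length LA))) ⟩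
      2 ^ Γ n * (length LA + length (blockB p h))  ≡⟨ *-distribˡ-+ (2 ^ Γ n) _ _ ⟩
      2 ^ Γ n * length LA + 2 ^ Γ n * length (blockB p h)  ≤⟨ A ⊕ B ⟩
      C * c n + C * c n  ≡⟨ cong (C * c n +_) (sym (+-identityʳ _)) ⟩
      2 * (C * c n) ∎
      where
      open ≤-Reasoning
      open Rare R R≥2 n h using (η; x; K; s; e; t; n≤xt; boundA; boundB)
      LA : List (Code n × Vec (Maybe Bool) n)
      LA = Decode.listA T s e K n
      η≤top : η ≤ top
      η≤top = s≤s h<H
      x≤ : x ≤ 8 * top
      x≤ = 8 ⊗ η≤top
      K≤ : K ≤ KOf top
      K≤ = 2 ⊗ x≤
      factor>0 : 0 < 2 * k₀ + 4
      factor>0 = ≤-trans (s≤s z≤n) (m≤n+m 4 (2 * k₀))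
      K≤Z : K ≤ Z
      K≤Z = ≤-trans K≤ (m≤m*n (2 * (8 * top)) (2 * k₀ + 4) ⦃ >-nonZero factor>0 ⦄)
      x≤Z : x * (2 * k₀ + 4) ≤ Z
      x≤Z = *-monoˡ-≤ (2 * k₀ + 4) (≤-trans x≤ (m≤n*m (8 * top) 2))
      L : ℕ
      L = proj₁ (logarithm Z Z>0 n Z≤)
      L≥ : 3 * n ≤ 2 ^ L
      L≥ = proj₁ (proj₂ (logarithm Z Z>0 n Z≤))
      ZL≤n : Z * L ≤ n
      ZL≤n = proj₂ (proj₂ (logarithm Z Z>0 n Z≤))
      small : K * K + 4 * x ≤ n
      small = ≤-trans (*-mono-≤ K≤ K≤ ⊕ (4 ⊗ x≤)) top≤
      A : 2 ^ Γ n * length LA ≤ C * c n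
      A = ≤-trans (2 ^ Γ n ⊗ Decode.listA-length T s e x (s≤s z≤n) n t n≤xt K n ≤-refl)
        (boundA C (Γ n) L f c (growths K) (ih (n ∸ K) (∸-monoʳ-< {n} {K} {0} (s≤s z≤n) (≤-trans (≤-trans (m≤m*n K K) (m≤m+n (K * K) (4 * x))) small)))
          (m/n≤m n (8 * top)) L≥ (≤-trans (*-monoˡ-≤ L K≤Z) ZL≤n) small)
      B : 2 ^ Γ n * length (blockB p h) ≤ C * c n
      B = ≤-trans (2 ^ Γ n ⊗ Decode.listB-length T s e x (s≤s z≤n) k₀ p t (≤-trans (n≤1+n p) n≤xt))
        (boundB C (Γ n) L k₀ p f c refl growth (ih p ≤-refl) (≤-trans (*-monoˡ-≤ (Γ n) x≤) (below n (8 * top))) L≥ (≤-trans (*-monoˡ-≤ L x≤Z) ZL≤n) (≤-trans (m≤n+m (4 * x) (K * K)) small))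

    lists-bound : ∀ l → l ≤ H → 2 ^ Γ n * length (lists p l) ≤ l * (2 * (C * c n))
    lists-bound zero _ = ≤-reflexive (*-zeroʳ (2 ^ Γ n))
    lists-bound (suc l) l<H = ≤-trans (≤-reflexive (trans (cong (2 ^ Γ n *_) (length-++ (blockA p l ++ blockB p l))) (*-distribˡ-+ (2 ^ Γ n) _ _)))
      (block-bound l l<H ⊕ lists-bound l (≤-trans (n≤1+n l) l<H))

    bad-bound : 2 ^ Γ n * b n ≤ H * (2 * (C * c n))
    bad-bound = ≤-trans (2 ^ Γ n ⊗ Unique-⊆-length (Unique-filter⁺ _ (codes-unique n)) listed) (lists-bound H ≤-refl)
      where
      listed : ∀ {G} → G ∈ badL n → G ∈ lists p H
      listed {G} q = let (free , bad) = proj₂ (∈-filter⁻ (λ G → free? T G ×-dec ¬? (cliquePartition? R G)) {xs = codes n} q)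
        in bad-listed p G second≤ first≤ free bad

  bad-bound : ∀ C n → largeN ≤ n → (∀ j → j < n → f j ≤ C * c j) → 2 ^ Γ n * b n ≤ H * (2 * (C * c n))
  bad-bound C zero le _ = ⊥-elim (<⇒≱ largeN>0 le)
  bad-bound C (suc p) le ih = Step.bad-bound C p le ih

  Γ-large : ∀ w n → 8 * top * w ≤ n → w ≤ 2 ^ Γ n
  Γ-large w n le = ≤-trans (≤-trans (≤-reflexive (sym (m*n/m≡n (8 * top) w))) (/-mono-≤ le (≤-refl {8 * top}))) (<⇒≤ (k<2^k (Γ n)))

  -- The sum settles all `n` below `base`. The summand 2 is for the induction step: there the bad
  -- graphs number at most `C * c n / 2`, and `c n` itself is at most `C * c n / 2`.
  base C : ℕ
  base = largeN + 8 * top * (4 * H)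
  C = 2 + sumTo f base

  H>0 : 0 < H
  H>0 = ≤-trans η₁>0 first≤H

  free-bound : ∀ k n → n ≤ k → f n ≤ C * c n
  free-bound k n n≤k with base ≤? n
  ... | no small = ≤-trans (≤-trans (≤sumTo f (<⇒≤ (≰⇒> small))) (≤-trans (m≤n+m (sumTo f base) 2) (≤-reflexive (sym (*-identityʳ C))))) (C ⊗ good-exists n)
  free-bound zero n n≤k | yes big = ⊥-elim (<⇒≱ largeN>0 (≤-trans (≤-trans (m≤m+n largeN _) big) n≤k))
  free-bound (suc k) n n≤k | yes big = *-cancelˡ-≤ 2 (certify 0 (2 ⊗ f≤c+b n ⊕ half ⊕ *-monoˡ-≤ (c n) (m≤m+n 2 (sumTo f base))) (re (f n) (c n) (b n) C))
    where
    re : ∀ f c b C → 2 * f + (2 * (c + b) + C * c + C * c) + 0 ≡ 2 * (C * c) + (2 * f + 2 * b + 2 * c)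
    re = solve-∀
    bound : 2 ^ Γ n * b n ≤ H * (2 * (C * c n))
    bound = bad-bound C n (≤-trans (m≤m+n largeN _) big) (λ j j<n → free-bound k j (s≤s⁻¹ (≤-trans j<n n≤k)))
    half : 2 * b n ≤ C * c n
    half = *-cancelˡ-≤ (2 * H) ⦃ >-nonZero (≤-trans H>0 (m≤m+n H _)) ⦄ (≤-trans (≤-reflexive (re₁ H (b n)))
      (≤-trans (*-monoˡ-≤ (b n) (Γ-large (4 * H) n (≤-trans (m≤n+m _ largeN) big))) (≤-trans bound (≤-reflexive (re₂ H (C * c n))))))
      where
      re₁ : ∀ H b → 2 * H * (2 * b) ≡ 4 * H * b
      re₁ = solve-∀
      re₂ : ∀ H d → H * (2 * d) ≡ 2 * H * d
      re₂ = solve-∀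

  threshold : ℕ → ℕ
  threshold k = largeN + 8 * top * (k * (H * (2 * C)))

  few-bad : ∀ k n → threshold k ≤ n → k * b n ≤ f n
  few-bad k n le = ≤-trans (*-cancelˡ-≤ (2 ^ Γ n) ⦃ >-nonZero (m^n>0 2 (Γ n)) ⦄ (begin
    2 ^ Γ n * (k * b n)  ≡⟨ re₁ (2 ^ Γ n) k (b n) ⟩
    k * (2 ^ Γ n * b n)  ≤⟨ k ⊗ bad-bound C n (≤-trans (m≤m+n largeN _) le) (λ j _ → free-bound j j ≤-refl) ⟩
    k * (H * (2 * (C * c n)))  ≡⟨ re₂ k H C (c n) ⟩
    k * (H * (2 * C)) * c n  ≤⟨ *-monoˡ-≤ (c n) (Γ-large (k * (H * (2 * C))) n (≤-trans (m≤n+m _ largeN) le)) ⟩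
    2 ^ Γ n * c n ∎)) (c≤f n)
    where
    open ≤-Reasoning
    re₁ : ∀ g k b → g * (k * b) ≡ k * (g * b)
    re₁ = solve-∀
    re₂ : ∀ k H C c → k * (H * (2 * (C * c))) ≡ k * (H * (2 * C)) * c
    re₂ = solve-∀

  Good : ∀ {n} → Code n → Set
  Good G = CliquePartition G R

  inject : ∀ k n → k * b n ≤ f n → (Fin k × BadFreeGraphs T Good n) ↣ FreeGraphs T n
  inject k n le = mk↣ {to = to} injective
    where
    bad? : (G : Code n) → Dec (Free T G × ¬ Good G)
    bad? G = free? T G ×-dec ¬? (cliquePartition? R G)
    -- The proof stored in the refinement is irrelevant; decidability of badness recovers a usable
    -- one.
    listed : (G : BadFreeGraphs T Good n) → value G ∈ badL n
    listed (G , [ p ]) = ∈-filter⁺ bad? (codes-complete G) (recompute (bad? G) p)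
    index : BadFreeGraphs T Good n → Fin (b n)
    index G = proj₁ (∈-index (listed G))
    position : Fin k × BadFreeGraphs T Good n → Fin (f n)
    position (i , G) = inject≤ (combine i (index G)) le
    to : Fin k × BadFreeGraphs T Good n → FreeGraphs T n
    to x = lookup (freeL n) (position x) , [ proj₂ (∈-filter⁻ (free? T) {xs = codes n} (∈-lookup (position x))) ]
    index-injective : ∀ G H → index G ≡ index H → value G ≡ value H
    index-injective G H e = trans (sym (proj₂ (∈-index (listed G)))) (trans (cong (lookup (badL n)) e) (proj₂ (∈-index (listed H))))
    value-injective : ∀ (G H : BadFreeGraphs T Good n) → value G ≡ value H → G ≡ H
    value-injective (G , _) (_ , _) refl = refl
    injective : Injective _≡_ _≡_ to
    injective {i , G} {j , H} e = let (p , q) = combine-injective i (index G) j (index H) (inject≤-injective le le _ _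
                                        (Unique-lookup (free-unique n) (position (i , G)) (position (j , H)) (cong value e)))
      in cong₂ _,_ p (value-injective G H (index-injective G H q))

mainTheorem2 : ∀ {m} (T : Code m) (a : ℕ) → IsTree T → IsStabilityNumber T a → 3 ≤ a →
    ¬ HasPerfectMatching T → ¬ IsSubdividedStar T →
    AlmostEveryFree T (λ G → CliquePartition G (a ∸ 1))
mainTheorem2 T (suc (suc (suc r))) isTree stab (s≤s (s≤s (s≤s z≤n))) noPM noSS k =
  threshold k , λ n le → inject k n (few-bad k n le)
  where open Assembly T isTree stab noPM noSS
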